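{- Let $G=(V,E^+,E^-)$ be a signed graph such that $G^+=(V,E^+)$ is a circuit. Then the flow clutter $\mathcal F$ of $G$ is ideal if and only if $G$ has no odd flow-circuit strong minor $C=(V_C,E_C^+,E_C^-)$ with $|E_C^+|\ge5$.
   Context: A signed graph $G=(V,E^+,E^-)$ is a (multi)graph with edge set $E=E^+\cup E^-$ partitioned into positive and negative edges. A circuit is a cycle without repeated vertices (as an edge set); a flow is a circuit with exactly one negative edge. The flow clutter $\mathcal F$ is the family of edge sets of flows of $G$; it is ideal if the polyhedron $\{x\in\mathbb R^E: x\ge0,\ \sum_{e\in C}x_e\ge1\ \forall C\in\mathcal F\}$ is integral. A strong minor of $G$ is a signed graph obtained from $G$ by a sequence of contractions of positive edges and deletions of arbitrary edges, such that no self-loops arise. A flow-circuit is a signed graph $C=(V_C,E_C^+,E_C^-)$ on vertices $v_1,\dots,v_k$, $k\ge3$, with positive edges $v_iv_{i+1}$ ($1\le i\le k-1$) and $v_kv_1$, and negative edges $v_iv_{i+2}$ ($1\le i\le k-2$), $v_{k-1}v_1$ and $v_kv_2$; it is odd if $k$ is odd. $G$ has an odd flow-circuit strong minor $C$ if some strong minor of $G$ is isomorphic (as a signed graph) to the odd flow-circuit $C$.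
   Formalization: The polyhedron is taken in the rational space instead of the real one, and integrality means that each of its rational extreme points is integral; since the defining inequalities are rational, this agrees with integrality of the real polyhedron. -}

module Defs where

open import Data.Nat as ℕ using (ℕ; zero; suc; _≤_; NonZero)
open import Data.Nat.DivMod using (_mod_)
open import Data.Nat.Divisibility using (_∣_)
open import Data.Fin as Fin using (Fin; toℕ; punchIn; punchOut; splitAt)
open import Data.Fin.Properties using () renaming (_≟_ to _≟F_)
open import Data.Bool using (Bool; true; false)
open import Data.Integer using (ℤ)
open import Data.Rational as ℚ using (ℚ; 0ℚ; 1ℚ; ½)
open import Data.Product using (Σ; ∃; ∃-syntax; _×_; _,_; proj₁; proj₂)
open import Data.Sum using (_⊎_; inj₁; inj₂)
open import Relation.Binary.PropositionalEquality using (_≡_; _≢_; refl)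
open import Relation.Nullary using (¬_; yes; no)
open import Function using (_∘_)
open import Function.Bundles using (_↔_; Inverse)
open import Function.Definitions using (Injective)

-- Signed (multi)graphs: vertices Fin n, edges Fin m.  Each edge has an
-- (unordered) pair of endpoints, stored as an ordered pair, and a sign
-- (pos e ≡ true : positive edge, pos e ≡ false : negative edge).
-- Parallel edges and loops are allowed.

record SGraph (n m : ℕ) : Set where
  field
    ends : Fin m → Fin n × Fin n
    pos  : Fin m → Bool
open SGraph public

Joins : ∀ {n m} → SGraph n m → Fin m → Fin n → Fin n → Set
Joins G e a b = ends G e ≡ (a , b) ⊎ ends G e ≡ (b , a)

next : ∀ {l} → Fin (suc l) → Fin (suc l)
next {l} i = (suc (toℕ i)) mod (suc l)

-- Circuits: cycles without repeated vertices, of length suc l ≥ 1,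
-- given by an injective cyclic vertex sequence and an injective edge
-- sequence, edge i joining vertex i and vertex i+1 (mod length).
-- The circuit (as an edge set) is the image of es.

record Circuit {n m} (G : SGraph n m) : Set where
  field
    len   : ℕ                      -- the circuit has suc len edges
    vs    : Fin (suc len) → Fin n
    es    : Fin (suc len) → Fin m
    vsInj : Injective _≡_ _≡_ vs
    esInj : Injective _≡_ _≡_ es
    joins : ∀ i → Joins G (es i) (vs i) (vs (next i))
open Circuit public

IsFlow : ∀ {n m} {G : SGraph n m} → Circuit G → Set
IsFlow {G = G} C =
  Σ (Fin (suc (len C))) λ i → pos G (es C i) ≡ false
    × (∀ j → pos G (es C j) ≡ false → j ≡ i)

PosIsCircuit : ∀ {n m} → SGraph n m → Set
PosIsCircuit {n} {m} G = Σ (Circuit G) λ C →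
    (∀ i → pos G (es C i) ≡ true)
  × (∀ (e : Fin m) → pos G e ≡ true → ∃[ i ] es C i ≡ e)
  × (∀ (v : Fin n) → ∃[ i ] vs C i ≡ v)

sumFin : ∀ {k} → (Fin k → ℚ) → ℚ
sumFin {zero}  f = 0ℚ
sumFin {suc k} f = f Fin.zero ℚ.+ sumFin (f ∘ Fin.suc)

InP : ∀ {n m} → SGraph n m → (Fin m → ℚ) → Set
InP {m = m} G x =
    (∀ (e : Fin m) → 0ℚ ℚ.≤ x e)
  × (∀ (C : Circuit G) → IsFlow C → 1ℚ ℚ.≤ sumFin (λ i → x (es C i)))

IsVertex : ∀ {n m} → SGraph n m → (Fin m → ℚ) → Set
IsVertex {m = m} G x = InP G x ×
  (∀ (y z : Fin m → ℚ) → InP G y → InP G z →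
     (∀ e → x e ≡ ½ ℚ.* (y e ℚ.+ z e)) → ∀ e → y e ≡ z e)

IsIntegral : ∀ {m} → (Fin m → ℚ) → Set
IsIntegral x = ∀ e → ∃[ t ] x e ≡ t ℚ./ 1

FlowIdeal : ∀ {n m} → SGraph n m → Set
FlowIdeal {m = m} G = ∀ (x : Fin m → ℚ) → IsVertex G x → IsIntegral x

deleteEdge : ∀ {n m} → SGraph n (suc m) → Fin (suc m) → SGraph n m
ends (deleteEdge G j) e = ends G (punchIn j e)
pos  (deleteEdge G j) e = pos G (punchIn j e)

merge : ∀ {n} (u v : Fin (suc n)) → u ≢ v → Fin (suc n) → Fin n
merge u v u≢v w with w ≟F v
... | yes _   = punchOut {i = v} {j = u} (λ v≡u → u≢v (Relation.Binary.PropositionalEquality.sym v≡u))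
... | no w≢v  = punchOut {i = v} {j = w} (λ v≡w → w≢v (Relation.Binary.PropositionalEquality.sym v≡w))

contractEdge : ∀ {n m} (G : SGraph (suc n) (suc m)) (j : Fin (suc m)) →
               proj₁ (ends G j) ≢ proj₂ (ends G j) → SGraph n m
ends (contractEdge G j u≢v) e =
  let u = proj₁ (ends G j) ; v = proj₂ (ends G j) ; p = ends G (punchIn j e)
  in merge u v u≢v (proj₁ p) , merge u v u≢v (proj₂ p)
pos (contractEdge G j u≢v) e = pos G (punchIn j e)

-- one step: delete any edge, or contract a positive non-loop edge j such
-- that no self-loop arises (no other edge joins the two endpoints of j)
data Step : ∀ {n m n' m'} → SGraph n m → SGraph n' m' → Set where
  del : ∀ {n m} (G : SGraph n (suc m)) (j : Fin (suc m)) → Step G (deleteEdge G j)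
  con : ∀ {n m} (G : SGraph (suc n) (suc m)) (j : Fin (suc m)) →
        pos G j ≡ true →
        (u≢v : proj₁ (ends G j) ≢ proj₂ (ends G j)) →
        (∀ e → e ≢ j → ¬ Joins G e (proj₁ (ends G j)) (proj₂ (ends G j))) →
        Step G (contractEdge G j u≢v)

data StrongMinor {n m} (G : SGraph n m) : ∀ {n' m'} → SGraph n' m' → Set where
  here  : StrongMinor G G
  there : ∀ {n' m' n'' m''} {H : SGraph n' m'} {K : SGraph n'' m''} →
          StrongMinor G H → Step H K → StrongMinor G K

record Iso {n m n' m'} (G : SGraph n m) (H : SGraph n' m') : Set where
  field
    fV : Fin n ↔ Fin n'
    fE : Fin m ↔ Fin m'
    signs : ∀ e → pos H (Inverse.to fE e) ≡ pos G e
    incid : ∀ e → Joins H (Inverse.to fE e)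
                    (Inverse.to fV (proj₁ (ends G e))) (Inverse.to fV (proj₂ (ends G e)))

flowCircuit : (k' : ℕ) → SGraph (suc k') (suc k' ℕ.+ suc k')
ends (flowCircuit k') e with splitAt (suc k') e
... | inj₁ i = i , (suc (toℕ i)) mod (suc k')
... | inj₂ i = i , (suc (suc (toℕ i))) mod (suc k')
pos (flowCircuit k') e with splitAt (suc k') e
... | inj₁ _ = true
... | inj₂ _ = false

-- G has an odd flow-circuit strong minor C with |E_C^+| ≥ 5
-- (C has k = suc k' vertices and k positive edges, k odd, k ≥ 5)
HasOddFlowCircuitMinor5 : ∀ {n m} → SGraph n m → Set
HasOddFlowCircuitMinor5 G =
  ∃[ k' ] (5 ≤ suc k') × ¬ (2 ∣ suc k') ×
    ∃[ n' ] ∃[ m' ] Σ (SGraph n' m') λ H → StrongMinor G H × Iso H (flowCircuit k')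

{-# OPTIONS --safe #-}

-- Cut the circuit G⁺ open into sequences of vertices V i and edges E i of period N;
-- the flows are then the negative edges together with either of their arcs, and a
-- weighting x gives vertex i the coordinate x (E 0) + … + x (E (i − 1)) on a circle
-- of length T.  At a vertex x of the polyhedron every quasi-periodic displacement of
-- the coordinates that respects the tight arcs is trivial.  For T < 2, rescaling
-- forces x = 0 on G⁺.  For T ≥ 2 write T = k / w in lowest terms: displacing the
-- class of 0 modulo 1/w forces all coordinates into (1/w)ℤ, and a chord of length 1
-- missing at some class a would allow the displacement that jumps only at a.  Hence
-- all k chords i → i + w of ℤ/k are present; for w = 1 this is integrality, and for
-- w ≥ 2 rounding ℤ/k to ℤ/r for a suitable odd r ≥ 5 turns them into chords
-- q → q + 2, which is an odd flow-circuit minor.  Conversely such a minor yields the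
-- vertex with weight ½ on its positive edges.
module Submission where

open import Defs
open import Data.Nat as ℕ using (ℕ; zero; suc; _+_; _*_; _∸_; _≤_; _<_; z≤n; s≤s; NonZero)
import Data.Nat.Properties as ℕ
open import Data.Nat.DivMod using (_mod_; _%_; _/_; m≡m%n+[m/n]*n; [m+kn]%n≡m%n; m%n<n; m<n⇒m%n≡m; n%n≡0)
open import Data.Nat.GCD using (module Bézout)
open import Data.Nat.Coprimality as Coprime using (Coprime)
open import Data.Nat.Divisibility as ∣ using (_∣_)
open import Data.Nat.Tactic.RingSolver using (solve-∀)
open import Data.Fin as Fin using (Fin; toℕ; fromℕ<; punchIn; punchOut; splitAt; _↑ˡ_; _↑ʳ_)
open import Data.Fin.Properties using (toℕ-injective; toℕ-fromℕ<; toℕ<n; injective⇒≤; any?;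
  punchIn-punchOut; punchOut-punchIn; punchIn-injective; punchInᵢ≢i; punchOut-cong;
  splitAt-↑ˡ; splitAt-↑ʳ; splitAt⁻¹-↑ˡ; splitAt⁻¹-↑ʳ) renaming (_≟_ to _≟F_)
open import Data.Integer as ℤ using (ℤ; _⊖_)
import Data.Integer.Properties as ℤ
import Data.Integer.Tactic.RingSolver as ℤSolver
open import Data.Bool using (Bool; true; false; if_then_else_)
import Data.Bool.Properties as Bool
open import Data.Rational as ℚ using (ℚ; 0ℚ; 1ℚ; ½)
import Data.Rational.Properties as ℚ
import Data.Rational.Unnormalised as ℚᵘ
import Data.Rational.Unnormalised.Properties as ℚᵘ
open import Data.Product using (Σ; ∃-syntax; _×_; _,_; proj₁; proj₂)
open import Data.Product.Properties using (≡-dec)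
open import Data.Sum using (_⊎_; inj₁; inj₂)
open import Data.Empty using (⊥; ⊥-elim)
open import Relation.Nullary using (¬_; Dec; yes; no; contradiction)
open import Relation.Nullary.Decidable using (map′; _×-dec_; _⊎-dec_; ¬?; dec⇒maybe)
open import Relation.Binary.PropositionalEquality
open import Function using (_∘_)
open import Function.Bundles using (_⇔_; Inverse; Injection; mk↔ₛ′; mk⇔)
open import Function.Definitions using (Injective)
open import Function.Properties.Inverse using (↔⇒↣)
open import Algebra.Properties.CommutativeMonoid.Sum ℕ.+-0-commutativeMonoid
  using (sum; sum-remove; sum-permute; sum-cong-≗; sum-replicate-zero)
import Tactic.RingSolver as RS
open import Tactic.RingSolver.Core.AlmostCommutativeRing using (AlmostCommutativeRing; fromCommutativeRing)

-- The threshold 2 comes from the two arcs of a negative edge `e`. If both are tight they add up to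
-- 2 · x e + T = 2, which for T ≥ 2 leaves only x e = 0; an edge of positive weight then has at most
-- one tight arc, and its own weight can absorb any displacement. So only the tight arcs of edges of
-- weight 0 constrain a displacement, and these have length exactly 1. Since k and w are coprime, i
-- → i + w is a single orbit on ℤ/k; one missing chord cuts it open, and a displacement may then
-- increase along it.
--
-- Rounding is t ↦ ⌊t r / k⌋. For every q some chord becomes q → q + 2 as soon as k ≤ r (w - 1) and
-- r (w + 1) ≤ 3 k. Oddness of r serves the converse: on an odd cycle, coordinates that gain 1 with
-- every two steps must gain ½ with each.
--
-- `Obstruction` speaks of the whole circuit although minors allow deletions. Contracting keeps the
-- number of positive edges minus that of vertices, deleting a positive edge lowers it, and it is 0
-- for both `G` and the flow circuit.

a+[s+t]*n : ∀ a s t n → a + (s + t) * n ≡ (a + s * n) + t * n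
a+[s+t]*n = solve-∀

a+b+c≡a+c+b : ∀ a b c → a + b + c ≡ a + c + b
a+b+c≡a+c+b = solve-∀

-- Congruence of natural numbers

infix 4 _≈_[mod_]

-- Multiples of the modulus on both sides avoid subtraction; below, -1 modulo `suc l` is accordingly
-- written `l`.
_≈_[mod_] : ℕ → ℕ → ℕ → Set
a ≈ b [mod N ] = ∃[ s ] ∃[ t ] a + s * N ≡ b + t * N

≈-refl : ∀ {N a} → a ≈ a [mod N ]
≈-refl = 0 , 0 , refl

≈-reflexive : ∀ {N a b} → a ≡ b → a ≈ b [mod N ]
≈-reflexive refl = ≈-refl

≈-sym : ∀ {N a b} → a ≈ b [mod N ] → b ≈ a [mod N ]
≈-sym (s , t , p) = t , s , sym p

≈-trans : ∀ {N a b c} → a ≈ b [mod N ] → b ≈ c [mod N ] → a ≈ c [mod N ]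
≈-trans {N} {a} {b} {c} (s , t , p) (s' , t' , p') = s + s' , t' + t , (begin
  a + (s + s') * N    ≡⟨ a+[s+t]*n a s s' N ⟩
  (a + s * N) + s' * N  ≡⟨ cong (_+ s' * N) p ⟩
  (b + t * N) + s' * N  ≡⟨ swap b t s' N ⟩
  (b + s' * N) + t * N  ≡⟨ cong (_+ t * N) p' ⟩
  (c + t' * N) + t * N  ≡⟨ a+[s+t]*n c t' t N ⟨
  c + (t' + t) * N ∎)
  where
  open ≡-Reasoning
  swap : ∀ b t s N → (b + t * N) + s * N ≡ (b + s * N) + t * N
  swap = solve-∀

≈-+ : ∀ {N a b c d} → a ≈ b [mod N ] → c ≈ d [mod N ] → (a + c) ≈ (b + d) [mod N ]
≈-+ {N} {a} {b} {c} {d} (s , t , p) (s' , t' , p') = s + s' , t + t' , (begin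
  a + c + (s + s') * N        ≡⟨ regroup a c s s' N ⟩
  (a + s * N) + (c + s' * N)  ≡⟨ cong₂ _+_ p p' ⟩
  (b + t * N) + (d + t' * N)  ≡⟨ regroup b d t t' N ⟨
  b + d + (t + t') * N ∎)
  where
  open ≡-Reasoning
  regroup : ∀ a c s s' N → a + c + (s + s') * N ≡ (a + s * N) + (c + s' * N)
  regroup = solve-∀

≈-suc : ∀ {N a b} → a ≈ b [mod N ] → suc a ≈ suc b [mod N ]
≈-suc = ≈-+ {a = 1} {b = 1} ≈-refl

≈-cancelˡ : ∀ {N a b} c → (c + a) ≈ (c + b) [mod N ] → a ≈ b [mod N ]
≈-cancelˡ {N} {a} {b} c (s , t , p) = s , t ,
  ℕ.+-cancelˡ-≡ c _ _ (trans (sym (ℕ.+-assoc c a _)) (trans p (ℕ.+-assoc c b _)))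

≈-pred : ∀ {N a b} → suc a ≈ suc b [mod N ] → a ≈ b [mod N ]
≈-pred = ≈-cancelˡ 1

≈-cancelʳ : ∀ {N a b} c → (a + c) ≈ (b + c) [mod N ] → a ≈ b [mod N ]
≈-cancelʳ {N} {a} {b} c p =
  ≈-cancelˡ c (subst₂ (λ x y → x ≈ y [mod N ]) (ℕ.+-comm a c) (ℕ.+-comm b c) p)

≈-+N : ∀ {N} a s → (a + s * N) ≈ a [mod N ]
≈-+N a s = 0 , s , ℕ.+-identityʳ _

≈-period : ∀ {N} a → a + N ≈ a [mod N ]
≈-period {N} a = 0 , 1 , trans (ℕ.+-identityʳ _) (cong (a +_) (sym (ℕ.+-identityʳ N)))

≈-suc-period : ∀ {l} a → suc (a + l) ≈ a [mod suc l ]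
≈-suc-period {l} a = ≈-trans (≈-reflexive (sym (ℕ.+-suc a l))) (≈-period a)

≈-* : ∀ {N a b} c → a ≈ b [mod N ] → (c * a) ≈ (c * b) [mod N ]
≈-* zero p = ≈-refl
≈-* (suc c) p = ≈-+ p (≈-* c p)

≈-split : ∀ {N a b} → a ≈ b [mod N ] → (∃[ s ] a ≡ b + s * N) ⊎ (∃[ s ] b ≡ a + s * N)
≈-split {N} {a} {b} (s , t , p) with ℕ.≤-total s t
... | inj₁ s≤t = inj₁ (t ∸ s , ℕ.+-cancelʳ-≡ (s * N) _ _ (begin
  a + s * N                  ≡⟨ p ⟩
  b + t * N                  ≡⟨ cong (λ z → b + z * N) (ℕ.m∸n+n≡m s≤t) ⟨
  b + (t ∸ s + s) * N        ≡⟨ a+[s+t]*n b (t ∸ s) s N ⟩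
  b + (t ∸ s) * N + s * N ∎))
  where
  open ≡-Reasoning
... | inj₂ t≤s = inj₂ (s ∸ t , ℕ.+-cancelʳ-≡ (t * N) _ _ (begin
  b + t * N                  ≡⟨ p ⟨
  a + s * N                  ≡⟨ cong (λ z → a + z * N) (ℕ.m∸n+n≡m t≤s) ⟨
  a + (s ∸ t + t) * N        ≡⟨ a+[s+t]*n a (s ∸ t) t N ⟩
  a + (s ∸ t) * N + t * N ∎))
  where
  open ≡-Reasoning

≈⇒≡ : ∀ {N a b} → a < N → b < N → a ≈ b [mod N ] → a ≡ b
≈⇒≡ {N} {a} {b} a<N b<N p with ≈-split p
... | inj₁ (zero , q) = trans q (ℕ.+-identityʳ b)
... | inj₂ (zero , q) = sym (trans q (ℕ.+-identityʳ a))
... | inj₁ (suc s , refl) = ⊥-elim (ℕ.<⇒≱ a<N (ℕ.≤-trans (ℕ.m≤m+n N (s * N)) (ℕ.m≤n+m _ b)))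
... | inj₂ (suc s , refl) = ⊥-elim (ℕ.<⇒≱ b<N (ℕ.≤-trans (ℕ.m≤m+n N (s * N)) (ℕ.m≤n+m _ a)))

%⇒≈ : ∀ {l a b} → a % suc l ≡ b % suc l → a ≈ b [mod suc l ]
%⇒≈ {l} {a} {b} p = b / suc l , a / suc l , (begin
  a + b / N * N                   ≡⟨ cong (_+ b / N * N) (m≡m%n+[m/n]*n a N) ⟩
  a % N + a / N * N + b / N * N   ≡⟨ cong (λ z → z + a / N * N + b / N * N) p ⟩
  b % N + a / N * N + b / N * N   ≡⟨ a+b+c≡a+c+b (b % N) (a / N * N) (b / N * N) ⟩
  b % N + b / N * N + a / N * N   ≡⟨ cong (_+ a / N * N) (m≡m%n+[m/n]*n b N) ⟨
  b + a / N * N ∎)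
  where
  open ≡-Reasoning
  N = suc l

≈⇒% : ∀ {l a b} → a ≈ b [mod suc l ] → a % suc l ≡ b % suc l
≈⇒% {l} {a} {b} (s , t , p) =
  trans (sym ([m+kn]%n≡m%n a s (suc l))) (trans (cong (_% suc l) p) ([m+kn]%n≡m%n b t (suc l)))

%≈ : ∀ {l} a → (a % suc l) ≈ a [mod suc l ]
%≈ {l} a = a / suc l , 0 , trans (sym (m≡m%n+[m/n]*n a (suc l))) (sym (ℕ.+-identityʳ a))

toℕ-mod : ∀ {l} i → toℕ (i mod suc l) ≡ i % suc l
toℕ-mod {l} i = toℕ-fromℕ< (m%n<n i (suc l))

mod-cong : ∀ {l i j} → i ≈ j [mod suc l ] → i mod suc l ≡ j mod suc l
mod-cong {l} {i} {j} p = toℕ-injective (trans (toℕ-mod i) (trans (≈⇒% p) (sym (toℕ-mod j))))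

toℕ-mod≈ : ∀ {l} i → toℕ (i mod suc l) ≈ i [mod suc l ]
toℕ-mod≈ i = ≈-trans (≈-reflexive (toℕ-mod i)) (%≈ i)

mod-injective : ∀ {l i j} → i mod suc l ≡ j mod suc l → i ≈ j [mod suc l ]
mod-injective {l} {i} {j} p =
  %⇒≈ (trans (sym (toℕ-mod i)) (trans (cong toℕ p) (toℕ-mod j)))

mod-toℕ : ∀ {l} (i : Fin (suc l)) → toℕ i mod suc l ≡ i
mod-toℕ {l} i = toℕ-injective (trans (toℕ-mod (toℕ i)) (m<n⇒m%n≡m (toℕ<n i)))

next-mod : ∀ {l} i → next (i mod suc l) ≡ suc i mod suc l
next-mod i = mod-cong (≈-suc (toℕ-mod≈ i))

-- Incidence and the unrolled positive circuit

Joins-sym : ∀ {n m} {G : SGraph n m} {e a b} → Joins G e a b → Joins G e b a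
Joins-sym (inj₁ p) = inj₂ p
Joins-sym (inj₂ p) = inj₁ p

Joins-unique : ∀ {n m} {G : SGraph n m} {e a b c d} → Joins G e a b → Joins G e c d →
  (a ≡ c × b ≡ d) ⊎ (a ≡ d × b ≡ c)
Joins-unique (inj₁ p) (inj₁ q) with refl ← trans (sym p) q = inj₁ (refl , refl)
Joins-unique (inj₁ p) (inj₂ q) with refl ← trans (sym p) q = inj₂ (refl , refl)
Joins-unique (inj₂ p) (inj₁ q) with refl ← trans (sym p) q = inj₂ (refl , refl)
Joins-unique (inj₂ p) (inj₂ q) with refl ← trans (sym p) q = inj₁ (refl , refl)

-- The positive circuit, unrolled to sequences of period N = suc l.
record Circle {n m} (G : SGraph n m) : Set where
  field
    l       : ℕ
    V       : ℕ → Fin n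
    E       : ℕ → Fin m
    V-cong  : ∀ {i j} → i ≈ j [mod suc l ] → V i ≡ V j
    V-inj   : ∀ {i j} → V i ≡ V j → i ≈ j [mod suc l ]
    E-cong  : ∀ {i j} → i ≈ j [mod suc l ] → E i ≡ E j
    E-inj   : ∀ {i j} → E i ≡ E j → i ≈ j [mod suc l ]
    E-joins : ∀ i → Joins G (E i) (V i) (V (suc i))
    E-pos   : ∀ i → pos G (E i) ≡ true
    idx     : Fin n → ℕ
    idx<    : ∀ v → idx v < suc l
    V-idx   : ∀ v → V (idx v) ≡ v
    eidx    : ∀ e → pos G e ≡ true → ∃[ i ] (i < suc l) × (E i ≡ e)
    N≤n     : suc l ≤ n
  N : ℕ
  N = suc l

unroll : ∀ {n m} {G : SGraph n m} → PosIsCircuit G → Circle G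
unroll {n} {m} {G} (C , allpos , onE , onV) = record
  { l = len C
  ; V = λ i → vs C (i mod L)
  ; E = λ i → es C (i mod L)
  ; V-cong = λ p → cong (vs C) (mod-cong p)
  ; V-inj = λ p → mod-injective (vsInj C p)
  ; E-cong = λ p → cong (es C) (mod-cong p)
  ; E-inj = λ p → mod-injective (esInj C p)
  ; E-joins = λ i → subst (λ j → Joins G (es C (i mod L)) (vs C (i mod L)) (vs C j))
                      (next-mod i) (joins C (i mod L))
  ; E-pos = λ i → allpos _
  ; idx = λ v → toℕ (proj₁ (onV v))
  ; idx< = λ v → toℕ<n _
  ; V-idx = λ v → trans (cong (vs C) (mod-toℕ _)) (proj₂ (onV v))
  ; eidx = λ e p → toℕ (proj₁ (onE e p)) , toℕ<n _ ,
                   trans (cong (es C) (mod-toℕ _)) (proj₂ (onE e p))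
  ; N≤n = injective⇒≤ (vsInj C)
  }
  where L = suc (len C)

-- Slow sequences and walks on a cycle

Slow : (ℕ → ℕ) → ℕ → Set
Slow Q s = Q (suc s) ≡ Q s ⊎ Q (suc s) ≡ suc (Q s)

slow-≤ : ∀ {Q s} → Slow Q s → Q s ≤ Q (suc s)
slow-≤ (inj₁ p) = ℕ.≤-reflexive (sym p)
slow-≤ (inj₂ p) = ℕ.≤-trans (ℕ.n≤1+n _) (ℕ.≤-reflexive (sym p))

-- Discrete intermediate value theorem; the step found is the one that leaves the value `q`.
crossing : ∀ (Q : ℕ → ℕ) r → (∀ s → s < r → Slow Q s) → ∀ q → Q 0 ≤ q → q < Q r →
           ∃[ s ] (s < r) × (Q s ≡ q) × (Q (suc s) ≡ suc q)
crossing Q zero slow q lo hi = contradiction lo (ℕ.<⇒≱ hi)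
crossing Q (suc r) slow q lo hi with q ℕ.<? Q r
... | yes q<Qr with s , s<r , a , b ← crossing Q r (λ s s<r → slow s (ℕ.m<n⇒m<1+n s<r)) q lo q<Qr
      = s , ℕ.m<n⇒m<1+n s<r , a , b
... | no q≮Qr with slow r (ℕ.n<1+n r)
...   | inj₁ stay = contradiction (subst (q <_) stay hi) q≮Qr
...   | inj₂ up = r , ℕ.n<1+n r , Qr≡q , trans up (cong suc Qr≡q)
  where Qr≡q = ℕ.≤-antisym (ℕ.≮⇒≥ q≮Qr) (ℕ.≤-pred (subst (q <_) up hi))

slow-mono≤ : ∀ (Q : ℕ → ℕ) r → (∀ s → s < r → Slow Q s) → ∀ {i} → i ≤ r → Q i ≤ Q r
slow-mono≤ Q zero slow z≤n = ℕ.≤-refl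
slow-mono≤ Q (suc r) slow {i} i≤ with ℕ.m≤n⇒m<n∨m≡n i≤
... | inj₂ refl = ℕ.≤-refl
... | inj₁ i<sr = ℕ.≤-trans (slow-mono≤ Q r (λ s s<r → slow s (ℕ.m<n⇒m<1+n s<r)) (ℕ.≤-pred i<sr))
                    (slow-≤ {Q} {r} (slow r (ℕ.n<1+n r)))

Across : ℕ → ℕ → ℕ → ℕ → Set
Across N a b g = (a ≈ g [mod N ] × b ≈ suc g [mod N ]) ⊎ (a ≈ suc g [mod N ] × b ≈ g [mod N ])

-- A walk α on the cycle ℤ/N, where step s either stays put or traverses the
-- edge γ s (joining γ s and γ s + 1); Q counts the traversals.
record Trail (N r : ℕ) (α γ Q : ℕ → ℕ) : Set where
  field
    start    : Q 0 ≡ 0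
    move     : ∀ s → s < r → (Q (suc s) ≡ Q s × α (suc s) ≈ α s [mod N ])
                           ⊎ (Q (suc s) ≡ suc (Q s) × Across N (α s) (α (suc s)) (γ s))
    distinct : ∀ s t → s < t → t < r → Q (suc s) ≡ suc (Q s) → Q (suc t) ≡ suc (Q t) →
               ¬ (γ s ≈ γ t [mod N ])

-- `u` is the class of the starting vertex. A backward walk is at u - Q s, written additively; the
-- `suc` is there because an edge carries the index of its lower end, while a backward step leaves
-- from its upper end.
Forward Backward : (N r : ℕ) (α γ Q : ℕ → ℕ) (u : ℕ) → Set
Forward N r α γ Q u =
    (∀ s → s ≤ r → α s ≈ u + Q s [mod N ])
  × (∀ s → s < r → Q (suc s) ≡ suc (Q s) → γ s ≈ u + Q s [mod N ])
Backward N r α γ Q u =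
    (∀ s → s ≤ r → (α s + Q s) ≈ u [mod N ])
  × (∀ s → s < r → Q (suc s) ≡ suc (Q s) → suc (γ s + Q s) ≈ u [mod N ])

Trail-init : ∀ {N r α γ Q} → Trail N (suc r) α γ Q → Trail N r α γ Q
Trail-init T = record
  { start = start
  ; move = λ s s<r → move s (ℕ.m<n⇒m<1+n s<r)
  ; distinct = λ s t s<t t<r → distinct s t s<t (ℕ.m<n⇒m<1+n t<r)
  } where open Trail T

Trail-slow : ∀ {N r α γ Q} → Trail N r α γ Q → ∀ s → s < r → Slow Q s
Trail-slow T s s<r with Trail.move T s s<r
... | inj₁ (p , _) = inj₁ p
... | inj₂ (p , _) = inj₂ p

-- Turning round would traverse the last edge twice.
trail-monotone : ∀ {N} r {α γ Q} → Trail N r α γ Q →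
  (∃[ u ] Forward N r α γ Q u) ⊎ (∃[ u ] Backward N r α γ Q u)
trail-monotone zero {α} {γ} {Q} T = inj₁ (α 0 , (λ { zero z≤n → ≈-reflexive (sym (trans (cong (α 0 +_) (Trail.start T)) (ℕ.+-identityʳ _))) }) , λ _ ())
trail-monotone {N} (suc r) {α} {γ} {Q} T = extend (trail-monotone r (Trail-init T)) (move r ℕ.≤-refl)
  where
  open Trail T

  snoc : ∀ {ℓ} {P : ℕ → Set ℓ} → (∀ s → s ≤ r → P s) → P (suc r) → ∀ s → s ≤ suc r → P s
  snoc f p s s≤ with ℕ.m≤n⇒m<n∨m≡n s≤
  ... | inj₁ s<sr = f s (ℕ.≤-pred s<sr)
  ... | inj₂ refl = p

  snoc< : ∀ {ℓ} {P : ℕ → Set ℓ} → (∀ s → s < r → P s) → P r → ∀ s → s < suc r → P s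
  snoc< f p s (s≤s s≤r) with ℕ.m≤n⇒m<n∨m≡n s≤r
  ... | inj₁ s<r = f s s<r
  ... | inj₂ refl = p

  +suc : ∀ u q → u + suc q ≈ suc (u + q) [mod N ]
  +suc u q = ≈-reflexive (ℕ.+-suc u q)

  last : ∀ q → Q r ≡ suc q → ∃[ s ] (s < r) × (Q s ≡ q) × (Q (suc s) ≡ suc q)
  last q Qr = crossing Q r (Trail-slow (Trail-init T)) q (subst (_≤ q) (sym start) z≤n)
                (subst (q <_) (sym Qr) ℕ.≤-refl)

  unmoved : Q r ≡ 0 → ∀ s → s ≤ r → Q s ≡ 0
  unmoved Qr s s≤r = ℕ.n≤0⇒n≡0 (subst (Q s ≤_) Qr (slow-mono≤ Q r (Trail-slow (Trail-init T)) s≤r))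

  noCross : ∀ {A : ℕ → Set} → Q r ≡ 0 → ∀ s → s < r → Q (suc s) ≡ suc (Q s) → A s
  noCross Qr s s<r up with trans (sym (unmoved Qr (suc s) s<r)) up
  ... | ()

  extend : (∃[ u ] Forward N r α γ Q u) ⊎ (∃[ u ] Backward N r α γ Q u) →
    (Q (suc r) ≡ Q r × α (suc r) ≈ α r [mod N ]) ⊎ (Q (suc r) ≡ suc (Q r) × Across N (α r) (α (suc r)) (γ r)) →
    (∃[ u ] Forward N (suc r) α γ Q u) ⊎ (∃[ u ] Backward N (suc r) α γ Q u)
  stepF : ∀ u → Forward N r α γ Q u → Q (suc r) ≡ suc (Q r) → α r ≈ γ r [mod N ] → α (suc r) ≈ suc (γ r) [mod N ] →
    Forward N (suc r) α γ Q u
  stepF u (f , g) up a b = snoc f (≈-trans b (≈-trans (≈-suc γr) (≈-reflexive (sym (trans (cong (u +_) up) (ℕ.+-suc u _))))))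
                         , snoc< g (λ _ → γr)
    where γr = ≈-trans (≈-sym a) (f r ℕ.≤-refl)
  stepB : ∀ u → Backward N r α γ Q u → Q (suc r) ≡ suc (Q r) → α r ≈ suc (γ r) [mod N ] → α (suc r) ≈ γ r [mod N ] →
    Backward N (suc r) α γ Q u
  stepB u (f , g) up a b = snoc f (≈-trans (≈-+ b (≈-reflexive up)) (≈-trans (+suc _ _) γr))
                         , snoc< g (λ _ → γr)
    where γr = ≈-trans (≈-+ {c = Q r} (≈-sym a) ≈-refl) (f r ℕ.≤-refl)

  extend (inj₁ (u , f , g)) (inj₁ (stay , a)) =
    inj₁ (u , snoc f (≈-trans a (≈-trans (f r ℕ.≤-refl) (≈-reflexive (cong (u +_) (sym stay)))))
            , snoc< g (λ up → ⊥-elim (ℕ.1+n≢n (trans (sym up) stay))))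
  extend (inj₂ (u , f , g)) (inj₁ (stay , a)) =
    inj₂ (u , snoc f (≈-trans (≈-+ a (≈-reflexive stay)) (f r ℕ.≤-refl))
            , snoc< g (λ up → ⊥-elim (ℕ.1+n≢n (trans (sym up) stay))))
  extend (inj₁ (u , F)) (inj₂ (up , inj₁ (a , b))) = inj₁ (u , stepF u F up a b)
  extend (inj₂ (u , B)) (inj₂ (up , inj₂ (a , b))) = inj₂ (u , stepB u B up a b)
  extend (inj₁ (u , F@(f , g))) (inj₂ (up , inj₂ (a , b))) with Q r in Qr
  -- Without any traversal so far the walk has stood still, so it may be regarded as backward just
  -- as well.
  ... | zero = inj₂ (u , stepB u ((λ s s≤r → ≈-trans (≈-+ (f s s≤r) (≈-reflexive (unmoved Qr s s≤r)))
                                               (≈-reflexive (trans (ℕ.+-identityʳ _) (trans (cong (u +_) (unmoved Qr s s≤r)) (ℕ.+-identityʳ u)))))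
                              , noCross Qr) (trans up (cong suc (sym Qr))) a b)
  ... | suc q with s , s<r , Qs , Qs' ← last q Qr =
    ⊥-elim (distinct s r s<r ℕ.≤-refl (trans Qs' (cong suc (sym Qs))) (trans up (cong suc (sym Qr)))
      (≈-pred (≈-trans (≈-suc (g s s<r (trans Qs' (cong suc (sym Qs)))))
        (≈-trans (≈-reflexive (trans (cong (λ z → suc (u + z)) Qs) (trans (sym (ℕ.+-suc u q)) (cong (u +_) (sym Qr)))))
          (≈-trans (≈-sym (f r ℕ.≤-refl)) a)))))
  extend (inj₂ (u , B@(f , g))) (inj₂ (up , inj₁ (a , b))) with Q r in Qr
  ... | zero = inj₁ (u , stepF u ((λ s s≤r → ≈-trans (≈-reflexive (sym (trans (cong (α s +_) (unmoved Qr s s≤r)) (ℕ.+-identityʳ _))))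
                                               (≈-trans (f s s≤r) (≈-reflexive (sym (trans (cong (u +_) (unmoved Qr s s≤r)) (ℕ.+-identityʳ u))))))
                              , noCross Qr) (trans up (cong suc (sym Qr))) a b)
  ... | suc q with s , s<r , Qs , Qs' ← last q Qr =
    ⊥-elim (distinct s r s<r ℕ.≤-refl (trans Qs' (cong suc (sym Qs))) (trans up (cong suc (sym Qr)))
      (≈-cancelʳ (suc q) (≈-trans (≈-reflexive (trans (ℕ.+-suc _ q) (cong (λ z → suc (γ s + z)) (sym Qs))))
        (≈-trans (g s s<r (trans Qs' (cong suc (sym Qs)))) (≈-trans (≈-sym (f r ℕ.≤-refl))
          (≈-+ a (≈-reflexive Qr)))))))

-- Flows and arcs

ℚ-ring : AlmostCommutativeRing _ _
ℚ-ring = fromCommutativeRing ℚ.+-*-commutativeRing (λ x → dec⇒maybe (0ℚ ℚ.≟ x))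

a+b-a≡b : ∀ a b → (a ℚ.+ b) ℚ.- a ≡ b
a+b-a≡b = RS.solve-∀ ℚ-ring

b≡a+b-a : ∀ a b → b ≡ (a ℚ.+ b) ℚ.- a
b≡a+b-a a b = sym (a+b-a≡b a b)

a≡b+[a-b] : ∀ a b → a ≡ b ℚ.+ (a ℚ.- b)
a≡b+[a-b] = RS.solve-∀ ℚ-ring

differences-add : ∀ a b c → (a ℚ.- b) ℚ.+ (c ℚ.- a) ≡ c ℚ.- b
differences-add = RS.solve-∀ ℚ-ring

pre : (ℕ → ℚ) → ℕ → ℚ
pre f zero    = 0ℚ
pre f (suc i) = pre f i ℚ.+ f i

pre-cong : ∀ {f g} k → (∀ s → s < k → f s ≡ g s) → pre f k ≡ pre g k
pre-cong zero    p = refl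
pre-cong (suc k) p = cong₂ ℚ._+_ (pre-cong k (λ s s<k → p s (ℕ.m<n⇒m<1+n s<k))) (p k (ℕ.n<1+n k))

pre-head : ∀ f k → pre f (suc k) ≡ f 0 ℚ.+ pre (f ∘ suc) k
pre-head f zero    = ℚ.+-comm 0ℚ (f 0)
pre-head f (suc k) = trans (cong (ℚ._+ f (suc k)) (pre-head f k)) (ℚ.+-assoc (f 0) _ _)

pre-reverse : ∀ f k → pre (λ s → f (k ∸ suc s)) k ≡ pre f k
pre-reverse f zero    = refl
pre-reverse f (suc k) = trans (pre-head (λ s → f (k ∸ s)) k)
  (trans (ℚ.+-comm (f k) _) (cong (ℚ._+ f k) (pre-reverse f k)))

pre-rotate : ∀ f M → (∀ i → f (i + M) ≡ f i) → ∀ o → pre (λ s → f (o + s)) M ≡ pre f M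
pre-rotate f M per zero    = refl
pre-rotate f M per (suc o) = trans (shift _ (f o) _ (begin
  f o ℚ.+ pre (λ s → f (suc o + s)) M      ≡⟨ cong₂ ℚ._+_ (cong f (ℕ.+-identityʳ o)) (pre-cong M (λ s _ → cong f (ℕ.+-suc o s))) ⟨
  f (o + 0) ℚ.+ pre (λ s → f (o + suc s)) M  ≡⟨ pre-head (λ s → f (o + s)) M ⟨
  pre (λ s → f (o + s)) M ℚ.+ f (o + M)    ≡⟨ cong (pre (λ s → f (o + s)) M ℚ.+_) (per o) ⟩
  pre (λ s → f (o + s)) M ℚ.+ f o ∎)) (pre-rotate f M per o)
  where
  open ≡-Reasoning
  shift : ∀ a b c → b ℚ.+ a ≡ c ℚ.+ b → a ≡ c
  shift a b c p = ℚ-cancel (trans p (ℚ.+-comm c b))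
    where
    undo : ∀ a b → (b ℚ.+ a) ℚ.- b ≡ a
    undo = RS.solve-∀ ℚ-ring
    ℚ-cancel : b ℚ.+ a ≡ b ℚ.+ c → a ≡ c
    ℚ-cancel q = trans (sym (undo a b)) (trans (cong (ℚ._- b) q) (undo c b))

sumFin-pre : ∀ {k} (f : Fin k → ℚ) (g : ℕ → ℚ) → (∀ i → f i ≡ g (toℕ i)) → sumFin f ≡ pre g k
sumFin-pre {zero}  f g p = refl
sumFin-pre {suc k} f g p = trans
  (cong₂ ℚ._+_ (p Fin.zero) (sumFin-pre (f ∘ Fin.suc) (g ∘ suc) (p ∘ Fin.suc)))
  (sym (pre-head g k))

pre-telescope : ∀ (f Δ : ℕ → ℚ) u L → (∀ s → Δ (suc (u + s)) ≡ Δ (u + s) ℚ.+ f s) →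
  Δ u ℚ.+ pre f L ≡ Δ (u + L)
pre-telescope f Δ u zero    p = trans (ℚ.+-identityʳ (Δ u)) (cong Δ (sym (ℕ.+-identityʳ u)))
pre-telescope f Δ u (suc L) p = begin
  Δ u ℚ.+ (pre f L ℚ.+ f L)    ≡⟨ ℚ.+-assoc (Δ u) _ _ ⟨
  (Δ u ℚ.+ pre f L) ℚ.+ f L    ≡⟨ cong (ℚ._+ f L) (pre-telescope f Δ u L p) ⟩
  Δ (u + L) ℚ.+ f L            ≡⟨ p L ⟨
  Δ (suc (u + L))              ≡⟨ cong Δ (ℕ.+-suc u L) ⟨
  Δ (u + suc L) ∎
  where open ≡-Reasoning

module Flows {n m} {G : SGraph n m} (K : Circle G) where
  open Circle K public

  arcSum : (Fin m → ℚ) → ℕ → ℕ → ℚ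
  arcSum x u L = pre (λ s → x (E (u + s))) L

  -- `L = 0` is the case of a negative loop, which is a flow by itself. An edge that is not a loop
  -- has two arcs, one for each choice of its end as `V u`.
  record IsArc (e : Fin m) (u L : ℕ) : Set where
    constructor mkArc
    field
      neg    : pos G e ≡ false
      chord  : Joins G e (V u) (V (u + L))
      short  : L < N

  idx≈ : ∀ {i v} → V i ≡ v → idx v ≈ i [mod N ]
  idx≈ p = V-inj (trans (V-idx _) (sym p))

  V≡⇒idx≈ : ∀ {v w} → v ≡ V w → idx v ≈ w [mod N ]
  V≡⇒idx≈ p = idx≈ (sym p)

  private
    -- The value 0 at negative edges is a default.
    posIdx′ : ∀ e b → pos G e ≡ b → ℕ
    posIdx′ e true  p = proj₁ (eidx e p)
    posIdx′ e false p = 0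

    E-posIdx′ : ∀ e b p → b ≡ true → E (posIdx′ e b p) ≡ e
    E-posIdx′ e true p _ = proj₂ (proj₂ (eidx e p))

  posIdx : Fin m → ℕ
  posIdx e = posIdx′ e (pos G e) refl

  E-posIdx : ∀ e → pos G e ≡ true → E (posIdx e) ≡ e
  E-posIdx e = E-posIdx′ e (pos G e) refl

  posIdx-E : ∀ i → posIdx (E i) ≈ i [mod N ]
  posIdx-E i = E-inj (E-posIdx (E i) (E-pos i))

  module _ (C : Circuit G) (i₀ : Fin (suc (len C))) (neg₀ : pos G (es C i₀) ≡ false)
           (only₀ : ∀ j → pos G (es C j) ≡ false → j ≡ i₀) where
    private
      M L o : ℕ
      M = suc (len C)
      L = len C
      -- Reading starts just after the negative edge, so that the next `L` edges are positive and
      -- the negative one closes the circuit.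
      o = suc (toℕ i₀)
      A : ℕ → Fin n
      A j = vs C (j mod M)
      F : ℕ → Fin m
      F j = es C (j mod M)
      α γ : ℕ → ℕ
      α s = idx (A (o + s))
      γ s = posIdx (F (o + s))
      e = es C i₀

      F-pos : ∀ s → s < L → pos G (F (o + s)) ≡ true
      F-pos s s<L with pos G (F (o + s)) in p
      ... | true  = refl
      ... | false = ⊥-elim (ℕ.1+n≢0 (≈⇒≡ (s≤s s<L) (s≤s z≤n) back))
        where
        back : suc s ≈ 0 [mod M ]
        back = ≈-cancelˡ (toℕ i₀) (≈-trans (≈-reflexive (ℕ.+-suc (toℕ i₀) s))
          (≈-trans (≈-sym (toℕ-mod≈ (o + s))) (≈-reflexive (trans (cong toℕ (only₀ _ p)) (sym (ℕ.+-identityʳ (toℕ i₀)))))))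

      A-joins : ∀ j → Joins G (F j) (A j) (A (suc j))
      A-joins j = subst (λ k → Joins G (F j) (A j) (vs C k)) (next-mod j) (joins C (j mod M))

      trail : Trail N L α γ (λ s → s)
      trail = record { start = refl ; move = λ s s<L → inj₂ (refl , across s s<L) ; distinct = λ s t s<t t<L _ _ q →
        ℕ.<⇒≢ s<t (≈⇒≡ (ℕ.<-trans s<t (ℕ.m<n⇒m<1+n t<L)) (ℕ.m<n⇒m<1+n t<L) (≈-cancelˡ o (mod-injective (esInj C
          (trans (sym (E-posIdx _ (F-pos s (ℕ.<-trans s<t t<L)))) (trans (E-cong q) (E-posIdx _ (F-pos t t<L)))))))) }
        where
        across : ∀ s → s < L → Across N (α s) (α (suc s)) (γ s)
        across s s<L with Joins-unique {G = G} {e = F (o + s)} (A-joins (o + s)) (subst (λ z → Joins G z (V (γ s)) (V (suc (γ s)))) (E-posIdx _ (F-pos s s<L)) (E-joins (γ s)))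
        ... | inj₁ (p , q) = inj₁ (V≡⇒idx≈ p , V≡⇒idx≈ (trans (cong A (ℕ.+-suc o s)) q))
        ... | inj₂ (p , q) = inj₂ (V≡⇒idx≈ p , V≡⇒idx≈ (trans (cong A (ℕ.+-suc o s)) q))

      L<N : L < N
      L<N = injective⇒≤ {f = λ j → fromℕ< (idx< (vs C j))} inj
        where
        inj : Injective _≡_ _≡_ (λ j → fromℕ< (idx< (vs C j)))
        inj {i} {j} p = vsInj C (trans (sym (V-idx _)) (trans (cong V (trans (sym (toℕ-fromℕ< _)) (trans (cong toℕ p) (toℕ-fromℕ< _)))) (V-idx _)))

      i₀-mod : toℕ i₀ mod M ≡ i₀
      i₀-mod = mod-toℕ i₀

      around : o + L ≈ toℕ i₀ [mod M ]
      around = ≈-suc-period (toℕ i₀)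

      ends₀ : Joins G e (V (α L)) (V (α 0))
      ends₀ = subst₂ (Joins G e) (sym (trans (V-idx _) (cong (vs C) (mod-cong around))))
        (sym (trans (V-idx _) (cong A (ℕ.+-identityʳ o))))
        (subst (λ j → Joins G (es C j) (A (toℕ i₀)) (A o)) i₀-mod (A-joins (toℕ i₀)))

      sumC : ∀ x → sumFin (λ i → x (es C i)) ≡ x e ℚ.+ pre (λ s → x (E (γ s))) L
      sumC x = begin
        sumFin (λ i → x (es C i))           ≡⟨ sumFin-pre _ (x ∘ F) (λ i → cong (x ∘ es C) (sym (mod-toℕ i))) ⟩
        pre (x ∘ F) M                       ≡⟨ pre-rotate (x ∘ F) M (λ i → cong (x ∘ es C) (mod-cong (≈-period i))) (toℕ i₀) ⟨
        pre (λ s → x (F (toℕ i₀ + s))) M    ≡⟨ pre-head (λ s → x (F (toℕ i₀ + s))) L ⟩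
        x (F (toℕ i₀ + 0)) ℚ.+ pre (λ s → x (F (toℕ i₀ + suc s))) L
          ≡⟨ cong₂ ℚ._+_ (cong (x ∘ es C) (trans (cong (_mod M) (ℕ.+-identityʳ (toℕ i₀))) i₀-mod))
               (pre-cong L (λ s s<L → cong x (trans (cong F (ℕ.+-suc (toℕ i₀) s)) (sym (E-posIdx _ (F-pos s s<L)))))) ⟩
        x e ℚ.+ pre (λ s → x (E (γ s))) L ∎
        where
        open ≡-Reasoning

    -- The positive edges of a flow are distinct edges of the cycle, hence a trail that never turns
    -- round. A backward trail is read from its last vertex `α L`, which reverses the order of
    -- summation.
    flow⇒arc : ∃[ u ] ∃[ L ] IsArc e u L × (u < N) ×
               (∀ x → sumFin (λ i → x (es C i)) ≡ x e ℚ.+ arcSum x u L)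
    flow⇒arc with trail-monotone L trail
    ... | inj₁ (u₀ , f , g) = α 0 , L
        , mkArc neg₀ (Joins-sym {G = G} {e = e} (subst (λ v → Joins G e v (V (α 0))) (V-cong (≈-trans (f L ℕ.≤-refl) (≈-+ base ≈-refl))) ends₀)) L<N
        , idx< _
        , λ x → trans (sumC x) (cong (x e ℚ.+_) (pre-cong L (λ s s<L → cong x (E-cong (≈-trans (g s s<L refl) (≈-+ base ≈-refl))))))
      where
      base : u₀ ≈ α 0 [mod N ]
      base = ≈-sym (≈-trans (f 0 z≤n) (≈-reflexive (ℕ.+-identityʳ u₀)))
    ... | inj₂ (u₀ , f , g) = α L , L
        , mkArc neg₀ (subst (Joins G e (V (α L))) (V-cong base) ends₀) L<N
        , idx< _
        , λ x → trans (sumC x) (cong (x e ℚ.+_) (trans (pre-cong L (λ s s<L → cong x (E-cong (turned s s<L))))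
                  (pre-reverse (λ s → x (E (α L + s))) L)))
      where
      base : α 0 ≈ α L + L [mod N ]
      base = ≈-trans (≈-reflexive (sym (ℕ.+-identityʳ _))) (≈-trans (f 0 z≤n) (≈-sym (f L ℕ.≤-refl)))
      turned : ∀ s → s < L → γ s ≈ α L + (L ∸ suc s) [mod N ]
      turned s s<L = ≈-cancelʳ (suc s) (≈-trans (≈-reflexive (ℕ.+-suc (γ s) s)) (≈-trans (g s s<L refl)
        (≈-trans (≈-sym (f L ℕ.≤-refl)) (≈-reflexive (trans (cong (α L +_) (sym (ℕ.m∸n+n≡m s<L))) (sym (ℕ.+-assoc (α L) _ _)))))))

  arc⇒flow : ∀ {e u L} → IsArc e u L → Σ (Circuit G) λ C → IsFlow C ×
             (∀ x → sumFin (λ i → x (es C i)) ≡ x e ℚ.+ arcSum x u L)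
  arc⇒flow {e} {u} {L} (mkArc neg chord L<N) = C , flow , λ x → cong (x e ℚ.+_) (sumFin-pre {L} _ (λ s → x (E (u + s))) (λ _ → refl))
    where
    vsC : Fin (suc L) → Fin n
    vsC Fin.zero    = V (u + L)
    vsC (Fin.suc i) = V (u + toℕ i)
    esC : Fin (suc L) → Fin m
    esC Fin.zero    = e
    esC (Fin.suc i) = E (u + toℕ i)

    cancel : ∀ {i j} → i < N → j < N → u + i ≈ u + j [mod N ] → i ≡ j
    cancel i<N j<N p = ≈⇒≡ i<N j<N (≈-cancelˡ u p)

    toℕ<N : (i : Fin L) → toℕ i < N
    toℕ<N i = ℕ.<-trans (toℕ<n i) L<N

    vsC-inj : Injective _≡_ _≡_ vsC
    vsC-inj {Fin.zero}  {Fin.zero}  p = refl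
    vsC-inj {Fin.zero}  {Fin.suc j} p = ⊥-elim (ℕ.<⇒≢ (toℕ<n j) (sym (cancel L<N (toℕ<N j) (V-inj p))))
    vsC-inj {Fin.suc i} {Fin.zero}  p = ⊥-elim (ℕ.<⇒≢ (toℕ<n i) (cancel (toℕ<N i) L<N (V-inj p)))
    vsC-inj {Fin.suc i} {Fin.suc j} p = cong Fin.suc (toℕ-injective (cancel (toℕ<N i) (toℕ<N j) (V-inj p)))

    neg≢pos : ∀ {i} → e ≢ E i
    neg≢pos {i} refl with () ← trans (sym neg) (E-pos i)

    esC-inj : Injective _≡_ _≡_ esC
    esC-inj {Fin.zero}  {Fin.zero}  p = refl
    esC-inj {Fin.zero}  {Fin.suc j} p = ⊥-elim (neg≢pos p)
    esC-inj {Fin.suc i} {Fin.zero}  p = ⊥-elim (neg≢pos (sym p))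
    esC-inj {Fin.suc i} {Fin.suc j} p = cong Fin.suc (toℕ-injective (cancel (toℕ<N i) (toℕ<N j) (E-inj p)))

    vsC-next : ∀ i → vsC (next i) ≡ V (u + toℕ i)
    vsC-next i with ℕ.m≤n⇒m<n∨m≡n (toℕ<n i)
    ... | inj₁ (s≤s i<L) = trans (cong vsC (toℕ-injective {i = next i} {j = Fin.suc (fromℕ< i<L)}
            (trans (toℕ-mod (suc (toℕ i))) (trans (m<n⇒m%n≡m (s≤s i<L)) (cong suc (sym (toℕ-fromℕ< i<L)))))))
            (cong (λ z → V (u + z)) (toℕ-fromℕ< i<L))
    ... | inj₂ i≡L = trans (cong vsC (toℕ-injective {i = next i} {j = Fin.zero} (trans (toℕ-mod (suc (toℕ i))) (trans (cong (_% suc L) i≡L) (n%n≡0 (suc L))))))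
            (cong (λ z → V (u + z)) (sym (ℕ.suc-injective i≡L)))

    C : Circuit G
    C = record { len = L ; vs = vsC ; es = esC ; vsInj = vsC-inj ; esInj = esC-inj ; joins = joinsC }
      where
      joinsC : ∀ i → Joins G (esC i) (vsC i) (vsC (next i))
      joinsC Fin.zero    = subst (Joins G e (V (u + L))) (sym (trans (vsC-next Fin.zero) (cong V (ℕ.+-identityʳ u))))
                             (Joins-sym {G = G} {e = e} chord)
      joinsC (Fin.suc i) = subst (Joins G (E (u + toℕ i)) (V (u + toℕ i))) (sym (trans (vsC-next (Fin.suc i)) (cong V (ℕ.+-suc u (toℕ i)))))
                             (E-joins (u + toℕ i))

    flow : IsFlow C
    flow = Fin.zero , neg , only
      where
      only : ∀ j → pos G (esC j) ≡ false → j ≡ Fin.zero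
      only Fin.zero    _ = refl
      only (Fin.suc j) p with () ← trans (sym p) (E-pos (u + toℕ j))

  InP-arc : ∀ {x} → InP G x → ∀ {e u L} → IsArc e u L → 1ℚ ℚ.≤ x e ℚ.+ arcSum x u L
  InP-arc {x} (_ , inP) a with C , fl , s ← arc⇒flow a = subst (1ℚ ℚ.≤_) (s x) (inP C fl)

  arc-InP : ∀ {x} → (∀ e → 0ℚ ℚ.≤ x e) →
            (∀ {e u L} → IsArc e u L → u < N → 1ℚ ℚ.≤ x e ℚ.+ arcSum x u L) → InP G x
  arc-InP {x} nn arcs = nn , λ { C (i , neg , only) → flows C i neg only }
    where
    flows : ∀ C i (neg : pos G (es C i) ≡ false) (only : ∀ j → pos G (es C j) ≡ false → j ≡ i) →
            1ℚ ℚ.≤ sumFin (λ i → x (es C i))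
    flows C i neg only with u , L , a , u<N , s ← flow⇒arc C i neg only = subst (1ℚ ℚ.≤_) (sym (s x)) (arcs a u<N)

  -- If the two arcs start at opposite ends, L + L' is a multiple of `N` below 2 N. The multiple 0
  -- means a loop with both lengths 0 and falls under the first alternative.
  arc-unique : ∀ {e u L u' L'} → IsArc e u L → IsArc e u' L' →
    (u ≈ u' [mod N ] × L ≡ L') ⊎ (u + L ≈ u' [mod N ] × L + L' ≡ N)
  arc-unique {e} {u} {L} {u'} {L'} (mkArc _ c L<N) (mkArc _ c' L'<N) with Joins-unique {G = G} {e = e} c c'
  ... | inj₁ (p , q) = inj₁ (V-inj p , ≈⇒≡ L<N L'<N (≈-cancelˡ u (≈-trans (V-inj q) (≈-+ (≈-sym (V-inj p)) ≈-refl))))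
  ... | inj₂ (p , q) = around (≈-split wind)
    where
    wind : L + L' ≈ 0 [mod N ]
    wind = ≈-cancelˡ u (≈-trans (≈-reflexive (sym (ℕ.+-assoc u L L'))) (≈-trans (≈-+ (V-inj q) ≈-refl)
             (≈-trans (≈-sym (V-inj p)) (≈-reflexive (sym (ℕ.+-identityʳ u))))))
    around : (∃[ s ] L + L' ≡ 0 + s * N) ⊎ (∃[ s ] 0 ≡ L + L' + s * N) →
      (u ≈ u' [mod N ] × L ≡ L') ⊎ (u + L ≈ u' [mod N ] × L + L' ≡ N)
    none : L + L' ≡ 0 → (u ≈ u' [mod N ] × L ≡ L') ⊎ (u + L ≈ u' [mod N ] × L + L' ≡ N)
    none z = inj₁ (≈-trans (≈-reflexive (sym (trans (cong (u +_) L≡0) (ℕ.+-identityʳ u)))) (V-inj q) , trans L≡0 (sym (ℕ.m+n≡0⇒n≡0 L z)))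
      where L≡0 = ℕ.m+n≡0⇒m≡0 L z
    around (inj₂ (s , z)) = none (ℕ.m+n≡0⇒m≡0 (L + L') (sym z))
    around (inj₁ (zero , z)) = none z
    around (inj₁ (suc zero , z)) = inj₂ (V-inj q , trans z (ℕ.+-identityʳ N))
    around (inj₁ (suc (suc s) , z)) = ⊥-elim (ℕ.<⇒≱ (ℕ.+-mono-< L<N L'<N)
      (ℕ.≤-trans (ℕ.+-monoʳ-≤ N (ℕ.m≤m+n N (s * N))) (ℕ.≤-reflexive (sym z))))

-- Perturbation of vertices

≤⇒0≤ : ∀ {p q} → p ℚ.≤ q → 0ℚ ℚ.≤ q ℚ.- p
≤⇒0≤ {p} {q} p≤q = subst (ℚ._≤ q ℚ.- p) (ℚ.+-inverseʳ p) (ℚ.+-monoˡ-≤ (ℚ.- p) p≤q)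

0≤⇒≤ : ∀ {p q} → 0ℚ ℚ.≤ q ℚ.- p → p ℚ.≤ q
0≤⇒≤ {p} {q} h = subst₂ ℚ._≤_ (ℚ.+-identityˡ p) (undo q p) (ℚ.+-monoˡ-≤ p h)
  where
  undo : ∀ q p → (q ℚ.- p) ℚ.+ p ≡ q
  undo = RS.solve-∀ ℚ-ring

≤-by : ∀ {p q t} → 0ℚ ℚ.≤ t → t ≡ q ℚ.- p → p ℚ.≤ q
≤-by h refl = 0≤⇒≤ h

+-nonneg : ∀ {p q} → 0ℚ ℚ.≤ p → 0ℚ ℚ.≤ q → 0ℚ ℚ.≤ p ℚ.+ q
+-nonneg = ℚ.+-mono-≤

*-nonneg : ∀ {p q} → 0ℚ ℚ.≤ p → 0ℚ ℚ.≤ q → 0ℚ ℚ.≤ p ℚ.* q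
*-nonneg {p} {q} hp hq = subst (ℚ._≤ p ℚ.* q) (ℚ.*-zeroʳ p) (ℚ.*-monoˡ-≤-nonNeg p {{ℚ.nonNegative hp}} hq)

diff≡0⇒≡ : ∀ {p q} → p ℚ.- q ≡ 0ℚ → p ≡ q
diff≡0⇒≡ {p} {q} h = trans (undo p q) (trans (cong (ℚ._+ q) h) (ℚ.+-identityˡ q))
  where
  undo : ∀ p q → p ≡ (p ℚ.- q) ℚ.+ q
  undo = RS.solve-∀ ℚ-ring

≡⇒diff≡0 : ∀ {p q} → p ≡ q → p ℚ.- q ≡ 0ℚ
≡⇒diff≡0 {p} refl = ℚ.+-inverseʳ p

≤∧≢⇒< : ∀ {p q} → p ℚ.≤ q → p ≢ q → p ℚ.< q
≤∧≢⇒< {p} {q} p≤q p≢q with q ℚ.≤? p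
... | yes q≤p = contradiction (ℚ.≤-antisym p≤q q≤p) p≢q
... | no  q≰p = ℚ.≰⇒> q≰p

pos-cancel : ∀ {ε p} → 0ℚ ℚ.< ε → ε ℚ.* p ≡ 0ℚ → p ≡ 0ℚ
pos-cancel {ε} {p} ε>0 h = begin
  p                     ≡⟨ ℚ.*-identityˡ p ⟨
  1ℚ ℚ.* p              ≡⟨ cong (ℚ._* p) (ℚ.*-inverseˡ ε) ⟨
  (ℚ.1/ ε ℚ.* ε) ℚ.* p  ≡⟨ ℚ.*-assoc (ℚ.1/ ε) ε p ⟩
  ℚ.1/ ε ℚ.* (ε ℚ.* p)  ≡⟨ cong (ℚ.1/ ε ℚ.*_) h ⟩
  ℚ.1/ ε ℚ.* 0ℚ         ≡⟨ ℚ.*-zeroʳ (ℚ.1/ ε) ⟩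
  0ℚ ∎
  where
  open ≡-Reasoning
  instance _ = ℚ.>-nonZero ε>0

p≤∣p∣ : ∀ p → p ℚ.≤ ℚ.∣ p ∣
p≤∣p∣ p with ℚ.≤-total 0ℚ p
... | inj₁ h = ℚ.≤-reflexive (sym (ℚ.0≤p⇒∣p∣≡p h))
... | inj₂ h = ℚ.≤-trans h (ℚ.0≤∣p∣ p)

-- The absolute value lets one `ε` serve for the displacements by ε d and by -ε d, and makes the
-- condition persist for smaller `ε`.
Fits : ℚ → ℚ → ℚ → Set
Fits a d ε = ε ℚ.* ℚ.∣ d ∣ ℚ.≤ a

Fits-down : ∀ {a d ε ε′} → ε′ ℚ.≤ ε → Fits a d ε → Fits a d ε′
Fits-down {a} {d} ε′≤ε = ℚ.≤-trans (ℚ.*-monoʳ-≤-nonNeg ℚ.∣ d ∣ {{ℚ.∣-∣-nonNeg d}} ε′≤ε)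

fit : ∀ {a} d → 0ℚ ℚ.≤ a → (a ≡ 0ℚ → d ≡ 0ℚ) → ∃[ ε ] 0ℚ ℚ.< ε × Fits a d ε
fit {a} d a≥0 h with a ℚ.≟ 0ℚ
... | yes a≡0 = 1ℚ , ℚ.positive⁻¹ 1ℚ , subst₂ (λ d a → Fits a d 1ℚ) (sym (h a≡0)) (sym a≡0) ℚ.≤-refl
... | no a≢0 = a ℚ.* ℚ.1/ b , ℚ.positive⁻¹ _ , (begin
  a ℚ.* ℚ.1/ b ℚ.* ℚ.∣ d ∣  ≤⟨ ℚ.*-monoˡ-≤-nonNeg (a ℚ.* ℚ.1/ b) ∣d∣≤b ⟩
  a ℚ.* ℚ.1/ b ℚ.* b        ≡⟨ ℚ.*-assoc a _ b ⟩
  a ℚ.* (ℚ.1/ b ℚ.* b)      ≡⟨ cong (a ℚ.*_) (ℚ.*-inverseˡ b) ⟩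
  a ℚ.* 1ℚ                  ≡⟨ ℚ.*-identityʳ a ⟩
  a ∎)
  where
  open ℚ.≤-Reasoning
  b = 1ℚ ℚ.+ ℚ.∣ d ∣
  instance
    _ = ℚ.positive (≤∧≢⇒< a≥0 (a≢0 ∘ sym))
    _ = ℚ.∣-∣-nonNeg d
    b>0 : ℚ.Positive b
    b>0 = ℚ.pos+nonNeg⇒pos 1ℚ ℚ.∣ d ∣
    b≢0 : ℚ.NonZero b
    b≢0 = ℚ.pos⇒nonZero b
    b⁻¹>0 : ℚ.Positive (ℚ.1/ b)
    b⁻¹>0 = ℚ.1/pos⇒pos b
    ab⁻¹>0 : ℚ.Positive (a ℚ.* ℚ.1/ b)
    ab⁻¹>0 = ℚ.pos*pos⇒pos a (ℚ.1/ b)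
    ab⁻¹≥0 : ℚ.NonNegative (a ℚ.* ℚ.1/ b)
    ab⁻¹≥0 = ℚ.pos⇒nonNeg (a ℚ.* ℚ.1/ b)
  ∣d∣≤b : ℚ.∣ d ∣ ℚ.≤ b
  ∣d∣≤b = subst (ℚ._≤ b) (ℚ.+-identityˡ ℚ.∣ d ∣) (ℚ.+-monoˡ-≤ ℚ.∣ d ∣ (ℚ.nonNegative⁻¹ 1ℚ))

fits⇒nonneg : ∀ {a d ε} → 0ℚ ℚ.≤ ε → Fits a d ε → (0ℚ ℚ.≤ a ℚ.+ ε ℚ.* d) × (0ℚ ℚ.≤ a ℚ.- ε ℚ.* d)
fits⇒nonneg {a} {d} {ε} ε≥0 f = bound₁ , bound₂
  where
  instance _ = ℚ.nonNegative ε≥0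
  rearr : ∀ a ε d → a ℚ.+ ε ℚ.* d ≡ a ℚ.- ε ℚ.* (ℚ.- d)
  rearr = RS.solve-∀ ℚ-ring
  bound₂ : 0ℚ ℚ.≤ a ℚ.- ε ℚ.* d
  bound₂ = ≤⇒0≤ (ℚ.≤-trans (ℚ.*-monoˡ-≤-nonNeg ε (p≤∣p∣ d)) f)
  bound₁ : 0ℚ ℚ.≤ a ℚ.+ ε ℚ.* d
  bound₁ = subst (0ℚ ℚ.≤_) (sym (rearr a ε d)) (≤⇒0≤ (ℚ.≤-trans (ℚ.*-monoˡ-≤-nonNeg ε
             (subst (ℚ.- d ℚ.≤_) (ℚ.∣-p∣≡∣p∣ d) (p≤∣p∣ (ℚ.- d)))) f))

common-ε : ∀ {k} (P : Fin k → ℚ → Set) → (∀ i {ε ε′} → ε′ ℚ.≤ ε → P i ε → P i ε′) →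
  (∀ i → ∃[ ε ] 0ℚ ℚ.< ε × P i ε) → ∃[ ε ] 0ℚ ℚ.< ε × (∀ i → P i ε)
common-ε {zero}  P down h = 1ℚ , ℚ.positive⁻¹ 1ℚ , λ ()
common-ε {suc k} P down h with h Fin.zero | common-ε (P ∘ Fin.suc) (down ∘ Fin.suc) (h ∘ Fin.suc)
... | ε₁ , pos₁ , p₁ | ε₂ , pos₂ , p₂ = ε₁ ℚ.⊓ ε₂ , min>0 , λ
  { Fin.zero → down Fin.zero (ℚ.p⊓q≤p ε₁ ε₂) p₁ ; (Fin.suc i) → down (Fin.suc i) (ℚ.p⊓q≤q ε₁ ε₂) (p₂ i) }
  where
  min>0 : 0ℚ ℚ.< ε₁ ℚ.⊓ ε₂
  min>0 with ℚ.⊓-sel ε₁ ε₂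
  ... | inj₁ e = subst (0ℚ ℚ.<_) (sym e) pos₁
  ... | inj₂ e = subst (0ℚ ℚ.<_) (sym e) pos₂

pre-linear : ∀ f g ε k → pre (λ s → f s ℚ.+ ε ℚ.* g s) k ≡ pre f k ℚ.+ ε ℚ.* pre g k
pre-linear f g ε zero    = base ε
  where
  base : ∀ ε → 0ℚ ≡ 0ℚ ℚ.+ ε ℚ.* 0ℚ
  base = RS.solve-∀ ℚ-ring
pre-linear f g ε (suc k) = trans (cong (ℚ._+ (f k ℚ.+ ε ℚ.* g k)) (pre-linear f g ε k)) (step (pre f k) (pre g k) (f k) (g k) ε)
  where
  step : ∀ a b c d ε → (a ℚ.+ ε ℚ.* b) ℚ.+ (c ℚ.+ ε ℚ.* d) ≡ (a ℚ.+ c) ℚ.+ ε ℚ.* (b ℚ.+ d)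
  step = RS.solve-∀ ℚ-ring

module Perturb {n m} {G : SGraph n m} (K : Circle G) where
  open Flows K public

  -- Only finitely many edges and arcs bound a displacement. Those with slack tolerate a small
  -- multiple of `D`, those without are unaffected, so a common `ε` keeps x + ε D and x - ε D in the
  -- polyhedron; `x` is their midpoint.
  perturb : ∀ {x} → IsVertex G x → (D : Fin m → ℚ) → (∀ e → x e ≡ 0ℚ → D e ≡ 0ℚ) →
    (∀ {e u L} → IsArc e u L → u < N → x e ℚ.+ arcSum x u L ≡ 1ℚ → D e ℚ.+ arcSum D u L ≡ 0ℚ) →
    ∀ e → D e ≡ 0ℚ
  perturb {x} (inP , extreme) D zeros tight = conclude
    where
    nn = proj₁ inP

    slack : Fin m → ℕ → ℕ → ℚ
    slack e u L = (x e ℚ.+ arcSum x u L) ℚ.- 1ℚ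

    Good : Fin m → ℕ → ℕ → ℚ → Set
    Good e u L ε = IsArc e u L → Fits (slack e u L) (D e ℚ.+ arcSum D u L) ε

    good : ∀ e u L → u < N → ∃[ ε ] 0ℚ ℚ.< ε × Good e u L ε
    good e u L u<N with 1ℚ ℚ.≤? x e ℚ.+ arcSum x u L
    ... | no ≰ = 1ℚ , ℚ.positive⁻¹ 1ℚ , λ a → contradiction (InP-arc inP a) ≰
    ... | yes ≤ with slack e u L ℚ.≟ 0ℚ
    ...   | no ≢0 with ε , ε>0 , f ← fit (D e ℚ.+ arcSum D u L) (≤⇒0≤ ≤) (λ z → contradiction z ≢0) = ε , ε>0 , λ _ → f
    ...   | yes ≡0 = 1ℚ , ℚ.positive⁻¹ 1ℚ , λ a → subst₂ (λ d s → Fits s d 1ℚ)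
              (sym (tight a u<N (diff≡0⇒≡ ≡0))) (sym ≡0) ℚ.≤-refl

    edges = common-ε (λ e → Fits (x e) (D e)) (λ e {ε} {ε′} → Fits-down {x e} {D e} {ε} {ε′}) (λ e → fit (D e) (nn e) (zeros e))
    arcs = common-ε (λ e ε → ∀ u L → Good e (toℕ {N} u) (toℕ {N} L) ε)
      (λ e le h u L a → Fits-down {slack e (toℕ u) (toℕ L)} {D e ℚ.+ arcSum D (toℕ u) (toℕ L)} le (h u L a))
      λ e → common-ε (λ u ε → ∀ L → Good e (toℕ {N} u) (toℕ {N} L) ε)
        (λ u le h L a → Fits-down {slack e (toℕ u) (toℕ L)} {D e ℚ.+ arcSum D (toℕ u) (toℕ L)} le (h L a))
        λ u → common-ε (λ L → Good e (toℕ {N} u) (toℕ {N} L))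
          (λ L le h a → Fits-down {slack e (toℕ u) (toℕ L)} {D e ℚ.+ arcSum D (toℕ u) (toℕ L)} le (h a))
          λ L → good e (toℕ u) (toℕ L) (toℕ<n u)

    both = common-ε {2} (λ { Fin.zero ε → ∀ e → Fits (x e) (D e) ε
                           ; (Fin.suc _) ε → ∀ e u L → Good e (toℕ {N} u) (toℕ {N} L) ε })
      (λ { Fin.zero le h e → Fits-down {x e} {D e} le (h e)
         ; (Fin.suc _) le h e u L a → Fits-down {slack e (toℕ u) (toℕ L)} {D e ℚ.+ arcSum D (toℕ u) (toℕ L)} le (h e u L a) })
      (λ { Fin.zero → edges ; (Fin.suc _) → arcs })

    ε = proj₁ both
    ε>0 = proj₁ (proj₂ both)
    ε≥0 = ℚ.<⇒≤ ε>0
    fits-edge = proj₂ (proj₂ both) Fin.zero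
    fits-arc : ∀ {e u L} → u < N → IsArc e u L → Fits (slack e u L) (D e ℚ.+ arcSum D u L) ε
    fits-arc {e} {u} {L} u<N a@(mkArc _ _ L<N) =
      subst₂ (λ u L → IsArc e u L → Fits (slack e u L) (D e ℚ.+ arcSum D u L) ε) (toℕ-fromℕ< u<N) (toℕ-fromℕ< L<N)
        (proj₂ (proj₂ both) (Fin.suc Fin.zero) e (fromℕ< u<N) (fromℕ< L<N)) a

    y z : Fin m → ℚ
    y e = x e ℚ.+ ε ℚ.* D e
    z e = x e ℚ.+ (ℚ.- ε) ℚ.* D e

    y-inP : InP G y
    y-inP = arc-InP (λ e → proj₁ (fits⇒nonneg {x e} {D e} ε≥0 (fits-edge e)))
      λ {e} {u} {L} a u<N → ≤-by (proj₁ (fits⇒nonneg {slack e u L} {D e ℚ.+ arcSum D u L} ε≥0 (fits-arc u<N a)))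
        (trans (regroup (x e) (arcSum x u L) ε (D e) (arcSum D u L))
          (cong (λ t → (y e ℚ.+ t) ℚ.- 1ℚ) (sym (pre-linear (λ s → x (E (u + s))) (λ s → D (E (u + s))) ε L))))
      where
      regroup : ∀ a b ε d e → ((a ℚ.+ b) ℚ.- 1ℚ) ℚ.+ ε ℚ.* (d ℚ.+ e) ≡ ((a ℚ.+ ε ℚ.* d) ℚ.+ (b ℚ.+ ε ℚ.* e)) ℚ.- 1ℚ
      regroup = RS.solve-∀ ℚ-ring

    z-inP : InP G z
    z-inP = arc-InP (λ e → subst (0ℚ ℚ.≤_) (flip (x e) ε (D e)) (proj₂ (fits⇒nonneg {x e} {D e} ε≥0 (fits-edge e))))
      λ {e} {u} {L} a u<N → ≤-by (proj₂ (fits⇒nonneg {slack e u L} {D e ℚ.+ arcSum D u L} ε≥0 (fits-arc u<N a)))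
        (trans (regroup (x e) (arcSum x u L) ε (D e) (arcSum D u L))
          (cong (λ t → (z e ℚ.+ t) ℚ.- 1ℚ) (sym (pre-linear (λ s → x (E (u + s))) (λ s → D (E (u + s))) (ℚ.- ε) L))))
      where
      flip : ∀ a ε d → a ℚ.- ε ℚ.* d ≡ a ℚ.+ (ℚ.- ε) ℚ.* d
      flip = RS.solve-∀ ℚ-ring
      regroup : ∀ a b ε d e → ((a ℚ.+ b) ℚ.- 1ℚ) ℚ.- ε ℚ.* (d ℚ.+ e) ≡ ((a ℚ.+ (ℚ.- ε) ℚ.* d) ℚ.+ (b ℚ.+ (ℚ.- ε) ℚ.* e)) ℚ.- 1ℚ
      regroup = RS.solve-∀ ℚ-ring

    conclude : ∀ e → D e ≡ 0ℚ
    conclude e = pos-cancel ε>0 (trans (half (x e) ε (D e))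
      (trans (cong (½ ℚ.*_) (≡⇒diff≡0 (extreme y z y-inP z-inP (λ e → mid (x e) ε (D e)) e))) (ℚ.*-zeroʳ ½)))
      where
      mid : ∀ a ε d → a ≡ ½ ℚ.* ((a ℚ.+ ε ℚ.* d) ℚ.+ (a ℚ.+ (ℚ.- ε) ℚ.* d))
      mid = RS.solve-∀ ℚ-ring
      half : ∀ a ε d → ε ℚ.* d ≡ ½ ℚ.* ((a ℚ.+ ε ℚ.* d) ℚ.- (a ℚ.+ (ℚ.- ε) ℚ.* d))
      half = RS.solve-∀ ℚ-ring

-- Integers and natural numbers among the rationals

abstract
  int : ℤ → ℚ
  int z = z ℚ./ 1

  int-/1 : ∀ z → int z ≡ z ℚ./ 1
  int-/1 z = refl

int-mkℚ : ∀ z → int z ≡ ℚ.mkℚ z 0 (Coprime.sym (Coprime.1-coprimeTo ℤ.∣ z ∣))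
int-mkℚ z = trans (int-/1 z) (ℚ.fromℚᵘ-toℚᵘ (ℚ.mkℚ z 0 _))

int-injective : ∀ {a b} → int a ≡ int b → a ≡ b
int-injective {a} {b} p = cong ℚ.numerator (trans (sym (int-mkℚ a)) (trans p (int-mkℚ b)))

int-ᵘ : ∀ z → ℚ.toℚᵘ (int z) ℚᵘ.≃ ℚᵘ.mkℚᵘ z 0
int-ᵘ z = subst (λ q → ℚ.toℚᵘ q ℚᵘ.≃ ℚᵘ.mkℚᵘ z 0) (sym (int-/1 z)) (ℚ.toℚᵘ-fromℚᵘ (ℚᵘ.mkℚᵘ z 0))

int-+ : ∀ a b → int (a ℤ.+ b) ≡ int a ℚ.+ int b
int-+ a b = ℚ.toℚᵘ-injective (ℚᵘ.≃-trans (int-ᵘ (a ℤ.+ b)) (ℚᵘ.≃-trans (ℚᵘ.*≡* (unit a b))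
  (ℚᵘ.≃-trans (ℚᵘ.≃-sym (ℚᵘ.+-cong (int-ᵘ a) (int-ᵘ b))) (ℚᵘ.≃-sym (ℚ.toℚᵘ-homo-+ (int a) (int b))))))
  where
  unit : ∀ a b → (a ℤ.+ b) ℤ.* (ℤ.+ 1) ≡ (a ℤ.* (ℤ.+ 1) ℤ.+ b ℤ.* (ℤ.+ 1)) ℤ.* (ℤ.+ 1)
  unit = ℤSolver.solve-∀

int-neg : ∀ a → int (ℤ.- a) ≡ ℚ.- int a
int-neg a = ℚ.toℚᵘ-injective (ℚᵘ.≃-trans (int-ᵘ (ℤ.- a)) (ℚᵘ.≃-trans (ℚᵘ.-‿cong (ℚᵘ.≃-sym (int-ᵘ a)))
  (ℚᵘ.≃-sym (ℚ.toℚᵘ-homo‿- (int a)))))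

int-minus : ∀ a b → int (a ℤ.- b) ≡ int a ℚ.- int b
int-minus a b = trans (int-+ a (ℤ.- b)) (cong (int a ℚ.+_) (int-neg b))

IsInt : ℚ → Set
IsInt q = ∃[ t ] q ≡ int t

IsInt? : ∀ q → Dec (IsInt q)
IsInt? (ℚ.mkℚ z zero _) = yes (z , sym (int-mkℚ z))
IsInt? (ℚ.mkℚ z (suc d) _) = no λ { (t , p) → ℕ.1+n≢0 (cong ℚ.denominator-1 (trans p (int-mkℚ t))) }

IsInt-+ : ∀ {p q} → IsInt p → IsInt q → IsInt (p ℚ.+ q)
IsInt-+ (s , refl) (t , refl) = s ℤ.+ t , sym (int-+ s t)

IsInt-minus : ∀ {p q} → IsInt p → IsInt q → IsInt (p ℚ.- q)
IsInt-minus (s , refl) (t , refl) = s ℤ.- t , sym (int-minus s t)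

nat : ℕ → ℚ
nat n = int (ℤ.+ n)

nat-0 : nat 0 ≡ 0ℚ
nat-0 = int-/1 (ℤ.+ 0)

nat-1 : nat 1 ≡ 1ℚ
nat-1 = int-/1 (ℤ.+ 1)

nat-injective : ∀ {a b} → nat a ≡ nat b → a ≡ b
nat-injective = ℤ.+-injective ∘ int-injective

nat-+ : ∀ a b → nat (a + b) ≡ nat a ℚ.+ nat b
nat-+ a b = int-+ (ℤ.+ a) (ℤ.+ b)

0≤nat : ∀ n → 0ℚ ℚ.≤ nat n
0≤nat n = subst (0ℚ ℚ.≤_) (sym (int-mkℚ (ℤ.+ n))) (ℚ.nonNegative⁻¹ _)

nat-cancel-≤ : ∀ {a b} → nat a ℚ.≤ nat b → a ≤ b
nat-cancel-≤ {a} {b} h = ℤ.drop‿+≤+ (subst₂ ℤ._≤_ (ℤ.*-identityʳ (ℤ.+ a)) (ℤ.*-identityʳ (ℤ.+ b))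
  (ℚ.drop-*≤* (subst₂ ℚ._≤_ (int-mkℚ (ℤ.+ a)) (int-mkℚ (ℤ.+ b)) h)))

nonneg-int⇒nat : ∀ {q} → 0ℚ ℚ.≤ q → IsInt q → ∃[ n ] q ≡ nat n
nonneg-int⇒nat q≥0 (ℤ.+ n , p) = n , p
nonneg-int⇒nat q≥0 (ℤ.-[1+ n ] , refl) with () ← ℚ.drop-*≤* (subst (0ℚ ℚ.≤_) (int-mkℚ ℤ.-[1+ n ]) q≥0)

clear-denominator : ∀ q → nat (ℚ.↧ₙ q) ℚ.* q ≡ int (ℚ.↥ q)
clear-denominator q@(ℚ.mkℚ z d _) = ℚ.toℚᵘ-injective (ℚᵘ.≃-trans (ℚ.toℚᵘ-homo-* (nat (suc d)) q)
  (ℚᵘ.≃-trans (ℚᵘ.*-cong (int-ᵘ (ℤ.+ suc d)) (ℚᵘ.≃-refl {ℚ.toℚᵘ q}))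
  (ℚᵘ.≃-trans (ℚᵘ.*≡* (unit (ℤ.+ suc d) z)) (ℚᵘ.≃-sym (int-ᵘ z)))))
  where
  unit : ∀ d z → (d ℤ.* z) ℤ.* (ℤ.+ 1) ≡ z ℤ.* ((ℤ.+ 1) ℤ.* d)
  unit = ℤSolver.solve-∀

-- Potentials on the unrolled circuit: Δ (suc i) − Δ i is then well defined on
-- the positive edges, and Δ (u + L) − Δ u on arcs.
record QuasiPeriodic (N : ℕ) (Δ : ℕ → ℚ) (τ : ℚ) : Set where
  constructor quasiPeriodic
  field shift : ∀ i → Δ (i + N) ≡ Δ i ℚ.+ τ
open QuasiPeriodic

rise : (ℕ → ℚ) → ℕ → ℕ → ℚ
rise Δ u L = Δ (u + L) ℚ.- Δ u

rise-+N : ∀ {N Δ τ} → QuasiPeriodic N Δ τ → ∀ s u L → rise Δ (u + s * N) L ≡ rise Δ u L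
rise-+N {N} {Δ} {τ} q zero u L = cong (λ z → rise Δ z L) (ℕ.+-identityʳ u)
rise-+N {N} {Δ} {τ} q (suc s) u L = begin
  rise Δ (u + (N + s * N)) L    ≡⟨ cong (λ z → rise Δ z L) (trans (cong (_+_ u) (ℕ.+-comm N (s * N))) (sym (ℕ.+-assoc u (s * N) N))) ⟩
  rise Δ (v + N) L              ≡⟨ cong (λ z → Δ z ℚ.- Δ (v + N)) (trans (ℕ.+-assoc v N L) (trans (cong (v +_) (ℕ.+-comm N L)) (sym (ℕ.+-assoc v L N)))) ⟩
  Δ (v + L + N) ℚ.- Δ (v + N)   ≡⟨ cong₂ ℚ._-_ (shift q (v + L)) (shift q v) ⟩
  (Δ (v + L) ℚ.+ τ) ℚ.- (Δ v ℚ.+ τ) ≡⟨ cancel (Δ (v + L)) (Δ v) τ ⟩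
  rise Δ v L                    ≡⟨ rise-+N q s u L ⟩
  rise Δ u L ∎
  where
  open ≡-Reasoning
  v = u + s * N
  cancel : ∀ a b t → (a ℚ.+ t) ℚ.- (b ℚ.+ t) ≡ a ℚ.- b
  cancel = RS.solve-∀ ℚ-ring

rise-cong : ∀ {N Δ τ} → QuasiPeriodic N Δ τ → ∀ {u v} L → u ≈ v [mod N ] → rise Δ u L ≡ rise Δ v L
rise-cong {Δ = Δ} q {u} {v} L (s , t , p) =
  trans (sym (rise-+N q s u L)) (trans (cong (λ z → rise Δ z L) p) (rise-+N q t v L))

-- Tight arcs and displacements of the coordinates

module Vertex {n m} {G : SGraph n m} (K : Circle G) where
  open Perturb K public

  arc? : ∀ e u L → Dec (IsArc e u L)
  arc? e u L = map′ (λ { (a , b , c) → mkArc a b c }) (λ { (mkArc a b c) → a , b , c })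
    (pos G e Bool.≟ false ×-dec (≡-dec _≟F_ _≟F_ (ends G e) _ ⊎-dec ≡-dec _≟F_ _≟F_ (ends G e) _) ×-dec L ℕ.<? N)

  arc-rise : ∀ {e u L u′ L′} → IsArc e u L → IsArc e u′ L′ →
    (∀ {Δ τ} → QuasiPeriodic N Δ τ → rise Δ u L ≡ rise Δ u′ L′) ⊎
    (∀ {Δ τ} → QuasiPeriodic N Δ τ → rise Δ u L ℚ.+ rise Δ u′ L′ ≡ τ)
  arc-rise {e} {u} {L} {u′} {L′} a a′ with arc-unique a a′
  ... | inj₁ (p , refl) = inj₁ λ q → rise-cong q L p
  ... | inj₂ (p , r) = inj₂ λ {Δ} {τ} q → begin
    rise Δ u L ℚ.+ rise Δ u′ L′          ≡⟨ cong (rise Δ u L ℚ.+_) (rise-cong q L′ p) ⟨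
    rise Δ u L ℚ.+ rise Δ (u + L) L′     ≡⟨ differences-add (Δ (u + L)) (Δ u) (Δ (u + L + L′)) ⟩
    Δ (u + L + L′) ℚ.- Δ u               ≡⟨ cong (λ z → Δ z ℚ.- Δ u) (trans (ℕ.+-assoc u L L′) (cong (u +_) r)) ⟩
    Δ (u + N) ℚ.- Δ u                    ≡⟨ cong (ℚ._- Δ u) (shift q u) ⟩
    (Δ u ℚ.+ τ) ℚ.- Δ u                  ≡⟨ a+b-a≡b (Δ u) τ ⟩
    τ ∎
    where
    open ≡-Reasoning

  coord : (Fin m → ℚ) → ℕ → ℚ
  coord x = pre (x ∘ E)

  total : (Fin m → ℚ) → ℚ
  total x = coord x N

  coord-qp : ∀ x → QuasiPeriodic N (coord x) (total x)
  coord-qp x = quasiPeriodic λ i → trans (sym (pre-telescope (λ s → x (E (i + s))) (coord x) i N (λ s → refl)))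
    (cong (coord x i ℚ.+_) (pre-rotate (x ∘ E) N (λ j → cong x (E-cong (≈-period j))) i))

  arcSum-rise : ∀ x Δ u L → (∀ i → Δ (suc i) ≡ Δ i ℚ.+ x (E i)) → arcSum x u L ≡ rise Δ u L
  arcSum-rise x Δ u L p = trans (b≡a+b-a (Δ u) (arcSum x u L)) (cong (ℚ._- Δ u) (pre-telescope _ Δ u L (λ s → p (u + s))))

  Tight : (Fin m → ℚ) → Fin m → ℕ → ℕ → Set
  Tight x e u L = IsArc e u L × u < N × x e ℚ.+ rise (coord x) u L ≡ 1ℚ

  TightAt : (Fin m → ℚ) → Fin m → Set
  TightAt x e = ∃[ u ] ∃[ L ] Tight x e (toℕ {N} u) (toℕ {N} L)

  tightAt? : ∀ x e → Dec (TightAt x e)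
  tightAt? x e = any? λ u → any? λ L → arc? e (toℕ u) (toℕ L) ×-dec (toℕ u ℕ.<? N)
    ×-dec (x e ℚ.+ rise (coord x) (toℕ u) (toℕ L) ℚ.≟ 1ℚ)

  tight-fin : ∀ {x e u L} → Tight x e u L → TightAt x e
  tight-fin {x} {e} {u} {L} t@(mkArc _ _ L<N , u<N , _) = fromℕ< u<N , fromℕ< L<N ,
    subst₂ (Tight x e) (sym (toℕ-fromℕ< u<N)) (sym (toℕ-fromℕ< L<N)) t

  -- The perturbation changes positive edges by the steps of `Δ` and a negative edge by minus the
  -- rise of `Δ` on one of its tight arcs, or by 0 if it has none. `agree` makes the chosen arc
  -- immaterial, so every tight arc stays tight.
  potential-constant : ∀ {x} → IsVertex G x → ∀ {Δ τ} → QuasiPeriodic N Δ τ →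
    (∀ i → x (E i) ≡ 0ℚ → Δ (suc i) ≡ Δ i) →
    (∀ {e u L} → Tight x e u L → x e ≡ 0ℚ → rise Δ u L ≡ 0ℚ) →
    (∀ {e u L u′ L′} → Tight x e u L → Tight x e u′ L′ → rise Δ u L ≡ rise Δ u′ L′) →
    ∀ i → Δ (suc i) ≡ Δ i
  potential-constant {x} vx {Δ} {τ} qp flat zeroNeg agree i =
    diff≡0⇒≡ (trans (sym (D-E i)) (perturb vx D D-zero D-tight (E i)))
    where
    step : ℕ → ℚ
    step i = Δ (suc i) ℚ.- Δ i

    rise-1 : ∀ i → rise Δ i 1 ≡ step i
    rise-1 i = cong (λ z → Δ z ℚ.- Δ i) (ℕ.+-comm i 1)

    D′ : ∀ e → Bool → Dec (TightAt x e) → ℚ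
    D′ e true  _             = step (posIdx e)
    D′ e false (yes (u , L , _)) = ℚ.- rise Δ (toℕ u) (toℕ L)
    D′ e false (no _)        = 0ℚ

    D : Fin m → ℚ
    D e = D′ e (pos G e) (tightAt? x e)

    D-E : ∀ i → D (E i) ≡ step i
    D-E i = go (pos G (E i)) (E-pos i) (tightAt? x (E i))
      where
      go : ∀ b → b ≡ true → ∀ d → D′ (E i) b d ≡ step i
      go true _ _ = trans (sym (rise-1 (posIdx (E i)))) (trans (rise-cong qp 1 (posIdx-E i)) (rise-1 i))

    D-zero : ∀ e → x e ≡ 0ℚ → D e ≡ 0ℚ
    D-zero e z = zero′ (pos G e) refl (tightAt? x e)
      where
      zero′ : ∀ b → pos G e ≡ b → ∀ d → D′ e b d ≡ 0ℚ
      zero′ true p d = ≡⇒diff≡0 (flat _ (trans (cong x (E-posIdx e p)) z))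
      zero′ false p (yes (u , L , t)) = trans (cong ℚ.-_ (zeroNeg t z)) refl
      zero′ false p (no _) = refl

    D-tight : ∀ {e u L} → IsArc e u L → u < N → x e ℚ.+ arcSum x u L ≡ 1ℚ → D e ℚ.+ arcSum D u L ≡ 0ℚ
    D-tight {e} {u} {L} a u<N t = tight′ (pos G e) (IsArc.neg a) (tightAt? x e)
      where
      T : Tight x e u L
      T = a , u<N , trans (cong (x e ℚ.+_) (sym (arcSum-rise x (coord x) u L (λ _ → refl)))) t
      arcD : arcSum D u L ≡ rise Δ u L
      arcD = arcSum-rise D Δ u L (λ i → trans (a≡b+[a-b] (Δ (suc i)) (Δ i)) (cong (Δ i ℚ.+_) (sym (D-E i))))
      tight′ : ∀ b → b ≡ false → ∀ d → D′ e b d ℚ.+ arcSum D u L ≡ 0ℚ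
      tight′ false _ (yes (u′ , L′ , T′)) = trans (cong₂ ℚ._+_ (cong ℚ.-_ (agree T′ T)) arcD) (ℚ.+-inverseˡ (rise Δ u L))
      tight′ false _ (no ¬t) = contradiction (tight-fin {x} T) ¬t

  two : ℚ
  two = 1ℚ ℚ.+ 1ℚ

  InP-rise : ∀ {x} → InP G x → ∀ {e u L} → IsArc e u L → 1ℚ ℚ.≤ x e ℚ.+ rise (coord x) u L
  InP-rise {x} inP {e} {u} {L} a = subst (1ℚ ℚ.≤_) (cong (x e ℚ.+_) (arcSum-rise x (coord x) u L (λ _ → refl))) (InP-arc inP a)

  -- For total x ≥ 2 an edge with two different tight arcs has weight 0.
  potential-constant-long : ∀ {x} → IsVertex G x → two ℚ.≤ total x → ∀ {Δ τ} → QuasiPeriodic N Δ τ →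
    (∀ i → x (E i) ≡ 0ℚ → Δ (suc i) ≡ Δ i) →
    (∀ {e u L} → Tight x e u L → x e ≡ 0ℚ → rise Δ u L ≡ 0ℚ) →
    ∀ i → Δ (suc i) ≡ Δ i
  potential-constant-long {x} vx@(inP@(nn , _) , _) long {Δ} qp flat zeroNeg = potential-constant vx qp flat zeroNeg agree
    where
    agree : ∀ {e u L u′ L′} → Tight x e u L → Tight x e u′ L′ → rise Δ u L ≡ rise Δ u′ L′
    agree {e} {u} {L} {u′} {L′} T@(a , _ , t) T′@(a′ , _ , t′) with arc-rise a a′
    ... | inj₁ same = same qp
    ... | inj₂ opp = trans (zeroNeg T xe≡0) (sym (zeroNeg T′ xe≡0))
      where
      collect : ∀ y r r′ T → T ℚ.- ((y ℚ.+ r) ℚ.+ (y ℚ.+ r′)) ≡ (T ℚ.- (r ℚ.+ r′)) ℚ.+ ((0ℚ ℚ.- y) ℚ.- y)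
      collect = RS.solve-∀ ℚ-ring
      R = rise (coord x) u L
      R′ = rise (coord x) u′ L′
      -- Adding up the two tight complementary arcs gives 2 · x e + total x = 2, where total x ≥ 2.
      slack : 0ℚ ℚ.≤ (0ℚ ℚ.- x e) ℚ.- x e
      slack = subst (0ℚ ℚ.≤_) (trans (cong (λ z → total x ℚ.- z) (sym (cong₂ ℚ._+_ t t′)))
        (trans (collect (x e) R R′ (total x)) (trans (cong (ℚ._+ ((0ℚ ℚ.- x e) ℚ.- x e)) (≡⇒diff≡0 (sym (opp (coord-qp x))))) (ℚ.+-identityˡ _))))
        (≤⇒0≤ long)
      xe≤0 : x e ℚ.≤ 0ℚ
      xe≤0 = ≤-by (+-nonneg slack (nn e)) (fin (x e))
        where
        fin : ∀ y → ((0ℚ ℚ.- y) ℚ.- y) ℚ.+ y ≡ 0ℚ ℚ.- y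
        fin = RS.solve-∀ ℚ-ring
      xe≡0 = ℚ.≤-antisym xe≤0 (nn e)

  complement : ∀ {e u L} → IsArc e u (suc L) → IsArc e (u + suc L) (N ∸ suc L)
  complement {e} {u} {L} (mkArc neg c L<N) = mkArc neg
    (Joins-sym {G = G} {e = e} (subst (λ v → Joins G e v (V (u + suc L))) (V-cong back) c)) (ℕ.∸-monoʳ-< (s≤s z≤n) (ℕ.<⇒≤ L<N))
    where
    back : u ≈ u + suc L + (N ∸ suc L) [mod N ]
    back = 1 , 0 , (begin
      u + (N + 0)                         ≡⟨ cong (u +_) (ℕ.+-identityʳ N) ⟩
      u + N                               ≡⟨ cong (u +_) (ℕ.m+[n∸m]≡n (ℕ.<⇒≤ L<N)) ⟨
      u + (suc L + (N ∸ suc L))           ≡⟨ ℕ.+-assoc u (suc L) _ ⟨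
      u + suc L + (N ∸ suc L)             ≡⟨ ℕ.+-identityʳ _ ⟨
      u + suc L + (N ∸ suc L) + 0 * N ∎)
      where open ≡-Reasoning

  -- When total x < 2 every negative edge on a flow has positive weight, so the
  -- positive part can be rescaled.
  short-zero : ∀ {x} → IsVertex G x → ¬ (two ℚ.≤ total x) → ∀ i → x (E i) ≡ 0ℚ
  short-zero {x} vx@(inP@(nn , _) , _) short i = cancel (coord x i) (x (E i))
    (potential-constant vx (coord-qp x) (λ i z → trans (cong (coord x i ℚ.+_) z) (ℚ.+-identityʳ _)) zeroNeg agree i)
    where
    cancel : ∀ a b → a ℚ.+ b ≡ a → b ≡ 0ℚ
    cancel a b p = trans (b≡a+b-a a b) (≡⇒diff≡0 p)
    agree : ∀ {e u L u′ L′} → Tight x e u L → Tight x e u′ L′ → rise (coord x) u L ≡ rise (coord x) u′ L′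
    agree {e} {u} {L} {u′} {L′} (_ , _ , t) (_ , _ , t′) = trans (b≡a+b-a (x e) (rise (coord x) u L)) (trans (cong (ℚ._- x e) (trans t (sym t′))) (sym (b≡a+b-a (x e) (rise (coord x) u′ L′))))
    zeroNeg : ∀ {e u L} → Tight x e u L → x e ≡ 0ℚ → rise (coord x) u L ≡ 0ℚ
    zeroNeg {e} {u} {zero} _ _ = trans (cong (λ z → coord x z ℚ.- coord x u) (ℕ.+-identityʳ u)) (ℚ.+-inverseʳ (coord x u))
    -- A tight arc of an edge of weight 0 has length 1, and the complementary arc has length at
    -- least 1, which would make the total at least 2.
    zeroNeg {e} {u} {suc L} (a , _ , t) z = contradiction (≤-by (≤⇒0≤ (InP-rise inP (complement a))) eq) short
      where
      R = rise (coord x) u (suc L)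
      R′ = rise (coord x) (u + suc L) (N ∸ suc L)
      sumR : R ℚ.+ R′ ≡ total x
      sumR = trans (differences-add (coord x (u + suc L)) (coord x u) (coord x (u + suc L + (N ∸ suc L)))) (trans (cong (λ z → coord x z ℚ.- coord x u)
        (trans (ℕ.+-assoc u (suc L) _) (cong (u +_) (ℕ.m+[n∸m]≡n (ℕ.<⇒≤ (IsArc.short a)))))) (trans (cong (ℚ._- coord x u) (shift (coord-qp x) u)) (a+b-a≡b (coord x u) (total x))))
      R≡1 : R ≡ 1ℚ
      R≡1 = trans (sym (ℚ.+-identityˡ R)) (trans (cong (ℚ._+ R) (sym z)) t)
      eq : (x e ℚ.+ R′) ℚ.- 1ℚ ≡ total x ℚ.- two
      eq = trans (cong (λ y → (y ℚ.+ R′) ℚ.- 1ℚ) z) (trans (regroup R′ 1ℚ) (cong (ℚ._- two) (trans (cong (ℚ._+ R′) (sym R≡1)) sumR)))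
        where
        regroup : ∀ r o → (0ℚ ℚ.+ r) ℚ.- o ≡ (o ℚ.+ r) ℚ.- (o ℚ.+ o)
        regroup = RS.solve-∀ ℚ-ring

-- Vertices with long positive circuit

inverse-mod : ∀ {w l} → Coprime w (suc l) → ∃[ v ] w * v ≈ 1 [mod suc l ]
inverse-mod {w} {l} c with Coprime.coprime-Bézout c
... | Bézout.+- x y eq = x , 0 , y , trans (ℕ.+-identityʳ _) (trans (ℕ.*-comm w x) (sym eq))
-- Here x w ≡ -1, and the factor `l` ≡ -1 corrects the sign.
... | Bézout.-+ x y eq = x * l , ≈-cancelʳ (x * w) (≈-trans (0 , x * w , full w x l) (≈-trans (≈-sym (0 , y , trans (ℕ.+-identityʳ _) eq)) (≈-refl)))
  where
  full : ∀ w x l → w * (x * l) + x * w + 0 ≡ 0 + x * w * suc l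
  full = solve-∀

-- steps t counts the steps of length w that lead from a + w to t modulo k; it
-- advances by one along every step except the one leaving a.
module Steps {w l : ℕ} (c : Coprime w (suc l)) (a : ℕ) where
  private
    k = suc l
    v = proj₁ (inverse-mod c)
    wv≈1 = proj₂ (inverse-mod c)
    -- This is -(a + w) modulo `k`, so that `(t + b) * v` stands for (t - a - w) / w.
    b = l * (a + w)

  steps : ℕ → ℕ
  steps t = ((t + b) * v) % k

  steps-cong : ∀ {s t} → s ≈ t [mod k ] → steps s ≡ steps t
  steps-cong {s} {t} p = ≈⇒% (subst₂ (λ x y → x ≈ y [mod k ]) (ℕ.*-comm v _) (ℕ.*-comm v _) (≈-* v (≈-+ p ≈-refl)))

  -- Adding `w` adds 1 to the residue, which wraps round only from k - 1, that is, when t - a - w ≡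
  -- -w.
  advance : ∀ t → ¬ (t ≈ a [mod k ]) → steps (t + w) ≡ suc (steps t)
  advance t t≉a with ℕ.m≤n⇒m<n∨m≡n (m%n<n ((t + b) * v) k)
  ... | inj₁ lt = trans (≈⇒% next≈) (m<n⇒m%n≡m lt)
    where
    expand : ∀ t w b v → (t + w + b) * v ≡ (t + b) * v + w * v
    expand = solve-∀
    next≈ : (t + w + b) * v ≈ suc (steps t) [mod k ]
    next≈ = ≈-trans (≈-reflexive (expand t w b v)) (≈-trans (≈-+ (≈-sym (%≈ ((t + b) * v))) wv≈1) (≈-reflexive (ℕ.+-comm (steps t) 1)))
  ... | inj₂ eq = contradiction (≈-cancelʳ (w + b) (≈-trans t+w+b≈0 (≈-sym a+w+b≈0))) t≉a
    where
    a+w+b≈0 : a + (w + b) ≈ 0 [mod k ]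
    a+w+b≈0 = 0 , a + w , full a w l
      where
      full : ∀ a w l → a + (w + l * (a + w)) + 0 ≡ 0 + (a + w) * suc l
      full = solve-∀
    last≈0 : suc ((t + b) * v) ≈ 0 [mod k ]
    last≈0 = ≈-trans (≈-suc (≈-sym (%≈ ((t + b) * v)))) (≈-trans (≈-reflexive eq) (0 , 1 , refl))
    t+w+b≈0 : t + (w + b) ≈ 0 [mod k ]
    t+w+b≈0 = ≈-trans (≈-trans (≈-reflexive (reorder t w b)) (≈-+ {a = w} ≈-refl
        (≈-trans (≈-reflexive (sym (ℕ.*-identityʳ (t + b)))) (≈-sym (≈-* (t + b) wv≈1)))))
      (≈-trans (≈-reflexive (factor w (t + b) v)) (≈-trans (≈-* w last≈0) (≈-reflexive (ℕ.*-zeroʳ w))))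
      where
      reorder : ∀ t w b → t + (w + b) ≡ w + (t + b)
      reorder = solve-∀
      factor : ∀ w s v → w + s * (w * v) ≡ w * suc (s * v)
      factor = solve-∀

module Winds {n m} {G : SGraph n m} (K : Circle G) where
  open Vertex K public

  -- The positive circuit wraps k = w · total x unit steps around, in lowest
  -- terms; W i is the position of vertex i in units of 1/w.
  record Winding : Set where
    field
      w k      : ℕ
      2≤w      : 2 ≤ w
      w+w<k    : w + w < k
      coprime  : Coprime k w
      W        : ℕ → ℕ
      W-0      : W 0 ≡ 0
      W-N      : ∀ i → W (i + N) ≡ W i + k
      W-mono   : ∀ i → W i ≤ W (suc i)
      chords   : ∀ a → ¬ ¬ (∃[ e ] ∃[ u ] ∃[ L ] IsArc e u L × W u ≈ a [mod k ] × W (u + L) ≡ W u + w)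

  module Position {x : Fin m → ℚ} (vx : IsVertex G x) (long : two ℚ.≤ total x)
           (k d : ℕ) (wT : nat (suc d) ℚ.* total x ≡ nat k) where
    private
      w = suc d
      nn = proj₁ (proj₁ vx)
      c = coord x

      scaled : ℕ → ℚ
      scaled i = nat w ℚ.* c i

      scaled-N : ∀ i → scaled (i + N) ≡ scaled i ℚ.+ nat k
      scaled-N i = trans (cong (nat w ℚ.*_) (QuasiPeriodic.shift (coord-qp x) i)) (trans (ℚ.*-distribˡ-+ (nat w) (c i) (total x)) (cong (scaled i ℚ.+_) wT))

      scaled-tight : ∀ {e u L} → Tight x e u L → x e ≡ 0ℚ → scaled (u + L) ≡ scaled u ℚ.+ nat w
      scaled-tight {e} {u} {L} (_ , _ , t) z = trans (expand (nat w) (c (u + L)) (c u)) (cong (scaled u ℚ.+_)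
        (trans (cong (nat w ℚ.*_) (trans (sym (ℚ.+-identityˡ _)) (trans (cong (ℚ._+ rise c u L) (sym z)) t))) (ℚ.*-identityʳ (nat w))))
        where
        expand : ∀ w a b → w ℚ.* a ≡ w ℚ.* b ℚ.+ w ℚ.* (a ℚ.- b)
        expand = RS.solve-∀ ℚ-ring

      indicator′ : ∀ {q} → Dec (IsInt q) → ℚ
      indicator′ (yes _) = 1ℚ
      indicator′ (no _)  = 0ℚ

      indicator : ℚ → ℚ
      indicator q = indicator′ (IsInt? q)

      indicator-cong : ∀ {p q} → (IsInt p → IsInt q) → (IsInt q → IsInt p) → indicator p ≡ indicator q
      indicator-cong {p} {q} f g with IsInt? p | IsInt? q
      ... | yes _ | yes _ = refl
      ... | no _  | no _  = refl
      ... | yes a | no ¬b = contradiction (f a) ¬b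
      ... | no ¬a | yes b = contradiction (g b) ¬a

      indicator-+ : ∀ q z → indicator (q ℚ.+ nat z) ≡ indicator q
      indicator-+ q z = indicator-cong (λ i → subst IsInt (undo q (nat z)) (IsInt-minus i (ℤ.+ z , refl))) (λ i → IsInt-+ i (ℤ.+ z , refl))
        where
        undo : ∀ q z → (q ℚ.+ z) ℚ.- z ≡ q
        undo = RS.solve-∀ ℚ-ring

      indicator-1 : ∀ q → indicator q ≡ 1ℚ → IsInt q
      indicator-1 q p with IsInt? q
      ... | yes i = i
      ... | no _ = contradiction (sym p) ℚ.1≢0

      indicator-yes : ∀ q → IsInt q → indicator q ≡ 1ℚ
      indicator-yes q i with IsInt? q
      ... | yes _ = refl
      ... | no ¬i = contradiction i ¬i

      δ : ℕ → ℚ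
      δ i = indicator (scaled i)

      -- Integrality of `scaled` survives everything that constrains a displacement: a full turn
      -- adds `k`, an edge of weight 0 adds nothing, and a tight arc of a negative edge of weight 0
      -- adds `w`.
      δ-flat : ∀ i → δ (suc i) ≡ δ i
      δ-flat = potential-constant-long vx long {δ} {0ℚ}
        (quasiPeriodic λ i → trans (cong indicator (scaled-N i)) (trans (indicator-+ (scaled i) k) (sym (ℚ.+-identityʳ _))))
        (λ i z → cong (λ y → indicator (nat w ℚ.* y)) (trans (cong (c i ℚ.+_) z) (ℚ.+-identityʳ _)))
        (λ {e} {u} t z → ≡⇒diff≡0 (trans (cong indicator (scaled-tight t z)) (indicator-+ (scaled u) w)))

      scaled-int : ∀ i → IsInt (scaled i)
      scaled-int i = indicator-1 (scaled i) (trans (const i) (indicator-yes (scaled 0) (ℤ.+ 0 , trans (ℚ.*-zeroʳ (nat w)) (sym nat-0))))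
        where
        const : ∀ i → δ i ≡ δ 0
        const zero    = refl
        const (suc i) = trans (δ-flat i) (const i)

      c≥0 : ∀ i → 0ℚ ℚ.≤ c i
      c≥0 zero    = ℚ.≤-refl
      c≥0 (suc i) = +-nonneg (c≥0 i) (nn _)

      abstract
        position : ∀ i → ∃[ p ] scaled i ≡ nat p
        position i = nonneg-int⇒nat (*-nonneg (0≤nat w) (c≥0 i)) (scaled-int i)

    W : ℕ → ℕ
    W i = proj₁ (position i)

    nat-W : ∀ i → nat w ℚ.* coord x i ≡ nat (W i)
    nat-W i = proj₂ (position i)

    W-N : ∀ i → W (i + N) ≡ W i + k
    W-N i = nat-injective (trans (sym (nat-W (i + N))) (trans (scaled-N i) (trans (cong (ℚ._+ nat k) (nat-W i)) (sym (nat-+ (W i) k)))))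

    W-0 : W 0 ≡ 0
    W-0 = nat-injective (trans (sym (nat-W 0)) (trans (ℚ.*-zeroʳ (nat w)) (sym nat-0)))

    W-mono : ∀ i → W i ≤ W (suc i)
    W-mono i = nat-cancel-≤ (subst₂ ℚ._≤_ (nat-W i) (nat-W (suc i)) (≤-by (*-nonneg (0≤nat w) (nn (E i))) (expand (nat w) (c i) (x (E i)))))
      where
      expand : ∀ w a b → w ℚ.* b ≡ w ℚ.* (a ℚ.+ b) ℚ.- w ℚ.* a
      expand = RS.solve-∀ ℚ-ring

    W-tight : ∀ {e u L} → Tight x e u L → x e ≡ 0ℚ → W (u + L) ≡ W u + w
    W-tight {e} {u} {L} t z = nat-injective (trans (sym (nat-W (u + L))) (trans (scaled-tight t z) (trans (cong (ℚ._+ nat w) (nat-W u)) (sym (nat-+ (W u) w)))))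

    W-flat : ∀ i → x (E i) ≡ 0ℚ → W (suc i) ≡ W i
    W-flat i z = nat-injective (trans (sym (nat-W (suc i))) (trans (cong (nat w ℚ.*_) (trans (cong (c i ℚ.+_) z) (ℚ.+-identityʳ _))) (nat-W i)))

    -- Without a chord at a, the potential W − w · steps, which jumps only there,
    -- is constant although it grows by k around the circuit.
    chord-at : Coprime w k → ∀ {l} → k ≡ suc l → ∀ a →
      ¬ ¬ (∃[ e ] ∃[ u ] ∃[ L ] IsArc e u L × W u ≈ a [mod k ] × W (u + L) ≡ W u + w)
    chord-at cop {l} keq a none = ℕ.1+n≢0 (nat-injective (trans (sym (a+b-a≡b (Δ 0) (nat (suc l)))) (trans (≡⇒diff≡0 (trans (sym (Δ-N 0)) (const N))) (sym nat-0))))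
      where
      open Steps {w} {l} (subst (Coprime w) keq cop) a
      -- A tight arc of an edge of weight 0 adds `w` to `W` and, unless it starts in class `a`, 1 to
      -- `steps`. A full turn leaves `steps` alone and adds `k` to `W`.
      Δ : ℕ → ℚ
      Δ i = nat (W i) ℚ.- nat (w * steps (W i))
      Δ-cong : ∀ {i j} → W i ≡ W j → Δ i ≡ Δ j
      Δ-cong = cong (λ z → nat z ℚ.- nat (w * steps z))
      W-N′ : ∀ i → W (i + N) ≡ W i + suc l
      W-N′ i = trans (W-N i) (cong (W i +_) keq)
      Δ-N : ∀ i → Δ (i + N) ≡ Δ i ℚ.+ nat (suc l)
      Δ-N i = trans (cong₂ (λ p q → nat p ℚ.- nat (w * q)) (W-N′ i) (trans (cong steps (W-N′ i)) (steps-cong {W i + suc l} {W i} (≈-period (W i)))))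
        (trans (cong (ℚ._- nat (w * steps (W i))) (nat-+ (W i) (suc l))) (swap (nat (W i)) (nat (suc l)) (nat (w * steps (W i)))))
        where
        swap : ∀ a b c → (a ℚ.+ b) ℚ.- c ≡ (a ℚ.- c) ℚ.+ b
        swap = RS.solve-∀ ℚ-ring
      Δ-tight : ∀ {e u L} → Tight x e u L → x e ≡ 0ℚ → rise Δ u L ≡ 0ℚ
      Δ-tight {e} {u} {L} t z = ≡⇒diff≡0 (trans (cong₂ (λ p q → nat p ℚ.- nat (w * q)) Wt (trans (cong steps Wt) (advance (W u) (λ here → none (e , u , L , proj₁ t , subst (λ k → W u ≈ a [mod k ]) (sym keq) here , Wt)))))
        (trans (cong₂ ℚ._-_ (nat-+ (W u) w) (trans (cong nat (ℕ.*-suc w (steps (W u)))) (nat-+ w (w * steps (W u)))))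
          (cancel (nat (W u)) (nat w) (nat (w * steps (W u))))))
        where
        Wt = W-tight t z
        cancel : ∀ a b c → (a ℚ.+ b) ℚ.- (b ℚ.+ c) ≡ a ℚ.- c
        cancel = RS.solve-∀ ℚ-ring
      Δ-flat : ∀ i → Δ (suc i) ≡ Δ i
      Δ-flat = potential-constant-long vx long {Δ} {nat (suc l)} (quasiPeriodic Δ-N) (λ i z → Δ-cong {suc i} {i} (W-flat i z)) Δ-tight
      const : ∀ i → Δ i ≡ Δ 0
      const zero    = refl
      const (suc i) = trans (Δ-flat i) (const i)

  winding-or-integral : ∀ {x} → IsVertex G x → Winding ⊎ (∀ i → IsInt (x (E i)))
  winding-or-integral {x} vx with two ℚ.≤? total x
  ... | no short = inj₂ λ i → ℤ.+ 0 , trans (short-zero vx short i) (sym nat-0)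
  ... | yes long = go (total x) refl long
    where
    open Position
    go : ∀ T → T ≡ total x → two ℚ.≤ T → Winding ⊎ (∀ i → IsInt (x (E i)))
    go (ℚ.mkℚ ℤ.-[1+ _ ] d cop) T≡ 2≤T with () ← ℚ.drop-*≤* 2≤T
    go T@(ℚ.mkℚ (ℤ.+ k) zero cop) T≡ 2≤T = inj₂ λ i → subst IsInt (a+b-a≡b (coord x i) (x (E i))) (IsInt-minus (c-int (suc i)) (c-int i))
      where
      wT : nat 1 ℚ.* total x ≡ nat k
      wT = trans (cong (nat 1 ℚ.*_) (sym T≡)) (clear-denominator T)
      c-int : ∀ i → IsInt (coord x i)
      c-int i = _ , trans (sym (ℚ.*-identityˡ (coord x i))) (trans (cong (ℚ._* coord x i) (sym nat-1)) (nat-W vx long k 0 wT i))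
    go (ℚ.mkℚ (ℤ.+ zero) (suc d) cop) T≡ 2≤T with ℤ.+≤+ () ← ℚ.drop-*≤* 2≤T
    go T@(ℚ.mkℚ (ℤ.+ k@(suc _)) (suc d) cop) T≡ 2≤T = inj₁ record
      { w = w ; k = k ; 2≤w = s≤s (s≤s z≤n) ; w+w<k = ℕ.≤∧≢⇒< w+w≤k w+w≢k ; coprime = k⊥w
      ; W = W vx long k (suc d) wT ; W-0 = W-0 vx long k (suc d) wT ; W-N = W-N vx long k (suc d) wT ; W-mono = W-mono vx long k (suc d) wT
      ; chords = chord-at vx long k (suc d) wT (Coprime.sym k⊥w) refl }
      where
      w = suc (suc d)
      wT : nat w ℚ.* total x ≡ nat k
      wT = trans (cong (nat w ℚ.*_) (sym T≡)) (clear-denominator T)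
      k⊥w : Coprime k w
      k⊥w = Coprime.recompute cop
      w+w≤k : w + w ≤ k
      w+w≤k = ℤ.drop‿+≤+ (subst₂ ℤ._≤_ (cong ℤ.+_ (cong (w +_) (ℕ.+-identityʳ w))) (ℤ.*-identityʳ (ℤ.+ k)) (ℚ.drop-*≤* 2≤T))
      -- Otherwise w ≥ 2 would divide both `k` and itself. The strict inequality is what later makes
      -- k ≥ 5.
      w+w≢k : w + w ≢ k
      w+w≢k refl with () ← k⊥w {w} (∣.∣m∣n⇒∣m+n ∣.∣-refl ∣.∣-refl , ∣.∣-refl)

-- From windings to obstructions

-- The perturbation argument only refutes the absence of a chord. There are finitely many classes,
-- so the double negations can be collected into one, which is harmless because an obstruction is
-- used to derive a contradiction.
¬¬-Fin : ∀ {k} {P : Fin k → Set} → (∀ i → ¬ ¬ P i) → ¬ ¬ (∀ i → P i)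
¬¬-Fin {zero}  h none = none λ ()
¬¬-Fin {suc k} h none = h Fin.zero λ p₀ → ¬¬-Fin (h ∘ Fin.suc) λ ps →
  none λ { Fin.zero → p₀ ; (Fin.suc i) → ps i }

-- The search descends while `P` holds, so minimality is local; the failure at the predecessor is
-- what yields the upper bounds in `floor-window`.
least : ∀ {P : ℕ → Set} → (∀ t → Dec (P t)) → ∀ t → P t → ∃[ t ] P t × (∀ s → t ≡ suc s → ¬ P s)
least P? zero    p = zero , p , λ _ ()
least P? (suc t) p with P? t
... | yes q = least P? t q
... | no ¬q = suc t , p , λ { _ refl → ¬q }

shift-N : ∀ {N c} (f : ℕ → ℕ) → (∀ i → f (i + N) ≡ f i + c) → ∀ s i → f (i + s * N) ≡ f i + s * c
shift-N f p zero i = trans (cong f (ℕ.+-identityʳ i)) (sym (ℕ.+-identityʳ _))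
shift-N {N} {c} f p (suc s) i = begin
  f (i + (N + s * N))   ≡⟨ cong f (trans (cong (i +_) (ℕ.+-comm N (s * N))) (sym (ℕ.+-assoc i (s * N) N))) ⟩
  f (i + s * N + N)     ≡⟨ p (i + s * N) ⟩
  f (i + s * N) + c     ≡⟨ cong (_+ c) (shift-N f p s i) ⟩
  f i + s * c + c       ≡⟨ trans (ℕ.+-assoc (f i) (s * c) c) (cong (f i +_) (ℕ.+-comm (s * c) c)) ⟩
  f i + (c + s * c) ∎
  where open ≡-Reasoning

step-mono : ∀ (f : ℕ → ℕ) → (∀ i → f i ≤ f (suc i)) → ∀ {i j} → i ≤ j → f i ≤ f j
step-mono f up {i} {j} i≤j = subst (λ j → f i ≤ f j) (ℕ.m+[n∸m]≡n i≤j) (go (j ∸ i))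
  where
  go : ∀ d → f i ≤ f (i + d)
  go zero    = ℕ.≤-reflexive (cong f (sym (ℕ.+-identityʳ i)))
  go (suc d) = ℕ.≤-trans (go d) (ℕ.≤-trans (up (i + d)) (ℕ.≤-reflexive (cong f (sym (ℕ.+-suc i d)))))

odd-5+ : ∀ s → ¬ (2 ∣ 5 + s * 2)
odd-5+ s h with ∣.∣m+n∣m⇒∣n {2} {s * 2} {5} (subst (2 ∣_) (ℕ.+-comm 5 (s * 2)) h) (∣.n∣m*n s)
... | ∣.divides (suc (suc (suc q))) ()

-- An odd r ≥ 5 such that both windows below have length at least r.
-- For w = 2 it must be k itself; for w ≥ 3 the least one with k ≤ r (w − 1) works.
find-odd : ∀ z k → suc z + suc z < k → 1 ≤ z → (z ≡ 1 → ¬ (2 ∣ k)) →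
  ∃[ r ] (5 ≤ suc r) × ¬ (2 ∣ suc r) × (k ≤ suc r * z) × (suc r * suc (suc z) ≤ 3 * k)
find-odd zero k lo () odd
find-odd (suc zero) (suc r) lo _ odd = r , lo , odd refl , ℕ.≤-reflexive (sym (ℕ.*-identityʳ (suc r))) , ℕ.≤-reflexive (ℕ.*-comm (suc r) 3)
find-odd (suc (suc v)) k lo _ _ = search k 0 (ℕ.≤-reflexive (sym (ℕ.+-identityʳ k))) base
  where
  z = suc (suc v)
  Result = ∃[ r ] (5 ≤ suc r) × ¬ (2 ∣ suc r) × (k ≤ suc r * z) × (suc r * suc (suc z) ≤ 3 * k)
  base : (5 + 0 * 2) * suc (suc z) ≤ 3 * k
  base = ℕ.≤-trans (subst (5 * suc (suc z) ≤_) (slack v) (ℕ.m≤m+n _ (v + 1))) (ℕ.*-monoʳ-≤ 3 lo)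
    where
    slack : ∀ v → 5 * (4 + v) + (v + 1) ≡ 3 * suc (3 + v + (3 + v))
    slack = solve-∀
  search : ∀ fuel s → k ≤ fuel + s → (5 + s * 2) * suc (suc z) ≤ 3 * k → Result
  search fuel s enough hi with k ℕ.≤? (5 + s * 2) * z
  ... | yes lo = 4 + s * 2 , s≤s (s≤s (s≤s (s≤s (s≤s z≤n)))) , odd-5+ s , lo , hi
  search zero s enough hi | no ≰ = contradiction (ℕ.≤-trans enough (subst (s ≤_) (big s v) (ℕ.m≤m+n s _))) ≰
    where
    big : ∀ s v → s + (10 + 3 * s + 5 * v + 2 * (s * v)) ≡ (5 + s * 2) * suc (suc v)
    big = solve-∀
  -- With r = 5 + 2 s still too small, r z < k, so the next odd number satisfies (r + 2)(z + 2) ≤ 3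
  -- (r z + 1) ≤ 3 k; the first inequality holds because r ≥ 5 and z ≥ 2.
  search (suc fuel) s enough hi | no ≰ = search fuel (suc s) (subst (k ≤_) (sym (ℕ.+-suc fuel s)) enough)
      (ℕ.≤-trans (subst ((5 + suc s * 2) * suc (suc z) ≤_) (slack s v) (ℕ.m≤m+n _ (5 + 4 * s + 8 * v + 4 * (s * v)))) (ℕ.*-monoʳ-≤ 3 (ℕ.≰⇒> ≰)))
    where
    slack : ∀ s v → (5 + suc s * 2) * (4 + v) + (5 + 4 * s + 8 * v + 4 * (s * v)) ≡ 3 * suc ((5 + s * 2) * suc (suc v))
    slack = solve-∀

module Floor (k r : ℕ) {{_ : NonZero k}} where
  IsFloor : ℕ → ℕ → Set
  IsFloor t b = (b * k ≤ t * r) × (t * r < suc b * k)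

  floor : ℕ → ℕ
  floor t = (t * r) / k

  isFloor : ∀ t → IsFloor t (floor t)
  isFloor t = ℕ.≤-trans (ℕ.m≤n+m _ _) (ℕ.≤-reflexive (sym eq))
            , subst (_< suc (floor t) * k) (sym eq) (ℕ.+-monoˡ-< (floor t * k) (m%n<n (t * r) k))
    where
    eq : t * r ≡ (t * r) % k + floor t * k
    eq = m≡m%n+[m/n]*n (t * r) k

  floor-unique : ∀ t {b b′} → IsFloor t b → IsFloor t b′ → b ≡ b′
  floor-unique t (lo , hi) (lo′ , hi′) = ℕ.≤-antisym (below (t * r) lo hi′) (below (t * r) lo′ hi)
    where
    below : ∀ {b b′} n → b * k ≤ n → n < suc b′ * k → b ≤ b′
    below {b} {b′} _ lo hi = ℕ.≤-pred (ℕ.*-cancelʳ-< k b (suc b′) (ℕ.≤-<-trans lo hi))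

  floor-+k : ∀ t → floor (t + k) ≡ floor t + r
  floor-+k t with lo , hi ← isFloor t = floor-unique (t + k) (isFloor (t + k))
    ( subst₂ _≤_ (sym (e₁ (floor t) r k)) (sym (e₂ t k r)) (ℕ.+-monoˡ-≤ (k * r) lo)
    , subst₂ _<_ (sym (e₂ t k r)) (sym (e₃ (floor t) r k)) (ℕ.+-monoˡ-< (k * r) hi))
    where
    e₁ : ∀ b r k → (b + r) * k ≡ b * k + k * r
    e₁ = solve-∀
    e₂ : ∀ t k r → (t + k) * r ≡ t * r + k * r
    e₂ = solve-∀
    e₃ : ∀ b r k → suc (b + r) * k ≡ suc b * k + k * r
    e₃ = solve-∀

  floor-suc : r ≤ k → ∀ t → floor (suc t) ≡ floor t ⊎ floor (suc t) ≡ suc (floor t)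
  floor-suc r≤k t with isFloor t | suc t * r ℕ.<? suc (floor t) * k
  ... | lo , hi | yes lt = inj₁ (floor-unique (suc t) (isFloor (suc t)) (ℕ.≤-trans lo (ℕ.m≤n+m _ r) , lt))
  ... | lo , hi | no ≮ = inj₂ (floor-unique (suc t) (isFloor (suc t)) (ℕ.≮⇒≥ ≮ , ℕ.+-mono-≤-< r≤k hi))

  -- The least t with ⌊t r / k⌋ ≥ q and ⌊(t + w) r / k⌋ ≥ q + 2 attains both.
  floor-window : ∀ z → 1 ≤ r → r ≤ k → k ≤ r * z → r * suc (suc z) ≤ 3 * k → ∀ q →
    ∃[ t ] IsFloor t q × IsFloor (t + suc z) (q + 2)
  floor-window z 1≤r r≤k A B q with least good? ((q + 2) * k) start
    where
    Good : ℕ → Set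
    Good t = (q * k ≤ t * r) × ((q + 2) * k ≤ (t + suc z) * r)
    good? : ∀ t → Dec (Good t)
    good? t = (q * k ℕ.≤? t * r) ×-dec ((q + 2) * k ℕ.≤? (t + suc z) * r)
    grow : ∀ n → n ≤ n * r
    grow n = subst (_≤ n * r) (ℕ.*-identityʳ n) (ℕ.*-monoʳ-≤ n 1≤r)
    start : Good ((q + 2) * k)
    start = ℕ.≤-trans (ℕ.*-monoˡ-≤ k (ℕ.m≤m+n q 2)) (grow _)
          , ℕ.≤-trans (grow _) (ℕ.*-monoˡ-≤ r (ℕ.m≤m+n ((q + 2) * k) (suc z)))
  ... | zero , (lo , lo′) , _ = zero , (lo , ℕ.<-≤-trans 0<k (ℕ.m≤m+n k (q * k)))
      , (lo′ , ℕ.<-≤-trans (ℕ.<-≤-trans (subst (suc z * r <_) (e r z) (ℕ.m<n+m (suc z * r) 1≤r)) B) (ℕ.*-monoˡ-≤ k (ℕ.≤-trans (ℕ.m≤n+m 3 q) (ℕ.≤-reflexive (ℕ.+-suc q 2)))))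
    where
    0<k : 0 < k
    0<k = ℕ.>-nonZero⁻¹ k
    e : ∀ r z → r + suc z * r ≡ r * suc (suc z)
    e = solve-∀
  ... | suc s , (lo , lo′) , minimal with q * k ℕ.≤? s * r | (q + 2) * k ℕ.≤? (s + suc z) * r
  ...   | yes a | yes b = contradiction (a , b) (minimal s refl)
  -- The lower window follows from `s * r < q * k` at once; `B` carries this bound over z + 2
  -- further steps to the upper window.
  ...   | no a | _ = suc s , (lo , ℕ.+-mono-≤-< r≤k (ℕ.≰⇒> a)) , (lo′ , subst₂ _<_ (e₁ s r z) (e₂ q k) (ℕ.+-mono-<-≤ (ℕ.≰⇒> a) B))
    where
    e₁ : ∀ s r z → s * r + r * suc (suc z) ≡ (suc s + suc z) * r
    e₁ = solve-∀
    e₂ : ∀ q k → q * k + 3 * k ≡ suc (q + 2) * k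
    e₂ = solve-∀
  -- Now the failing bound at `s` gives the upper window at once, and going back by `r * z`, which
  -- is at least `k` by `A`, gives the lower one.
  ...   | yes _ | no b = suc s , (lo , ℕ.+-cancelʳ-< k _ _ (ℕ.≤-<-trans (ℕ.+-monoʳ-≤ (suc s * r) A) (subst₂ _<_ (e₁ s r z) (e₂ q k) (ℕ.≰⇒> b))))
                             , (lo′ , ℕ.+-mono-≤-< r≤k (ℕ.≰⇒> b))
    where
    e₁ : ∀ s r z → (s + suc z) * r ≡ suc s * r + r * z
    e₁ = solve-∀
    e₂ : ∀ q k → (q + 2) * k ≡ suc q * k + k
    e₂ = solve-∀

module Obstructions {n m} {G : SGraph n m} (K : Circle G) where
  open Winds K public

  -- A contraction of the positive circuit onto a cycle of odd length k = suc k′ ≥ 5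
  -- (Q counts the edges kept) and, for each q, a negative edge joining the
  -- classes q and q + 2.
  record Obstruction : Set where
    field
      k′     : ℕ
      5≤k    : 5 ≤ suc k′
      odd    : ¬ (2 ∣ suc k′)
      Q      : ℕ → ℕ
      Q-slow : ∀ i → Slow Q i
      Q-N    : ∀ i → Q (i + N) ≡ Q i + suc k′
      chord  : ∀ q → ∃[ e ] ∃[ u ] ∃[ L ] IsArc e u L × Q u ≈ q [mod suc k′ ] × Q (u + L) ≡ Q u + 2

  winding⇒obstruction : Winding → ¬ ¬ Obstruction
  winding⇒obstruction Wd none = ¬¬-Fin (λ (i : Fin k) → chords (toℕ i)) λ all → none (build λ a →
      let e , u , L , arc , p , r = all (fromℕ< (m%n<n a k)) in
      e , u , L , arc , ≈-trans p (≈-trans (≈-reflexive (toℕ-fromℕ< (m%n<n a k))) (%≈′ a)) , r)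
    where
    open Winding Wd
    instance
      nz : NonZero k
      nz = ℕ.>-nonZero (ℕ.≤-<-trans z≤n w+w<k)
    %≈′ : ∀ a → (a % k) ≈ a [mod k ]
    %≈′ a = a / k , 0 , trans (sym (m≡m%n+[m/n]*n a k)) (sym (ℕ.+-identityʳ a))

    build : (∀ a → ∃[ e ] ∃[ u ] ∃[ L ] IsArc e u L × W u ≈ a [mod k ] × W (u + L) ≡ W u + w) → Obstruction
    build chord with w in weq | 2≤w
    ... | suc (suc v) | s≤s (s≤s _) with find-odd (suc v) k (subst (λ w → w + w < k) weq w+w<k) (s≤s z≤n) odd₁
      where
      odd₁ : suc v ≡ 1 → ¬ (2 ∣ k)
      odd₁ refl 2∣k with () ← coprime {2} (2∣k , subst (2 ∣_) (sym weq) ∣.∣-refl)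
    ... | k′ , 5≤r , odd , A , B = record
      { k′ = k′ ; 5≤k = 5≤r ; odd = odd ; Q = Q ; Q-slow = Q-slow ; Q-N = λ i → trans (cong floor (W-N i)) (floor-+k (W i))
      ; chord = λ q → Q-chord q (floor-window (suc v) (s≤s z≤n) r≤k A B q) }
      where
      r = suc k′
      open Floor k r
      r≤k : r ≤ k
      r≤k = ℕ.*-cancelˡ-≤ 3 (ℕ.≤-trans (ℕ.≤-reflexive (ℕ.*-comm 3 r)) (ℕ.≤-trans (ℕ.*-monoʳ-≤ r (s≤s (s≤s (s≤s z≤n)))) B))
      Q : ℕ → ℕ
      Q i = floor (W i)

      noGap : ∀ j u → W u ≡ suc (W j) → ¬ (suc (W j) < W (suc j))
      noGap j u eq gap with ℕ.≤-total u j
      ... | inj₁ u≤j = ℕ.<⇒≱ (ℕ.n<1+n (W j)) (subst (_≤ W j) eq (step-mono W W-mono u≤j))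
      ... | inj₂ j≤u with ℕ.m≤n⇒m<n∨m≡n j≤u
      ...   | inj₂ refl = ℕ.1+n≢n (sym eq)
      ...   | inj₁ j<u = ℕ.<⇒≱ gap (subst (W (suc j) ≤_) eq (step-mono W W-mono j<u))

      -- A chord starts in every class modulo `k`, so every class is attained by `W`, and a monotone
      -- `W` that skipped a value could never attain it.
      W-slow : ∀ i → Slow W i
      W-slow i with ℕ.m≤n⇒m<n∨m≡n (W-mono i)
      ... | inj₂ eq = inj₁ (sym eq)
      ... | inj₁ lt with ℕ.m≤n⇒m<n∨m≡n lt
      ...   | inj₂ eq = inj₂ (sym eq)
      ...   | inj₁ gap with _ , u , _ , _ , p , _ ← chord (suc (W i)) with ≈-split p
      ...     | inj₁ (s , eq) = ⊥-elim (noGap (i + s * N) u (trans eq (cong suc (sym (shift-N W W-N s i))))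
                  (subst₂ _<_ (cong suc (sym (shift-N W W-N s i))) (sym (shift-N W W-N s (suc i))) (ℕ.+-monoˡ-< (s * k) gap)))
      ...     | inj₂ (s , eq) = ⊥-elim (noGap i (u + s * N) (trans (shift-N W W-N s u) (sym eq)) gap)

      Q-slow : ∀ i → Slow Q i
      Q-slow i with W-slow i
      ... | inj₁ eq = inj₁ (cong floor eq)
      ... | inj₂ eq rewrite eq = floor-suc r≤k (W i)

      Q-chord : ∀ q → ∃[ t ] IsFloor t q × IsFloor (t + suc (suc v)) (q + 2) →
        ∃[ e ] ∃[ u ] ∃[ L ] IsArc e u L × Q u ≈ q [mod r ] × Q (u + L) ≡ Q u + 2
      Q-chord q (t , f , f₂) with e , u , L , arc , p , eq ← chord t = e , u , L , arc , at (≈-split p)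
        where
        Ft : floor t ≡ q
        Ft = floor-unique t (isFloor t) f
        Ft₂ : floor (t + suc (suc v)) ≡ q + 2
        Ft₂ = floor-unique (t + suc (suc v)) (isFloor (t + suc (suc v))) f₂
        at : (∃[ s ] W u ≡ t + s * k) ⊎ (∃[ s ] t ≡ W u + s * k) → Q u ≈ q [mod r ] × Q (u + L) ≡ Q u + 2
        at (inj₁ (s , Wu)) = (0 , s , trans (ℕ.+-identityʳ _) Qu) , (begin
          floor (W (u + L))              ≡⟨ cong floor eq ⟩
          floor (W u + suc (suc v))      ≡⟨ cong floor (trans (cong (_+ suc (suc v)) Wu) (a+b+c≡a+c+b t (s * k) _)) ⟩
          floor (t + suc (suc v) + s * k)  ≡⟨ shift-N floor floor-+k s (t + suc (suc v)) ⟩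
          floor (t + suc (suc v)) + s * r  ≡⟨ cong (_+ s * r) Ft₂ ⟩
          q + 2 + s * r                  ≡⟨ a+b+c≡a+c+b q 2 (s * r) ⟩
          q + s * r + 2                  ≡⟨ cong (_+ 2) Qu ⟨
          Q u + 2 ∎)
          where
          open ≡-Reasoning
          Qu : Q u ≡ q + s * r
          Qu = trans (cong floor Wu) (trans (shift-N floor floor-+k s t) (cong (_+ s * r) Ft))
        at (inj₂ (s , teq)) = (s , 0 , trans Qu (sym (ℕ.+-identityʳ q))) , ℕ.+-cancelʳ-≡ (s * r) _ _ (begin
          floor (W (u + L)) + s * r      ≡⟨ shift-N floor floor-+k s (W (u + L)) ⟨
          floor (W (u + L) + s * k)      ≡⟨ cong floor (trans (cong (_+ s * k) eq) (trans (a+b+c≡a+c+b (W u) _ (s * k)) (cong (_+ suc (suc v)) (sym teq)))) ⟩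
          floor (t + suc (suc v))        ≡⟨ Ft₂ ⟩
          q + 2                          ≡⟨ cong (_+ 2) Qu ⟨
          Q u + s * r + 2                ≡⟨ a+b+c≡a+c+b (Q u) (s * r) 2 ⟩
          Q u + 2 + s * r ∎)
          where
          open ≡-Reasoning
          Qu : Q u + s * r ≡ q
          Qu = trans (sym (shift-N floor floor-+k s (W u))) (trans (cong floor (sym teq)) Ft)

-- From obstructions to minors

module _ {n} {u v : Fin (suc n)} (u≢v : u ≢ v) where

  merge-v : merge u v u≢v v ≡ merge u v u≢v u
  merge-v with v ≟F v | u ≟F v
  ... | no v≢v | _     = contradiction refl v≢v
  ... | yes _  | yes p = contradiction p u≢v
  ... | yes _  | no _  = punchOut-cong v refl

  merge-punchIn : ∀ x → merge u v u≢v (punchIn v x) ≡ x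
  merge-punchIn x with punchIn v x ≟F v
  ... | yes p = contradiction p punchInᵢ≢i′
    where punchInᵢ≢i′ = punchInᵢ≢i v x
  ... | no _  = trans (punchOut-cong v refl) (punchOut-punchIn v)

  punchIn-merge : ∀ {w} → w ≢ v → punchIn v (merge u v u≢v w) ≡ w
  punchIn-merge {w} w≢v with w ≟F v
  ... | yes p = contradiction p w≢v
  ... | no ¬p = punchIn-punchOut _

Joins-map : ∀ {n m n′ m′} {G : SGraph n m} {H : SGraph n′ m′} (φ : Fin n → Fin n′) {e a b f} →
  Joins G e a b → Joins H f (φ a) (φ b) → Joins H f (φ (proj₁ (ends G e))) (φ (proj₂ (ends G e)))
Joins-map {H = H} φ {f = f} (inj₁ p) j rewrite p = j
Joins-map {H = H} φ {f = f} (inj₂ p) j rewrite p = Joins-sym {G = H} {e = f} j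

module Cyclic (k′ : ℕ) (5≤k : 5 ≤ suc k′) where
  k = suc k′
  FC = flowCircuit k′

  FC-positive : (i : Fin k) → ends FC (i ↑ˡ k) ≡ (i , suc (toℕ i) mod k)
  FC-positive i rewrite splitAt-↑ˡ k i k = refl

  FC-negative : (i : Fin k) → ends FC (k ↑ʳ i) ≡ (i , suc (suc (toℕ i)) mod k)
  FC-negative i rewrite splitAt-↑ʳ k k i = refl

  FC-pos : (i : Fin k) → pos FC (i ↑ˡ k) ≡ true
  FC-pos i rewrite splitAt-↑ˡ k i k = refl

  FC-neg : (i : Fin k) → pos FC (k ↑ʳ i) ≡ false
  FC-neg i rewrite splitAt-↑ʳ k k i = refl

  data EdgeView : Fin (k + k) → Set where
    positive : (i : Fin k) → EdgeView (i ↑ˡ k)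
    negative : (i : Fin k) → EdgeView (k ↑ʳ i)

  edgeView : ∀ a → EdgeView a
  edgeView a with splitAt k a in eq
  ... | inj₁ i = subst EdgeView (splitAt⁻¹-↑ˡ eq) (positive i)
  ... | inj₂ i = subst EdgeView (splitAt⁻¹-↑ʳ {k} {k} {a} eq) (negative i)

  -- This is how `5 ≤ k` enters: the residues 1 and 2 exclude loops in the flow circuit, and 4
  -- excludes an edge that is a chord in both directions.
  small≉0 : ∀ c → c < 4 → ¬ (suc c ≈ 0 [mod k ])
  small≉0 c c<4 p with () ← ≈⇒≡ (ℕ.<-≤-trans (s≤s c<4) 5≤k) (s≤s z≤n) p

  FC-loopless : ∀ a x → ¬ Joins FC a x x
  FC-loopless a x j = noLoop (edgeView a) (same j)
    where
    same : Joins FC a x x → ends FC a ≡ (x , x)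
    same (inj₁ p) = p
    same (inj₂ p) = p
    shifted : ∀ {i : Fin k} {c} → i ≡ (suc c + toℕ i) mod k → suc c ≈ 0 [mod k ]
    shifted {i} {c} p = ≈-cancelʳ (toℕ i) (≈-trans (≈-sym (toℕ-mod≈ _)) (≈-reflexive (cong toℕ (sym p))))
    noLoop : ∀ {a} → EdgeView a → ends FC a ≡ (x , x) → ⊥
    noLoop (positive i) p with q ← trans (sym (FC-positive i)) p = small≉0 0 (s≤s z≤n) (shifted {i} (trans (cong proj₁ q) (sym (cong proj₂ q))))
    noLoop (negative i) p with q ← trans (sym (FC-negative i)) p = small≉0 1 (s≤s (s≤s z≤n)) (shifted {i} (trans (cong proj₁ q) (sym (cong proj₂ q))))

  -- A map of H onto the flow circuit whose positive edges outside the image of ι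
  -- form a forest: each is charged to its endpoint of larger rank, its child.
  -- This rules out loops and parallel edges, and persists under contraction.
  record Forest {n m} (H : SGraph n m) : Set where
    field
      φ      : Fin n → Fin k
      ι      : Fin (k + k) → Fin m
      ι-inj  : Injective _≡_ _≡_ ι
      incid  : ∀ a → Joins FC a (φ (proj₁ (ends H (ι a)))) (φ (proj₂ (ends H (ι a))))
      sign   : ∀ a → pos FC a ≡ pos H (ι a)
      root   : Fin k → Fin n
      φ-root : ∀ a → φ (root a) ≡ a
      rank   : Fin n → ℤ
      child parent : Fin m → Fin n
    Tree : Fin m → Set
    Tree e = (∀ a → ι a ≢ e) × pos H e ≡ true
    field
      tree      : ∀ {e} → Tree e → Joins H e (child e) (parent e) × φ (child e) ≡ φ (parent e)
                                 × rank (parent e) ℤ.< rank (child e)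
      child-inj : ∀ {e f} → Tree e → Tree f → child e ≡ child f → e ≡ f
      cover     : ∀ v → v ≡ root (φ v) ⊎ ∃[ e ] Tree e × child e ≡ v

  -- Deletion and contraction share this argument and differ in the vertex map `μ`. Ranks may drop
  -- in passing to `H′`, but not at the children of the remaining tree edges, so each of these still
  -- lies above its parent.
  reduce : ∀ {n m n′} {H : SGraph n (suc m)} {H′ : SGraph n′ m} (F : Forest H) → let open Forest F in
    ∀ j → (∀ a → ι a ≢ j) → (μ : Fin n → Fin n′) →
    (∀ e → ends H′ e ≡ (μ (proj₁ (ends H (punchIn j e))) , μ (proj₂ (ends H (punchIn j e))))) →
    (∀ e → pos H′ e ≡ pos H (punchIn j e)) →
    (φ′ : Fin n′ → Fin k) → (∀ w → φ′ (μ w) ≡ φ w) →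
    (rank′ : Fin n′ → ℤ) → (∀ w → rank′ (μ w) ℤ.≤ rank w) →
    (∀ {e} → e ≢ j → Tree e → rank′ (μ (child e)) ≡ rank (child e)) →
    (∀ {e f} → e ≢ j → f ≢ j → Tree e → Tree f → μ (child e) ≡ μ (child f) → child e ≡ child f) →
    (∀ x → ∃[ w ] (μ w ≡ x) × (w ≡ root (φ w) ⊎ ∃[ e ] e ≢ j × Tree e × child e ≡ w)) →
    Forest H′
  reduce {H = H} {H′} F j free μ ends′ pos′ φ′ φ′-μ rank′ rank-≤ rank-child μ-inj lift = record
    { φ = φ′
    ; ι = ι′
    ; ι-inj = λ {a} {b} p → ι-inj (trans (sym (in-ι′ a)) (trans (cong (punchIn j) p) (in-ι′ b)))
    ; incid = λ a → subst (λ p → Joins FC a (φ′ (proj₁ p)) (φ′ (proj₂ p))) (sym (ends′ (ι′ a)))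
        (subst₂ (Joins FC a) (sym (φ′-μ _)) (sym (φ′-μ _)) (subst (λ e → Joins FC a (φ (proj₁ (ends H e))) (φ (proj₂ (ends H e)))) (sym (in-ι′ a)) (incid a)))
    ; sign = λ a → trans (sign a) (sym (trans (pos′ (ι′ a)) (cong (pos H) (in-ι′ a))))
    ; root = μ ∘ root
    ; φ-root = λ a → trans (φ′-μ (root a)) (φ-root a)
    ; rank = rank′
    ; child = μ ∘ child ∘ punchIn j
    ; parent = μ ∘ parent ∘ punchIn j
    ; tree = λ {e} t → let T = up t ; c , f , r = tree T in
        joins′ e c , trans (φ′-μ _) (trans f (sym (φ′-μ _)))
        , subst (rank′ (μ (parent (punchIn j e))) ℤ.<_) (sym (rank-child (punchInᵢ≢i j e) T)) (ℤ.≤-<-trans (rank-≤ _) r)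
    ; child-inj = λ {e} {f} t t′ p → punchIn-injective j e f (child-inj (up t) (up t′)
        (μ-inj (punchInᵢ≢i j e) (punchInᵢ≢i j f) (up t) (up t′) p))
    ; cover = cover′
    }
    where
    open Forest F
    ι′ : Fin (k + k) → _
    ι′ a = punchOut {i = j} {j = ι a} (λ p → free a (sym p))
    in-ι′ : ∀ a → punchIn j (ι′ a) ≡ ι a
    in-ι′ a = punchIn-punchOut _
    up : ∀ {e} → (∀ a → ι′ a ≢ e) × pos H′ e ≡ true → Tree (punchIn j e)
    up {e} (fr , p) = (λ a q → fr a (punchIn-injective j (ι′ a) e (trans (in-ι′ a) q))) , trans (sym (pos′ e)) p
    joins′ : ∀ e {a b} → Joins H (punchIn j e) a b → Joins H′ e (μ a) (μ b)
    joins′ e (inj₁ p) = inj₁ (trans (ends′ e) (cong (λ p → μ (proj₁ p) , μ (proj₂ p)) p))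
    joins′ e (inj₂ p) = inj₂ (trans (ends′ e) (cong (λ p → μ (proj₁ p) , μ (proj₂ p)) p))
    cover′ : ∀ x → x ≡ μ (root (φ′ x)) ⊎ ∃[ e ] ((∀ a → ι′ a ≢ e) × pos H′ e ≡ true) × μ (child (punchIn j e)) ≡ x
    cover′ x with lift x
    ... | w , refl , inj₁ p = inj₁ (cong μ (trans p (cong root (sym (φ′-μ w)))))
    ... | w , refl , inj₂ (e , e≢j , (fr , q) , refl) = inj₂ (punchOut j≢e
        , ((λ a p → fr a (trans (sym (in-ι′ a)) (trans (cong (punchIn j) p) in-e))) , trans (pos′ _) (trans (cong (pos H) in-e) q))
        , cong (μ ∘ child) in-e)
      where
      j≢e = λ j≡e → e≢j (sym j≡e)
      in-e : punchIn j (punchOut j≢e) ≡ e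
      in-e = punchIn-punchOut j≢e

  delete : ∀ {n m} {H : SGraph n (suc m)} (F : Forest H) j → (∀ a → Forest.ι F a ≢ j) → pos H j ≡ false → Forest (deleteEdge H j)
  delete {H = H} F j free neg = reduce F j free (λ w → w) (λ _ → refl) (λ _ → refl) φ (λ _ → refl) rank (λ _ → ℤ.≤-refl)
    (λ _ _ → refl) (λ _ _ _ _ p → p) lift
    where
    open Forest F
    lift : ∀ x → ∃[ w ] (w ≡ x) × (w ≡ root (φ w) ⊎ ∃[ e ] e ≢ j × Tree e × child e ≡ w)
    lift x with cover x
    ... | inj₁ p = x , refl , inj₁ p
    ... | inj₂ (e , t , p) = x , refl , inj₂ (e , (λ { refl → contradiction (trans (sym neg) (proj₂ t)) λ () }) , t , p)

  module Contract {n m} {H : SGraph (suc n) (suc m)} (F : Forest H) (j : Fin (suc m)) (T : Forest.Tree F j) where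
    open Forest F
    private
      u = proj₁ (ends H j)
      v = proj₂ (ends H j)
      c = child j
      p = parent j

    uv : (c ≡ u × p ≡ v) ⊎ (c ≡ v × p ≡ u)
    uv = Joins-unique {G = H} {e = j} (proj₁ (tree T)) (inj₁ refl)

    c≢p : c ≢ p
    c≢p eq = ℤ.<-irrefl (cong rank (sym eq)) (proj₂ (proj₂ (tree T)))

    u≢v : u ≢ v
    u≢v eq with uv
    ... | inj₁ (a , b) = c≢p (trans a (trans eq (sym b)))
    ... | inj₂ (a , b) = c≢p (trans a (trans (sym eq) (sym b)))

    private
      μ = merge u v u≢v

      μc≡μp : μ c ≡ μ p
      μc≡μp with uv
      ... | inj₁ (a , b) = trans (cong μ a) (trans (sym (merge-v u≢v)) (cong μ (sym b)))
      ... | inj₂ (a , b) = trans (cong μ a) (trans (merge-v u≢v) (cong μ (sym b)))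

      -- The class of c and p is represented by p, so that the rank of the merged
      -- vertex stays above its parent's and below its children's.
      lower : Fin (suc n) → Fin (suc n)
      lower w with w ≟F c
      ... | yes _ = p
      ... | no _  = w

      lower-c : lower c ≡ p
      lower-c with c ≟F c
      ... | yes _ = refl
      ... | no c≢c = contradiction refl c≢c

      lower-≢ : ∀ {w} → w ≢ c → lower w ≡ w
      lower-≢ {w} w≢c with w ≟F c
      ... | yes q = contradiction q w≢c
      ... | no _  = refl

      sec : Fin n → Fin (suc n)
      sec x = lower (punchIn v x)

      sec-v : sec (μ v) ≡ lower v
      sec-v = trans (cong sec (merge-v u≢v)) (trans (cong lower (punchIn-merge u≢v u≢v)) flip)
        where
        flip : lower u ≡ lower v
        flip with uv
        ... | inj₁ (a , b) = trans (cong lower (sym a)) (trans lower-c (trans b (sym (lower-≢ (λ q → u≢v (trans (sym a) (sym q)))))))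
        ... | inj₂ (a , b) = trans (lower-≢ (λ q → u≢v (trans q a))) (trans (sym b) (trans (sym lower-c) (cong lower a)))

      sec-μ : ∀ w → sec (μ w) ≡ lower w
      sec-μ w = go (w ≟F v)
        where
        go : Dec (w ≡ v) → sec (μ w) ≡ lower w
        go (yes w≡v) = trans (cong (sec ∘ μ) w≡v) (trans sec-v (cong lower (sym w≡v)))
        go (no w≢v)  = cong lower (punchIn-merge u≢v w≢v)

      φ-lower : ∀ w → φ (lower w) ≡ φ w
      φ-lower w with w ≟F c
      ... | yes refl = sym (proj₁ (proj₂ (tree T)))
      ... | no _ = refl

      rank-lower : ∀ w → rank (lower w) ℤ.≤ rank w
      rank-lower w with w ≟F c
      ... | yes refl = ℤ.<⇒≤ (proj₂ (proj₂ (tree T)))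
      ... | no _ = ℤ.≤-refl

      child≢c : ∀ {e} → e ≢ j → Tree e → child e ≢ c
      child≢c e≢j t q = e≢j (child-inj t T q)

      μ-sec : ∀ x → μ (sec x) ≡ x
      μ-sec x with punchIn v x ≟F c
      ... | yes q = trans (sym μc≡μp) (trans (cong μ (sym q)) (merge-punchIn u≢v x))
      ... | no _ = merge-punchIn u≢v x

      sec≢c : ∀ x → sec x ≢ c
      sec≢c x with punchIn v x ≟F c
      ... | yes _ = λ q → c≢p (sym q)
      ... | no ≢c = ≢c

    contracted : Forest (contractEdge H j u≢v)
    contracted = reduce F j (proj₁ T) μ (λ _ → refl) (λ _ → refl)
      (φ ∘ sec) (λ w → trans (cong φ (sec-μ w)) (φ-lower w))
      (rank ∘ sec) (λ w → subst (ℤ._≤ rank w) (cong rank (sym (sec-μ w))) (rank-lower w))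
      (λ {e} e≢j t → cong rank (trans (sec-μ (child e)) (lower-≢ (child≢c e≢j t))))
      (λ {e} {f} e≢j f≢j t t′ q → trans (sym (lower-≢ (child≢c e≢j t))) (trans (sym (sec-μ (child e)))
        (trans (cong sec q) (trans (sec-μ (child f)) (lower-≢ (child≢c f≢j t′))))))
      λ x → sec x , μ-sec x , lift x
      where
      lift : ∀ x → sec x ≡ root (φ (sec x)) ⊎ ∃[ e ] e ≢ j × Tree e × child e ≡ sec x
      lift x with cover (sec x)
      ... | inj₁ q = inj₁ q
      ... | inj₂ (e , t , q) = inj₂ (e , (λ { refl → sec≢c x (sym q) }) , t , q)

    -- An edge of the image parallel to `j` would be mapped to a loop of the flow circuit. Any other
    -- parallel edge is a tree edge with the same two ends: either it shares its child with `j`, or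
    -- child and parent are exchanged and the ranks contradict each other.
    unparallel : (∀ e → (∀ a → ι a ≢ e) → pos H e ≡ true) → ∀ e → e ≢ j → ¬ Joins H e u v
    unparallel noNeg e e≢j J with any? (λ a → ι a ≟F e)
    ... | yes (a , refl) = FC-loopless a (φ v) (subst (λ x → Joins FC a x (φ v)) φu≡φv (flat J))
      where
      φu≡φv : φ u ≡ φ v
      φu≡φv with uv
      ... | inj₁ (q , r) = trans (cong φ (sym q)) (trans (proj₁ (proj₂ (tree T))) (cong φ r))
      ... | inj₂ (q , r) = trans (cong φ (sym r)) (trans (sym (proj₁ (proj₂ (tree T)))) (cong φ q))
      flat : Joins H (ι a) u v → Joins FC a (φ u) (φ v)
      flat (inj₁ q) = subst (λ z → Joins FC a (φ (proj₁ z)) (φ (proj₂ z))) q (incid a)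
      flat (inj₂ q) = Joins-sym {G = FC} {e = a} (subst (λ z → Joins FC a (φ (proj₁ z)) (φ (proj₂ z))) q (incid a))
    ... | no ∉ = clash (Joins-unique {G = H} {e = e} (proj₁ (tree Te)) J) uv
      where
      Te : Tree e
      Te = (λ a q → ∉ (a , q)) , noNeg e (λ a q → ∉ (a , q))
      same : child e ≡ c → ⊥
      same q = e≢j (child-inj Te T q)
      crossed : child e ≡ p → parent e ≡ c → ⊥
      crossed q r = ℤ.<-asym (subst₂ ℤ._<_ (cong rank r) (cong rank q) (proj₂ (proj₂ (tree Te)))) (proj₂ (proj₂ (tree T)))
      clash : (child e ≡ u × parent e ≡ v) ⊎ (child e ≡ v × parent e ≡ u) → (c ≡ u × p ≡ v) ⊎ (c ≡ v × p ≡ u) → ⊥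
      clash (inj₁ (a , b)) (inj₁ (a′ , b′)) = same (trans a (sym a′))
      clash (inj₁ (a , b)) (inj₂ (a′ , b′)) = crossed (trans a (sym b′)) (trans b (sym a′))
      clash (inj₂ (a , b)) (inj₁ (a′ , b′)) = crossed (trans a (sym b′)) (trans b (sym a′))
      clash (inj₂ (a , b)) (inj₂ (a′ , b′)) = same (trans a (sym a′))

  finished : ∀ {n m} {H : SGraph n m} (F : Forest H) → (∀ e → ∃[ a ] Forest.ι F a ≡ e) → Iso H FC
  finished {H = H} F onto = record
    { fV = mk↔ₛ′ φ root φ-root root-φ
    ; fE = mk↔ₛ′ (proj₁ ∘ onto) ι (λ a → ι-inj (proj₂ (onto (ι a)))) (proj₂ ∘ onto)
    ; signs = λ e → trans (sign _) (cong (pos H) (proj₂ (onto e)))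
    ; incid = λ e → subst (λ f → Joins FC (proj₁ (onto e)) (φ (proj₁ (ends H f))) (φ (proj₂ (ends H f)))) (proj₂ (onto e)) (incid _)
    }
    where
    open Forest F
    root-φ : ∀ v → root (φ v) ≡ v
    root-φ v with cover v
    ... | inj₁ p = sym p
    ... | inj₂ (e , (fr , _) , _) = contradiction (proj₂ (onto e)) (fr _)

  -- Negative edges outside the image go first, since one parallel to a tree edge would become a
  -- self-loop and block its contraction. Every step removes an edge.
  contract-all : ∀ {n₀ m₀} {G : SGraph n₀ m₀} {n m} {H : SGraph n m} → StrongMinor G H → Forest H →
    ∃[ n′ ] ∃[ m′ ] Σ (SGraph n′ m′) λ H′ → StrongMinor G H′ × Iso H′ FC
  contract-all {m = m} {H} S F with any? (λ e → ¬? (any? λ a → Forest.ι F a ≟F e) ×-dec (pos H e Bool.≟ false))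
  contract-all {m = suc m} {H} S F | yes (j , fr , neg) = contract-all (there S (del H j)) (delete F j (λ a q → fr (a , q)) neg)
  ... | no noNeg with any? (λ e → ¬? (any? λ a → Forest.ι F a ≟F e))
  ...   | no none = _ , _ , H , S , finished F onto
    where
    onto : ∀ e → ∃[ a ] Forest.ι F a ≡ e
    onto e with any? (λ a → Forest.ι F a ≟F e)
    ... | yes p = p
    ... | no ¬p = contradiction (e , ¬p) none
  contract-all {n = zero} {m = suc m} {H} S F | no noNeg | yes (j , fr) with () ← proj₁ (ends H j)
  contract-all {n = suc n} {m = suc m} {H} S F | no noNeg | yes (j , fr) =
    contract-all (there S (con H j (proj₂ T) u≢v (unparallel positive′))) contracted
    where
    positive′ : ∀ e → (∀ a → Forest.ι F a ≢ e) → pos H e ≡ true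
    positive′ e f with pos H e in eq
    ... | true  = refl
    ... | false = contradiction (e , (λ (a , q) → f a q) , eq) noNeg
    T : Forest.Tree F j
    T = (λ a q → fr (a , q)) , positive′ j (λ a q → fr (a , q))
    open Contract F j T

module Quotient {n m} {G : SGraph n m} (K : Circle G) (O : Obstructions.Obstruction K) where
  open Obstructions K
  open Obstruction O
  open Cyclic k′ 5≤k

  Q-+N : ∀ s i → Q (i + s * N) ≡ Q i + s * k
  Q-+N = shift-N Q Q-N

  Q-cong : ∀ {i j} → i ≈ j [mod N ] → Q i ≈ Q j [mod k ]
  Q-cong {i} {j} (s , t , p) = s , t , trans (sym (Q-+N s i)) (trans (cong Q p) (Q-+N t j))

  Q-mono : ∀ {i j} → i ≤ j → Q i ≤ Q j
  Q-mono = step-mono Q λ i → slow-≤ {Q} {i} (Q-slow i)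

  Kept : ℕ → Set
  Kept i = Q (suc i) ≡ suc (Q i)

  Kept-cong : ∀ {i j} → i ≈ j [mod N ] → Kept i → Kept j
  Kept-cong {i} {j} (s , t , p) h = ℕ.+-cancelʳ-≡ (t * k) _ _ (begin
    Q (suc j) + t * k     ≡⟨ Q-+N t (suc j) ⟨
    Q (suc j + t * N)     ≡⟨ cong (Q ∘ suc) p ⟨
    Q (suc i + s * N)     ≡⟨ Q-+N s (suc i) ⟩
    Q (suc i) + s * k     ≡⟨ cong (_+ s * k) h ⟩
    suc (Q i + s * k)     ≡⟨ cong suc (Q-+N s i) ⟨
    suc (Q (i + s * N))   ≡⟨ cong (suc ∘ Q) p ⟩
    suc (Q (j + t * N))   ≡⟨ cong suc (Q-+N t j) ⟩
    suc (Q j) + t * k ∎)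
    where open ≡-Reasoning

  -- A monotone `Q` leaves each value only once.
  kept-≡ : ∀ {i j} → Kept i → Kept j → Q i ≡ Q j → i ≡ j
  kept-≡ {i} {j} hi hj eq = ℕ.≤-antisym (ℕ.≮⇒≥ (apart hj eq)) (ℕ.≮⇒≥ (apart hi (sym eq)))
    where
    apart : ∀ {i j} → Kept i → Q j ≡ Q i → ¬ (i < j)
    apart {i} {j} h eq i<j = ℕ.<⇒≱ (ℕ.n<1+n (Q i)) (subst₂ _≤_ h eq (Q-mono i<j))

  kept-unique : ∀ {i j} → Kept i → Kept j → Q i ≈ Q j [mod k ] → i ≈ j [mod N ]
  kept-unique {i} {j} hi hj (s , t , p) = s , t , kept-≡ (Kept-cong (shiftUp s i) hi) (Kept-cong (shiftUp t j) hj)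
      (trans (Q-+N s i) (trans p (sym (Q-+N t j))))
    where
    shiftUp : ∀ s i → i ≈ i + s * N [mod N ]
    shiftUp s i = ≈-sym (≈-+N i s)

  keep : ∀ a → ∃[ s ] Kept s × Q s ≈ a [mod k ]
  keep a = let s , _ , Qs , Qs′ = crossing Q (suc q * N) (λ s _ → Q-slow s) q lo hi in
    s , trans Qs′ (cong suc (sym Qs)) , 0 , Q 0 , trans (ℕ.+-identityʳ _) Qs
    where
    -- A representative of `a` modulo `k` that is at least `Q 0`.
    q = a + Q 0 * k
    lo : Q 0 ≤ q
    lo = ℕ.≤-trans (ℕ.m≤m*n (Q 0) k) (ℕ.m≤n+m _ a)
    hi : q < Q (suc q * N)
    hi = subst (q <_) (sym (Q-+N (suc q) 0)) (ℕ.≤-trans (ℕ.m≤m*n (suc q) k) (ℕ.m≤n+m _ (Q 0)))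

  φ : Fin n → Fin k
  φ v = Q (idx v) mod k

  φ-V : ∀ i → φ (V i) ≡ Q i mod k
  φ-V i = mod-cong (Q-cong (idx≈ refl))

  φ-V≡ : ∀ {i} {a : Fin k} → Q i ≈ toℕ a [mod k ] → φ (V i) ≡ a
  φ-V≡ {i} {a} p = trans (φ-V i) (trans (mod-cong p) (mod-toℕ a))

  keptAt : Fin k → ℕ
  keptAt i = proj₁ (keep (toℕ i))

  chordAt : Fin k → Fin m
  chordAt i = proj₁ (chord (toℕ i))

  ι′ : Fin k ⊎ Fin k → Fin m
  ι′ (inj₁ i) = E (keptAt i)
  ι′ (inj₂ i) = chordAt i

  ι : Fin (k + k) → Fin m
  ι a = ι′ (splitAt k a)

  ι-kept : ∀ i → ι (i ↑ˡ k) ≡ E (keptAt i)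
  ι-kept i = cong ι′ (splitAt-↑ˡ k i k)

  ι-chord : ∀ i → ι (k ↑ʳ i) ≡ chordAt i
  ι-chord i = cong ι′ (splitAt-↑ʳ k k i)

  chord-neg : ∀ i → pos G (chordAt i) ≡ false
  chord-neg i = IsArc.neg (proj₁ (proj₂ (proj₂ (proj₂ (chord (toℕ i))))))

  keptAt-inj : ∀ {i j} → E (keptAt i) ≡ E (keptAt j) → i ≡ j
  keptAt-inj {i} {j} p = toℕ-injective (≈⇒≡ (toℕ<n i) (toℕ<n j)
    (≈-trans (≈-sym (proj₂ (proj₂ (keep (toℕ i))))) (≈-trans (Q-cong (E-inj p)) (proj₂ (proj₂ (keep (toℕ j)))))))

  -- One edge used for two classes would have to be used in opposite directions. Its two arcs then
  -- close up to a full turn with `Q` rising by 2 on each, so that 4 ≡ 0 modulo `k`.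
  chordAt-inj : ∀ {i j} → chordAt i ≡ chordAt j → i ≡ j
  chordAt-inj {i} {j} p with chord (toℕ i) | chord (toℕ j)
  chordAt-inj {i} {j} refl | e , u , L , arc , q , r | _ , u′ , L′ , arc′ , q′ , r′ with arc-unique arc arc′
  ... | inj₁ (uu , _) = toℕ-injective (≈⇒≡ (toℕ<n i) (toℕ<n j) (≈-trans (≈-sym q) (≈-trans (Q-cong uu) q′)))
  ... | inj₂ (uu , LL) = ⊥-elim (small≉0 3 ℕ.≤-refl (≈-cancelˡ (Q u) (begin
    Q u + 4           ≈⟨ ≈-reflexive (sym (ℕ.+-assoc (Q u) 2 2)) ⟩
    Q u + 2 + 2       ≈⟨ ≈-reflexive (cong (_+ 2) (sym r)) ⟩
    Q (u + L) + 2     ≈⟨ ≈-+ (Q-cong uu) ≈-refl ⟩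
    Q u′ + 2          ≈⟨ ≈-reflexive (sym r′) ⟩
    Q (u′ + L′)       ≈⟨ Q-cong (≈-+ (≈-sym uu) ≈-refl) ⟩
    Q (u + L + L′)    ≈⟨ ≈-reflexive (cong Q (trans (ℕ.+-assoc u L L′) (cong (u +_) LL))) ⟩
    Q (u + N)         ≈⟨ Q-cong (≈-period u) ⟩
    Q u               ≈⟨ ≈-reflexive (sym (ℕ.+-identityʳ (Q u))) ⟩
    Q u + 0 ∎)))
    where
    infix 1 begin_
    infixr 2 _≈⟨_⟩_
    infix 3 _∎
    begin_ : ∀ {a b} → a ≈ b [mod k ] → a ≈ b [mod k ]
    begin p = p
    _≈⟨_⟩_ : ∀ a {b c} → a ≈ b [mod k ] → b ≈ c [mod k ] → a ≈ c [mod k ]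
    _ ≈⟨ p ⟩ q = ≈-trans p q
    _∎ : ∀ a → a ≈ a [mod k ]
    _ ∎ = ≈-refl

  kept≢chord : ∀ {i e} → pos G e ≡ false → E i ≢ e
  kept≢chord {i} neg refl with () ← trans (sym (E-pos i)) neg

  -- The combination of `i` and `Q i` that a full turn leaves fixed, so that it is a function of the
  -- vertex. Along an edge that is not kept only the first term grows.
  rankAt : ℕ → ℤ
  rankAt i = (i * k) ⊖ (N * Q i)

  rankAt-+N : ∀ s i → rankAt (i + s * N) ≡ rankAt i
  rankAt-+N s i = trans (cong₂ _⊖_ (e₁ i s N k) (trans (cong (N *_) (Q-+N s i)) (e₂ N (Q i) s k)))
      (ℤ.+-cancelˡ-⊖ (s * N * k) (i * k) (N * Q i))
    where
    e₁ : ∀ i s N k → (i + s * N) * k ≡ s * N * k + i * k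
    e₁ = solve-∀
    e₂ : ∀ N q s k → N * (q + s * k) ≡ s * N * k + N * q
    e₂ = solve-∀

  rankAt-cong : ∀ {i j} → i ≈ j [mod N ] → rankAt i ≡ rankAt j
  rankAt-cong {i} {j} (s , t , p) = trans (sym (rankAt-+N s i)) (trans (cong rankAt p) (rankAt-+N t j))

  forest : Forest G
  forest = record
    { φ = φ ; ι = ι ; ι-inj = ι-inj ; incid = λ a → incid (edgeView a) ; sign = λ a → sign (edgeView a)
    ; root = root ; φ-root = φ-root ; rank = rankAt ∘ idx
    ; child = λ e → V (suc (posIdx e)) ; parent = λ e → V (posIdx e)
    ; tree = tree ; child-inj = child-inj ; cover = cover }
    where
    ι-inj : Injective _≡_ _≡_ ι
    ι-inj {a} {b} p with edgeView a | edgeView b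
    ... | positive i | positive j = cong (_↑ˡ k) (keptAt-inj (trans (sym (ι-kept i)) (trans p (ι-kept j))))
    ... | positive i | negative j = ⊥-elim (kept≢chord (chord-neg j) (trans (sym (ι-kept i)) (trans p (ι-chord j))))
    ... | negative i | positive j = ⊥-elim (kept≢chord (chord-neg i) (trans (sym (ι-kept j)) (trans (sym p) (ι-chord i))))
    ... | negative i | negative j = cong (k ↑ʳ_) (chordAt-inj (trans (sym (ι-chord i)) (trans p (ι-chord j))))

    incid : ∀ {a} → EdgeView a → Joins FC a (φ (proj₁ (ends G (ι a)))) (φ (proj₂ (ends G (ι a))))
    incid {a} (positive i) = subst (λ f → Joins FC a (φ (proj₁ (ends G f))) (φ (proj₂ (ends G f)))) (sym (ι-kept i))
      (Joins-map {G = G} {H = FC} φ {e = E (keptAt i)} {f = a} (E-joins (keptAt i)) (inj₁ (trans (FC-positive i) (cong₂ _,_ (sym (φ-V≡ (proj₂ (proj₂ (keep (toℕ i))))))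
        (sym (trans (φ-V _) (mod-cong (≈-trans (≈-reflexive (proj₁ (proj₂ (keep (toℕ i))))) (≈-suc (proj₂ (proj₂ (keep (toℕ i)))))))))))))
    incid {a} (negative i) = subst (λ f → Joins FC a (φ (proj₁ (ends G f))) (φ (proj₂ (ends G f)))) (sym (ι-chord i)) go
      where
      go : Joins FC a (φ (proj₁ (ends G (chordAt i)))) (φ (proj₂ (ends G (chordAt i))))
      go with f , u , L , arc , q , r ← chord (toℕ i) = Joins-map {G = G} {H = FC} φ {e = f} {f = a} (IsArc.chord arc) (inj₁ (trans (FC-negative i) (cong₂ _,_ (sym (φ-V≡ q))
        (sym (trans (φ-V (u + L)) (mod-cong (≈-trans (≈-reflexive (trans r (ℕ.+-comm (Q u) 2))) (≈-suc (≈-suc q)))))))))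

    sign : ∀ {a} → EdgeView a → pos FC a ≡ pos G (ι a)
    sign (positive i) = trans (FC-pos i) (sym (trans (cong (pos G) (ι-kept i)) (E-pos _)))
    sign (negative i) = trans (FC-neg i) (sym (trans (cong (pos G) (ι-chord i)) (chord-neg i)))

    -- `k′` is -1 modulo `k`: this is the kept edge that enters class `a`. Each class is a path of
    -- the circuit, rooted at its first vertex.
    before : ∀ (a : Fin k) → ∃[ s ] Kept s × Q s ≈ toℕ a + k′ [mod k ]
    before a = keep (toℕ a + k′)

    root : Fin k → Fin n
    root a = V (suc (proj₁ (before a)))

    suc-before : ∀ a → Q (suc (proj₁ (before a))) ≈ toℕ a [mod k ]
    suc-before a = ≈-trans (≈-reflexive (proj₁ (proj₂ (before a)))) (≈-trans (≈-suc (proj₂ (proj₂ (before a)))) (≈-suc-period (toℕ a)))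

    φ-root : ∀ a → φ (root a) ≡ a
    φ-root a = φ-V≡ (suc-before a)

    Free : Fin m → Set
    Free e = (∀ a → ι a ≢ e) × pos G e ≡ true

    unkept : ∀ {e} → Free e → Q (suc (posIdx e)) ≡ Q (posIdx e)
    unkept {e} (fr , p) with Q-slow (posIdx e)
    ... | inj₁ stay = stay
    ... | inj₂ h = contradiction (trans (ι-kept a) (trans (E-cong (kept-unique (proj₁ (proj₂ (keep (toℕ a)))) h
            (≈-trans (proj₂ (proj₂ (keep (toℕ a)))) (toℕ-mod≈ (Q (posIdx e)))))) (E-posIdx e p))) (fr (a ↑ˡ k))
      where a = Q (posIdx e) mod k

    tree : ∀ {e} → Free e → Joins G e (V (suc (posIdx e))) (V (posIdx e)) × φ (V (suc (posIdx e))) ≡ φ (V (posIdx e))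
      × rankAt (idx (V (posIdx e))) ℤ.< rankAt (idx (V (suc (posIdx e))))
    tree {e} f@(fr , p) = Joins-sym {G = G} {e = e} (subst (λ z → Joins G z (V i) (V (suc i))) (E-posIdx e p) (E-joins i))
      , trans (φ-V (suc i)) (trans (cong (_mod k) (unkept f)) (sym (φ-V i)))
      , subst₂ ℤ._<_ (sym (rankAt-cong (idx≈ refl))) (sym (rankAt-cong (idx≈ refl)))
          (subst (λ q → rankAt i ℤ.< (suc i * k) ⊖ (N * q)) (sym (unkept f)) (ℤ.⊖-monoˡ-< (N * Q i) (ℕ.m<n+m (i * k) {k} (s≤s z≤n))))
      where i = posIdx e

    child-inj : ∀ {e f} → Free e → Free f → V (suc (posIdx e)) ≡ V (suc (posIdx f)) → e ≡ f
    child-inj {e} {f} (_ , p) (_ , p′) eq = trans (sym (E-posIdx e p)) (trans (E-cong (≈-pred (V-inj eq))) (E-posIdx f p′))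

    -- As `l` is -1 modulo `N`, `idx v + l` is the index of the edge that ends in `v`. If it is
    -- kept, `v` is the first vertex of its class; otherwise `v` is the child of this edge.
    cover : ∀ v → v ≡ root (φ v) ⊎ ∃[ e ] Free e × V (suc (posIdx e)) ≡ v
    cover v with Q-slow (idx v + l)
    ... | inj₂ h = inj₁ (trans (sym (trans (V-cong (≈-suc-period (idx v))) (V-idx v))) (V-cong (≈-suc (kept-unique h h′ (≈-pred same)))))
      where
      h′ = proj₁ (proj₂ (before (φ v)))
      same : suc (Q (idx v + l)) ≈ suc (Q (proj₁ (before (φ v)))) [mod k ]
      same = ≈-trans (≈-reflexive (sym h)) (≈-trans (Q-cong (≈-suc-period (idx v))) (≈-trans (≈-sym (toℕ-mod≈ (Q (idx v))))
        (≈-trans (≈-sym (suc-before (φ v))) (≈-reflexive h′))))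
    ... | inj₁ stay = inj₂ (E i , (fr , E-pos i) , trans (V-cong (≈-trans (≈-suc (posIdx-E i)) (≈-suc-period (idx v)))) (V-idx v))
      where
      i = idx v + l
      fr : ∀ a → ι a ≢ E i
      fr a p with edgeView a
      ... | negative j = kept≢chord (chord-neg j) (trans (sym p) (ι-chord j))
      ... | positive j = ℕ.1+n≢n (trans (sym (Kept-cong (E-inj (trans (sym (ι-kept j)) p)) (proj₁ (proj₂ (keep (toℕ j)))))) stay)

obstruction⇒minor : ∀ {n m} {G : SGraph n m} (K : Circle G) → Obstructions.Obstruction K → HasOddFlowCircuitMinor5 G
obstruction⇒minor K O = k′ , 5≤k , odd , Cyclic.contract-all k′ 5≤k here (Quotient.forest K O)
  where open Obstructions.Obstruction O

-- From minors to obstructions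

weight : Bool → ℕ
weight b = if b then 1 else 0

posCount : ∀ {n m} → SGraph n m → ℕ
posCount G = sum (λ e → weight (pos G e))

posCount-punchIn : ∀ {n m} (G : SGraph n (suc m)) j → posCount G ≡ weight (pos G j) + sum (λ e → weight (pos G (punchIn j e)))
posCount-punchIn G j = sum-remove {i = j} (λ e → weight (pos G e))

-- Each entry of the list accounts for at most one `true`: the induction masks the first entry and
-- lists what is left.
sum-≤ : ∀ {m c} (p : Fin m → Bool) (f : Fin c → Fin m) → (∀ e → p e ≡ true → ∃[ i ] f i ≡ e) → sum (weight ∘ p) ≤ c
sum-≤ {m} {zero} p f onto = ℕ.≤-reflexive (trans (sum-cong-≗ λ e → off e) (sum-replicate-zero m))
  where
  off : ∀ e → weight (p e) ≡ 0
  off e with p e in eq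
  ... | false = refl
  ... | true with () ← proj₁ (onto e eq)
sum-≤ {zero} {suc c} p f onto = z≤n
sum-≤ {suc m} {suc c} p f onto = ℕ.≤-trans (ℕ.≤-reflexive (sum-remove {i = j} (weight ∘ p)))
    (ℕ.+-mono-≤ (weight≤1 (p j)) (restrict (sum-≤ p′ (f ∘ Fin.suc) onto′)))
  where
  j = f Fin.zero
  weight≤1 : ∀ b → weight b ≤ 1
  weight≤1 true  = ℕ.≤-refl
  weight≤1 false = z≤n
  mask : ∀ {e} → Dec (e ≡ j) → Bool
  mask {e} (yes _) = false
  mask {e} (no _)  = p e
  p′ : Fin (suc m) → Bool
  p′ e = mask (e ≟F j)
  onto′ : ∀ e → p′ e ≡ true → ∃[ i ] f (Fin.suc i) ≡ e
  onto′ e q with e ≟F j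
  onto′ e () | yes _
  ... | no e≢j with onto e q
  ...   | Fin.zero , r = contradiction (sym r) e≢j
  ...   | Fin.suc i , r = i , r
  unmasked : ∀ e → weight (p (punchIn j e)) ≡ weight (p′ (punchIn j e))
  unmasked e with punchIn j e ≟F j
  ... | yes q = contradiction q (punchInᵢ≢i j e)
  ... | no _ = refl
  restrict : sum (weight ∘ p′) ≤ c → sum (λ e → weight (p (punchIn j e))) ≤ c
  restrict h = ℕ.≤-trans (ℕ.≤-reflexive (sum-cong-≗ unmasked))
    (ℕ.≤-trans (ℕ.m≤n+m _ (weight (p′ j))) (ℕ.≤-trans (ℕ.≤-reflexive (sym (sum-remove {i = j} (weight ∘ p′)))) h))

circle-posCount : ∀ {n m} {G : SGraph n m} → Circle G → posCount G ≤ n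
circle-posCount {G = G} K = ℕ.≤-trans (sum-≤ (pos G) (λ (i : Fin N) → E (toℕ i)) λ e p → let i , i<N , q = eidx e p in
    fromℕ< i<N , trans (cong E (toℕ-fromℕ< i<N)) q) N≤n
  where
  open Circle K

flowCircuit-posCount : ∀ k′ → suc k′ ≤ posCount (flowCircuit k′)
flowCircuit-posCount k′ = ℕ.≤-trans (count (suc k′) (suc k′)) (ℕ.≤-reflexive (sum-cong-≗ λ e → sign e))
  where
  isPos : ∀ {a b} → Fin a ⊎ Fin b → Bool
  isPos (inj₁ _) = true
  isPos (inj₂ _) = false
  sign : ∀ e → weight (isPos (splitAt (suc k′) e)) ≡ weight (pos (flowCircuit k′) e)
  sign e with splitAt (suc k′) e
  ... | inj₁ _ = refl
  ... | inj₂ _ = refl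
  count : ∀ a b → a ≤ sum (λ (e : Fin (a + b)) → weight (isPos (splitAt a e)))
  count zero    b = z≤n
  count (suc a) b = s≤s (ℕ.≤-trans (count a b) (ℕ.≤-reflexive (sum-cong-≗ λ e → same e)))
    where
    same : ∀ e → weight (isPos (splitAt a e)) ≡ weight (isPos (splitAt (suc a) (Fin.suc e)))
    same e with splitAt a e
    ... | inj₁ _ = refl
    ... | inj₂ _ = refl

-- H is a minor of G in which no positive edge was deleted.
record Contraction {n m n′ m′} (G : SGraph n m) (H : SGraph n′ m′) : Set where
  field
    φ      : Fin n → Fin n′
    ι      : Fin m′ → Fin m
    ι-inj  : Injective _≡_ _≡_ ι
    ends-φ : ∀ e → ends H e ≡ (φ (proj₁ (ends G (ι e))) , φ (proj₂ (ends G (ι e))))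
    sign   : ∀ e → pos H e ≡ pos G (ι e)
    lost   : ∀ f → pos G f ≡ true → (∃[ e ] ι e ≡ f) ⊎ φ (proj₁ (ends G f)) ≡ φ (proj₂ (ends G f))

-- Deleting a positive edge leaves fewer positive edges than vertices for good.
minor⇒contraction : ∀ {n m n′ m′} {G : SGraph n m} {H : SGraph n′ m′} → posCount G ≤ n → StrongMinor G H →
  posCount H < n′ ⊎ (posCount H ≤ n′ × Contraction G H)
minor⇒contraction few here = inj₂ (few , record
  { φ = λ v → v ; ι = λ e → e ; ι-inj = λ p → p ; ends-φ = λ _ → refl ; sign = λ _ → refl ; lost = λ f _ → inj₁ (f , refl) })
minor⇒contraction {G = G} few (there {n′} S (del H j)) with pos H j in eq | posCount-punchIn H j | minor⇒contraction few S
... | true  | c | inj₁ lt = inj₁ (ℕ.<-trans (subst (posCount (deleteEdge H j) <_) (sym c) (ℕ.n<1+n _)) lt)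
... | true  | c | inj₂ (le , _) = inj₁ (subst (_≤ n′) c le)
... | false | c | inj₁ lt = inj₁ (subst (_< n′) c lt)
... | false | c | inj₂ (le , C) = inj₂ (subst (_≤ n′) c le , record
  { φ = φ ; ι = ι ∘ punchIn j ; ι-inj = λ {a} {b} p → punchIn-injective j a b (ι-inj p)
  ; ends-φ = λ e → ends-φ (punchIn j e) ; sign = λ e → sign (punchIn j e) ; lost = lost′ })
  where
  open Contraction C
  lost′ : ∀ f → pos G f ≡ true → (∃[ e ] ι (punchIn j e) ≡ f) ⊎ φ (proj₁ (ends G f)) ≡ φ (proj₂ (ends G f))
  lost′ f p with lost f p
  ... | inj₂ q = inj₂ q
  ... | inj₁ (e , refl) with j ≟F e
  ...   | yes refl = contradiction (trans (sym p) (trans (sym (sign j)) eq)) λ ()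
  ...   | no j≢e = inj₁ (punchOut j≢e , cong ι (punchIn-punchOut j≢e))
minor⇒contraction {G = G} few (there S (con {n = n′} H j pj u≢v _)) with posCount-punchIn H j | minor⇒contraction few S
... | c | inj₁ lt = inj₁ (ℕ.≤-pred (subst (_< suc n′) (trans c (cong (λ b → weight b + posCount (contractEdge H j u≢v)) pj)) lt))
... | c | inj₂ (le , C) = inj₂ (ℕ.≤-pred (subst (_≤ suc n′) (trans c (cong (λ b → weight b + posCount (contractEdge H j u≢v)) pj)) le) , record
  { φ = μ ∘ φ ; ι = ι ∘ punchIn j ; ι-inj = λ {a} {b} p → punchIn-injective j a b (ι-inj p)
  ; ends-φ = λ e → cong (λ p → μ (proj₁ p) , μ (proj₂ p)) (ends-φ (punchIn j e)) ; sign = λ e → sign (punchIn j e) ; lost = lost′ })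
  where
  open Contraction C
  μ = merge _ _ u≢v
  lost′ : ∀ f → pos G f ≡ true → (∃[ e ] ι (punchIn j e) ≡ f) ⊎ μ (φ (proj₁ (ends G f))) ≡ μ (φ (proj₂ (ends G f)))
  lost′ f p with lost f p
  ... | inj₂ q = inj₂ (cong μ q)
  ... | inj₁ (e , refl) with j ≟F e
  ...   | yes refl = inj₂ (subst (λ p → μ (proj₁ p) ≡ μ (proj₂ p)) (ends-φ j) (sym (merge-v u≢v)))
  ...   | no j≢e = inj₁ (punchOut j≢e , cong ι (punchIn-punchOut j≢e))

-- The data are a `Contraction` followed by an isomorphism onto the flow circuit. Going once round
-- the circuit of `G`, the images under `φ` form a closed walk on the positive cycle of the flow
-- circuit, and `Q` counts its moves.
module Model {n m} {G : SGraph n m} (K : Circle G) (k′ : ℕ) (5≤k : 5 ≤ suc k′) (odd : ¬ (2 ∣ suc k′))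
  (φ : Fin n → Fin (suc k′)) (ι : Fin (suc k′ + suc k′) → Fin m) (ι-inj : Injective _≡_ _≡_ ι)
  (incid : ∀ a → Joins (flowCircuit k′) a (φ (proj₁ (ends G (ι a)))) (φ (proj₂ (ends G (ι a)))))
  (sign : ∀ a → pos (flowCircuit k′) a ≡ pos G (ι a))
  (lost : ∀ f → pos G f ≡ true → (∃[ a ] ι a ≡ f) ⊎ φ (proj₁ (ends G f)) ≡ φ (proj₂ (ends G f))) where
  open Obstructions K using (Obstruction; IsArc; mkArc)
  open Circle K
  open Cyclic k′ 5≤k

  Image : Fin m → Set
  Image f = ∃[ a ] ι a ≡ f

  image? : ∀ f → Dec (Image f)
  image? f = any? (λ a → ι a ≟F f)

  bump : ∀ {f} → Dec (Image f) → ℕ → ℕ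
  bump (yes _) q = suc q
  bump (no _)  q = q

  -- The zeros are defaults: a trail consults `γ` only at steps that move, where the edge is the
  -- image of a positive one.
  label : ∀ {f} → Dec (Image f) → ℕ
  label (yes (a , _)) with edgeView a
  ... | positive j = toℕ j
  ... | negative _ = 0
  label (no _) = 0

  Q α γ : ℕ → ℕ
  Q zero    = 0
  Q (suc i) = bump (image? (E i)) (Q i)
  α i = toℕ (φ (V i))
  γ i = label (image? (E i))

  data StepView (i : ℕ) : Set where
    stay : Q (suc i) ≡ Q i → ¬ Image (E i) → StepView i
    move : (j : Fin k) → Q (suc i) ≡ suc (Q i) → ι (j ↑ˡ k) ≡ E i → γ i ≡ toℕ j → StepView i

  stepView : ∀ i → StepView i
  stepView i = go (image? (E i)) refl refl
    where
    go : (d : Dec (Image (E i))) → Q (suc i) ≡ bump d (Q i) → γ i ≡ label d → StepView i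
    go (no ¬p) q g = stay q ¬p
    go (yes (a , p)) q g with edgeView a
    ... | positive j = move j q p g
    ... | negative j = contradiction (trans (sym (trans (cong (pos G) p) (E-pos i))) (trans (sym (sign a)) (FC-neg j))) λ ()

  Q-slow : ∀ i → Slow Q i
  Q-slow i with stepView i
  ... | stay q _ = inj₁ q
  ... | move _ q _ _ = inj₂ q

  moved : ∀ {i} → Q (suc i) ≡ suc (Q i) → Σ (Fin k) λ j → ι (j ↑ˡ k) ≡ E i × γ i ≡ toℕ j
  moved {i} h with stepView i
  ... | stay q _ = contradiction (trans (sym h) q) ℕ.1+n≢n
  ... | move j _ p g = j , p , g

  Joins-φ : ∀ {a x y} → Joins G (ι a) x y → Joins FC a (φ x) (φ y)
  Joins-φ {a} (inj₁ p) = subst (λ z → Joins FC a (φ (proj₁ z)) (φ (proj₂ z))) p (incid a)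
  Joins-φ {a} (inj₂ p) = Joins-sym {G = FC} {e = a} (subst (λ z → Joins FC a (φ (proj₁ z)) (φ (proj₂ z))) p (incid a))

  -- By `lost`, a positive edge outside the image has its ends identified and does not move the
  -- walk. Two moves along the same edge of the cycle would come from the same edge of `G`, which a
  -- single turn meets only once.
  trail : Trail k N α γ Q
  trail = record { start = refl ; move = λ s _ → step s ; distinct = distinct }
    where
    step : ∀ s → (Q (suc s) ≡ Q s × α (suc s) ≈ α s [mod k ]) ⊎ (Q (suc s) ≡ suc (Q s) × Across k (α s) (α (suc s)) (γ s))
    step s with stepView s
    step s | stay q out with lost (E s) (E-pos s)
    ... | inj₁ im = contradiction im out
    ... | inj₂ p = inj₁ (q , ≈-reflexive (cong toℕ (sym (flat (E-joins s)))))
      where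
      flat : Joins G (E s) (V s) (V (suc s)) → φ (V s) ≡ φ (V (suc s))
      flat (inj₁ r) = subst (λ z → φ (proj₁ z) ≡ φ (proj₂ z)) r p
      flat (inj₂ r) = sym (subst (λ z → φ (proj₁ z) ≡ φ (proj₂ z)) r p)
    step s | move j q p g = inj₂ (q , across (Joins-unique {G = FC} {e = j ↑ˡ k}
        (Joins-φ (subst (λ f → Joins G f (V s) (V (suc s))) (sym p) (E-joins s))) (inj₁ (FC-positive j))))
      where
      γj : toℕ j ≈ γ s [mod k ]
      γj = ≈-reflexive (sym g)
      across : (φ (V s) ≡ j × φ (V (suc s)) ≡ suc (toℕ j) mod k) ⊎ (φ (V s) ≡ suc (toℕ j) mod k × φ (V (suc s)) ≡ j) → Across k (α s) (α (suc s)) (γ s)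
      across (inj₁ (x , y)) = inj₁ (≈-trans (≈-reflexive (cong toℕ x)) γj , ≈-trans (≈-reflexive (cong toℕ y)) (≈-trans (toℕ-mod≈ _) (≈-suc γj)))
      across (inj₂ (x , y)) = inj₂ (≈-trans (≈-reflexive (cong toℕ x)) (≈-trans (toℕ-mod≈ _) (≈-suc γj)) , ≈-trans (≈-reflexive (cong toℕ y)) γj)
    distinct : ∀ s t → s < t → t < N → Q (suc s) ≡ suc (Q s) → Q (suc t) ≡ suc (Q t) → ¬ (γ s ≈ γ t [mod k ])
    distinct s t s<t t<N hs ht eq with moved hs | moved ht
    ... | i , p , g | j , p′ , g′ = ℕ.<⇒≢ s<t (≈⇒≡ (ℕ.<-trans s<t t<N) t<N (E-inj (trans (sym p) (trans (cong (λ z → ι (z ↑ˡ k)) i≡j) p′))))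
      where
      i≡j : i ≡ j
      i≡j = toℕ-injective (≈⇒≡ (toℕ<n i) (toℕ<n j) (≈-trans (≈-reflexive (sym g)) (≈-trans eq (≈-reflexive g′))))

  oriented : (∃[ u ] Forward k N α γ Q u) ⊎ (∃[ u ] Backward k N α γ Q u)
  oriented = trail-monotone N trail

  α-N : α N ≡ α 0
  α-N = cong (toℕ ∘ φ) (V-cong (≈-period 0))

  QN≈0 : Q N ≈ 0 [mod k ]
  QN≈0 with oriented
  ... | inj₁ (u , f , _) = ≈-cancelˡ u (≈-trans (≈-sym (f N ℕ.≤-refl)) (≈-trans (≈-reflexive α-N) (f 0 z≤n)))
  ... | inj₂ (u , f , _) = ≈-cancelˡ (α 0) (≈-trans (≈-reflexive (cong (_+ Q N) (sym α-N))) (≈-trans (f N ℕ.≤-refl) (≈-sym (f 0 z≤n))))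

  Q-mono : ∀ {i j} → i ≤ j → Q i ≤ Q j
  Q-mono = step-mono Q λ i → slow-≤ {Q} {i} (Q-slow i)

  -- In a walk that never turns, the moves numbered 0 and `k` would use the same edge of the cycle.
  QN≤k : Q N ≤ k
  QN≤k = ℕ.≮⇒≥ λ k<QN →
    let s , s<N , Qs , Qs′ = crossing Q N (λ s _ → Q-slow s) 0 z≤n (ℕ.<-trans (s≤s z≤n) k<QN)
        t , t<N , Qt , Qt′ = crossing Q N (λ s _ → Q-slow s) k z≤n k<QN
        hs = trans Qs′ (cong suc (sym Qs))
        ht = trans Qt′ (cong suc (sym Qt))
    in Trail.distinct trail s t (ℕ.≰⇒> λ t≤s → ℕ.<⇒≱ (s≤s z≤n) (subst₂ _≤_ Qt Qs (Q-mono t≤s))) t<N hs ht (same s<N t<N hs ht Qs Qt)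
    where
    same : ∀ {s t} → s < N → t < N → Q (suc s) ≡ suc (Q s) → Q (suc t) ≡ suc (Q t) → Q s ≡ 0 → Q t ≡ k → γ s ≈ γ t [mod k ]
    same {s} {t} s<N t<N hs ht Qs Qt with oriented
    ... | inj₁ (u , _ , g) = ≈-trans (g s s<N hs) (≈-trans (≈-+ {a = u} ≈-refl 0≈k) (≈-sym (g t t<N ht)))
      where
      0≈k : Q s ≈ Q t [mod k ]
      0≈k = ≈-trans (≈-reflexive Qs) (≈-trans {b = k} (1 , 0 , refl) (≈-reflexive (sym Qt)))
    ... | inj₂ (u , _ , g) = ≈-cancelʳ (Q s) (≈-pred (≈-trans (g s s<N hs) (≈-trans (≈-sym (g t t<N ht)) (≈-suc (≈-+ {a = γ t} ≈-refl k≈0)))))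
      where
      k≈0 : Q t ≈ Q s [mod k ]
      k≈0 = ≈-trans (≈-reflexive Qt) (≈-trans (0 , 1 , refl) (≈-reflexive (sym Qs)))

  QN≥1 : 1 ≤ Q N
  QN≥1 with i , i<N , q ← eidx (ι (Fin.zero ↑ˡ k)) (trans (sym (sign (Fin.zero ↑ˡ k))) (FC-pos Fin.zero)) with stepView i
  ... | stay _ out = contradiction (Fin.zero ↑ˡ k , sym q) out
  ... | move _ h _ _ = ℕ.≤-trans (subst (1 ≤_) (sym h) (s≤s z≤n)) (Q-mono i<N)

  Q-N : Q N ≡ k
  Q-N with ≈-split QN≈0
  ... | inj₂ (s , p) = contradiction QN≥1 (subst (λ q → ¬ (1 ≤ q)) (sym (ℕ.m+n≡0⇒m≡0 (Q N) (sym p))) λ ())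
  ... | inj₁ (zero , p) = contradiction QN≥1 (subst (λ q → ¬ (1 ≤ q)) (sym p) λ ())
  ... | inj₁ (suc zero , p) = trans p (ℕ.+-identityʳ k)
  ... | inj₁ (suc (suc s) , p) = contradiction (subst (_≤ k) p QN≤k) (ℕ.<⇒≱ (ℕ.m<m+n k (s≤s z≤n)))

  Q-+N : ∀ i → Q (i + N) ≡ Q i + k
  Q-+N zero    = Q-N
  Q-+N (suc i) = trans (cong (λ f → bump (image? f) (Q (i + N))) (E-cong (≈-period i)))
                       (trans (cong (bump (image? (E i))) (Q-+N i)) (bump-+ (image? (E i))))
    where
    bump-+ : (d : Dec (Image (E i))) → bump d (Q i + k) ≡ bump d (Q i) + k
    bump-+ (yes _) = refl
    bump-+ (no _)  = refl

  -- On an arc shorter than a full turn `Q` rises by something between 0 and `k`, and its residue 2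
  -- leaves only the value 2.
  arc-of : ∀ {e P P′} q → pos G e ≡ false → Joins G e P P′ → Q (idx P) ≈ q [mod k ] → Q (idx P′) ≈ Q (idx P) + 2 [mod k ] →
    ∃[ e ] ∃[ u ] ∃[ L ] IsArc e u L × Q u ≈ q [mod k ] × Q (u + L) ≡ Q u + 2
  arc-of {e} {P} {P′} q neg J at apart = e , i , L , mkArc neg chord′ L<N , at , two-apart
    where
    i = idx P
    i′ = idx P′
    lifted : ∃[ L ] L < N × i + L ≈ i′ [mod N ]
    lifted with ℕ.≤-total i i′
    ... | inj₁ i≤i′ = i′ ∸ i , ℕ.≤-<-trans (ℕ.m∸n≤m i′ i) (idx< P′) , ≈-reflexive (ℕ.m+[n∸m]≡n i≤i′)
    ... | inj₂ i′≤i with ℕ.m≤n⇒m<n∨m≡n i′≤i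
    ...   | inj₂ eq = 0 , s≤s z≤n , ≈-reflexive (trans (ℕ.+-identityʳ i) (sym eq))
    ...   | inj₁ i′<i = N ∸ (i ∸ i′) , ℕ.∸-monoʳ-< (ℕ.m<n⇒0<n∸m i′<i) (ℕ.≤-trans (ℕ.m∸n≤m i i′) (ℕ.<⇒≤ (idx< P)))
              , ≈-trans (≈-reflexive (begin
                i + (N ∸ (i ∸ i′))                 ≡⟨ cong (_+ (N ∸ (i ∸ i′))) (ℕ.m+[n∸m]≡n i′≤i) ⟨
                i′ + (i ∸ i′) + (N ∸ (i ∸ i′))     ≡⟨ ℕ.+-assoc i′ (i ∸ i′) _ ⟩
                i′ + ((i ∸ i′) + (N ∸ (i ∸ i′)))   ≡⟨ cong (i′ +_) (ℕ.m+[n∸m]≡n (ℕ.≤-trans (ℕ.m∸n≤m i i′) (ℕ.<⇒≤ (idx< P)))) ⟩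
                i′ + N ∎)) (≈-period i′)
      where open ≡-Reasoning
    L = proj₁ lifted
    L<N = proj₁ (proj₂ lifted)
    i+L≈i′ = proj₂ (proj₂ lifted)
    chord′ : Joins G e (V i) (V (i + L))
    chord′ = subst₂ (Joins G e) (sym (V-idx P)) (sym (trans (V-cong i+L≈i′) (V-idx P′))) J
    Q-cong : ∀ {i j} → i ≈ j [mod N ] → Q i ≈ Q j [mod k ]
    Q-cong {i} {j} (s , t , p) = s , t , trans (sym (shift-N Q Q-+N s i)) (trans (cong Q p) (shift-N Q Q-+N t j))
    d = Q (i + L) ∸ Q i
    Qd : Q i + d ≡ Q (i + L)
    Qd = ℕ.m+[n∸m]≡n (Q-mono (ℕ.m≤m+n i L))
    d≤k : d ≤ k
    d≤k = ℕ.+-cancelˡ-≤ (Q i) _ _ (subst₂ _≤_ (sym Qd) (Q-+N i) (Q-mono (ℕ.+-monoʳ-≤ i (ℕ.<⇒≤ L<N))))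
    d≈2 : d ≈ 2 [mod k ]
    d≈2 = ≈-cancelˡ (Q i) (≈-trans (≈-reflexive Qd) (≈-trans (Q-cong i+L≈i′) apart))
    d≡2 : d ≡ 2
    d≡2 with ℕ.m≤n⇒m<n∨m≡n d≤k
    ... | inj₁ d<k = ≈⇒≡ d<k (ℕ.<-≤-trans (s≤s (s≤s (s≤s z≤n))) 5≤k) d≈2
    ... | inj₂ d≡k = ⊥-elim (small≉0 1 (s≤s (s≤s z≤n)) (≈-trans (≈-sym d≈2) (≈-trans (≈-reflexive d≡k) (0 , 1 , refl))))
    two-apart : Q (i + L) ≡ Q i + 2
    two-apart = trans (sym Qd) (cong (Q i +_) d≡2)

  negative-ends : (j : Fin k) → ∃[ P ] ∃[ P′ ] Joins G (ι (k ↑ʳ j)) P P′ × pos G (ι (k ↑ʳ j)) ≡ false × φ P ≡ j × φ P′ ≡ suc (suc (toℕ j)) mod k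
  negative-ends j with Joins-unique {G = FC} {e = k ↑ʳ j} (incid (k ↑ʳ j)) (inj₁ (FC-negative j))
  ... | inj₁ (p , q) = _ , _ , inj₁ refl , trans (sym (sign (k ↑ʳ j))) (FC-neg j) , p , q
  ... | inj₂ (p , q) = _ , _ , inj₂ refl , trans (sym (sign (k ↑ʳ j))) (FC-neg j) , q , p

  obstruction : Obstruction
  obstruction = record { k′ = k′ ; 5≤k = 5≤k ; odd = odd ; Q = Q ; Q-slow = Q-slow ; Q-N = Q-+N ; chord = chord oriented }
    where
    α-idx : ∀ {P} {j : Fin k} → φ P ≡ j → α (idx P) ≈ toℕ j [mod k ]
    α-idx {P} p = ≈-reflexive (cong toℕ (trans (cong φ (V-idx P)) p))
    chord : (∃[ u ] Forward k N α γ Q u) ⊎ (∃[ u ] Backward k N α γ Q u) → ∀ q → ∃[ e ] ∃[ u ] ∃[ L ] IsArc e u L × Q u ≈ q [mod k ] × Q (u + L) ≡ Q u + 2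
    chord (inj₁ (u , f , _)) q with P , P′ , J , neg , p , p′ ← negative-ends ((u + q) mod k) =
      arc-of {P = P} {P′} q neg J (≈-cancelˡ u (≈-trans (≈-sym (f (idx P) (ℕ.<⇒≤ (idx< P)))) (≈-trans (α-idx p) (toℕ-mod≈ (u + q)))))
        (≈-cancelˡ u (≈-trans (≈-sym (f (idx P′) (ℕ.<⇒≤ (idx< P′)))) (≈-trans (α-idx p′) (≈-trans (toℕ-mod≈ _)
          (≈-trans (≈-suc (≈-suc (≈-trans (≈-sym (α-idx p)) (f (idx P) (ℕ.<⇒≤ (idx< P)))))) (≈-reflexive (two-more u (Q (idx P)))))))))
      where
      two-more : ∀ u q → suc (suc (u + q)) ≡ u + (q + 2)
      two-more = solve-∀
    -- On a backward walk label and count add up to `u`, so each chord is read from its far end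
    -- `P′`, with label j + 2. Class `q` thus needs j = u - q - 2, where `k′` again stands for -1.
    chord (inj₂ (u , f , _)) q with P , P′ , J , neg , p , p′ ← negative-ends ((u + k′ * (2 + q)) mod k) =
      arc-of {P = P′} {P} q neg (Joins-sym {G = G} {e = ι (k ↑ʳ ((u + k′ * (2 + q)) mod k))} J) at
        (≈-cancelˡ (toℕ j) (≈-trans (≈-trans (≈-+ (≈-sym (α-idx p)) ≈-refl) (f (idx P) (ℕ.<⇒≤ (idx< P)))) (≈-sym (≈-trans (≈-reflexive (two-less (toℕ j) (Q (idx P′)))) P′-at))))
      where
      j = (u + k′ * (2 + q)) mod k
      two-less : ∀ j q → j + (q + 2) ≡ suc (suc j) + q
      two-less = solve-∀
      P′-at : suc (suc (toℕ j)) + Q (idx P′) ≈ u [mod k ]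
      P′-at = ≈-trans (≈-+ (≈-sym (≈-trans (α-idx p′) (toℕ-mod≈ _))) ≈-refl) (f (idx P′) (ℕ.<⇒≤ (idx< P′)))
      at : Q (idx P′) ≈ q [mod k ]
      at = ≈-cancelˡ (suc (suc (toℕ j))) (≈-trans P′-at (≈-sym (≈-trans (≈-+ (≈-suc (≈-suc (toℕ-mod≈ (u + k′ * (2 + q))))) ≈-refl) (0 , 2 + q , full u k′ q))))
        where
        full : ∀ u k′ q → suc (suc (u + k′ * (2 + q))) + q + 0 ≡ u + (2 + q) * suc k′
        full = solve-∀

minor⇒obstruction : ∀ {n m} {G : SGraph n m} (K : Circle G) → HasOddFlowCircuitMinor5 G → Obstructions.Obstruction K
minor⇒obstruction {G = G} K (k′ , 5≤k , odd , n′ , m′ , H , S , iso) with minor⇒contraction (circle-posCount K) S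
-- `H` would have fewer positive edges than vertices, but the flow circuit does not.
... | inj₁ few = ⊥-elim (ℕ.<⇒≱ few (ℕ.≤-trans n′≤k (ℕ.≤-trans (flowCircuit-posCount k′) (ℕ.≤-reflexive same))))
  where
  open Iso iso
  n′≤k : n′ ≤ suc k′
  n′≤k = injective⇒≤ {f = Inverse.to fV} (Injection.injective (↔⇒↣ fV))
  same : posCount (flowCircuit k′) ≡ posCount H
  same = trans (sum-permute (λ e → weight (pos (flowCircuit k′) e)) fE) (sum-cong-≗ λ e → cong weight (signs e))
... | inj₂ (_ , C) = Model.obstruction K k′ 5≤k odd (to fV ∘ φ) (ι ∘ from fE)
    (λ p → trans (sym (inverseˡ fE refl)) (trans (cong (to fE) (ι-inj p)) (inverseˡ fE refl)))
    (λ a → subst₂ (λ b p → Joins (flowCircuit k′) b (to fV (proj₁ p)) (to fV (proj₂ p))) (inverseˡ fE refl) (ends-φ (from fE a)) (incid (from fE a)))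
    (λ a → trans (cong (pos (flowCircuit k′)) (sym (inverseˡ fE refl))) (trans (signs (from fE a)) (sign (from fE a))))
    lost′
  where
  open Iso iso
  open Inverse
  open Contraction C
  lost′ : ∀ f → pos G f ≡ true → (∃[ a ] ι (from fE a) ≡ f) ⊎ to fV (φ (proj₁ (ends G f))) ≡ to fV (φ (proj₂ (ends G f)))
  lost′ f p with lost f p
  ... | inj₁ (e , q) = inj₁ (to fE e , trans (cong ι (inverseʳ fE refl)) q)
  ... | inj₂ q = inj₂ (cong (to fV) q)

-- From obstructions to fractional vertices

parity : ∀ k → (∃[ h ] k ≡ h * 2) ⊎ (∃[ h ] k ≡ suc (h * 2))
parity zero = inj₁ (0 , refl)
parity (suc k) with parity k
... | inj₁ (h , refl) = inj₂ (h , refl)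
... | inj₂ (h , refl) = inj₁ (suc h , refl)

½-not-int : ¬ IsInt ½
½-not-int (t , p) with () ← cong ℚ.denominator-1 (trans p (int-mkℚ t))

nonneg-sum-zero : ∀ {p q} → 0ℚ ℚ.≤ p → 0ℚ ℚ.≤ q → p ℚ.+ q ≡ 0ℚ → p ≡ 0ℚ
nonneg-sum-zero {p} {q} p≥0 q≥0 e = ℚ.≤-antisym (≤-by q≥0 (trans (b≡a+b-a p q) (cong (ℚ._- p) e))) p≥0

double : ∀ x y z → x ≡ ½ ℚ.* (y ℚ.+ z) → y ℚ.+ z ≡ x ℚ.+ x
double x y z refl = halves y z
  where
  halves : ∀ y z → y ℚ.+ z ≡ ½ ℚ.* (y ℚ.+ z) ℚ.+ ½ ℚ.* (y ℚ.+ z)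
  halves = RS.solve-∀ ℚ-ring

midpoint-≡ : ∀ {x y z} → x ≡ ½ ℚ.* (y ℚ.+ z) → x ℚ.≤ y → x ℚ.≤ z → y ≡ x
midpoint-≡ {x} {y} {z} m x≤y x≤z = diff≡0⇒≡ (nonneg-sum-zero (≤⇒0≤ x≤y) (≤⇒0≤ x≤z)
  (trans (regroup x y z) (≡⇒diff≡0 (double x y z m))))
  where
  regroup : ∀ x y z → (y ℚ.- x) ℚ.+ (z ℚ.- x) ≡ (y ℚ.+ z) ℚ.- (x ℚ.+ x)
  regroup = RS.solve-∀ ℚ-ring

module HalfIntegral {n m} {G : SGraph n m} (K : Circle G) (O : Obstructions.Obstruction K) where
  open Obstructions K
  open Obstruction O
  open Quotient K O using (Q-+N; Q-mono; Kept)
  private k = suc k′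

  h : ℕ → ℚ
  h i = ½ ℚ.* nat (Q i)

  h-qp : QuasiPeriodic N h (½ ℚ.* nat k)
  h-qp = quasiPeriodic λ i → trans (cong (λ q → ½ ℚ.* nat q) (Q-N i)) (trans (cong (½ ℚ.*_) (nat-+ (Q i) k)) (ℚ.*-distribˡ-+ ½ (nat (Q i)) (nat k)))

  Q-qp : QuasiPeriodic N (nat ∘ Q) (nat k)
  Q-qp = quasiPeriodic λ i → trans (cong nat (Q-N i)) (nat-+ (Q i) k)

  rise-nat : ∀ {u L d} → Q (u + L) ≡ Q u + d → rise (nat ∘ Q) u L ≡ nat d
  rise-nat {u} {L} {d} p = trans (cong (ℚ._- nat (Q u)) (trans (cong nat p) (nat-+ (Q u) d))) (a+b-a≡b (nat (Q u)) (nat d))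

  rise-h : ∀ {u L d} → Q (u + L) ≡ Q u + d → rise h u L ≡ ½ ℚ.* nat d
  rise-h {u} {L} {d} p = trans (factor (nat (Q (u + L))) (nat (Q u))) (cong (½ ℚ.*_) (rise-nat {u} {L} p))
    where
    factor : ∀ a b → ½ ℚ.* a ℚ.- ½ ℚ.* b ≡ ½ ℚ.* (a ℚ.- b)
    factor = RS.solve-∀ ℚ-ring

  Span : Fin m → ℕ → Set
  Span e d = ∃[ u ] ∃[ L ] IsArc e (toℕ {N} u) (toℕ {N} L) × Q (toℕ u + toℕ L) ≡ Q (toℕ u) + d

  span? : ∀ e d → Dec (Span e d)
  span? e d = any? λ u → any? λ L → arc? e (toℕ u) (toℕ L) ×-dec (Q (toℕ u + toℕ L) ℕ.≟ Q (toℕ u) + d)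

  span : ∀ {e u L d} → IsArc e u L → u < N → Q (u + L) ≡ Q u + d → Span e d
  span {e} {u} {L} {d} a u<N p = fromℕ< u<N , fromℕ< (IsArc.short a) ,
    subst₂ (λ u L → IsArc e u L × Q (u + L) ≡ Q u + d) (sym (toℕ-fromℕ< u<N)) (sym (toℕ-fromℕ< (IsArc.short a))) (a , p)

  -- The least weight making all flows through a negative edge have weight ≥ 1,
  -- when every kept positive edge has weight ½.
  negWeight : ∀ {e} → Dec (Span e 0) → Dec (Span e 1) → ℚ
  negWeight (yes _) _       = 1ℚ
  negWeight (no _)  (yes _) = ½
  negWeight (no _)  (no _)  = 0ℚ

  weight′ : Bool → Fin m → ℚ
  weight′ true  e = h (suc (posIdx e)) ℚ.- h (posIdx e)
  weight′ false e = negWeight (span? e 0) (span? e 1)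

  x : Fin m → ℚ
  x e = weight′ (pos G e) e

  x-E : ∀ i → x (E i) ≡ h (suc i) ℚ.- h i
  x-E i = trans (cong (λ b → weight′ b (E i)) (E-pos i)) (trans (sym (one (posIdx (E i)))) (trans (rise-cong h-qp 1 (posIdx-E i)) (one i)))
    where
    one : ∀ i → rise h i 1 ≡ h (suc i) ℚ.- h i
    one i = cong (λ z → h z ℚ.- h i) (ℕ.+-comm i 1)

  x-neg : ∀ {e} → pos G e ≡ false → x e ≡ negWeight (span? e 0) (span? e 1)
  x-neg {e} p = cong (λ b → weight′ b e) p

  arcSum-h : ∀ u L → arcSum x u L ≡ rise h u L
  arcSum-h u L = arcSum-rise x h u L λ i → trans (a≡b+[a-b] (h (suc i)) (h i)) (cong (h i ℚ.+_) (sym (x-E i)))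

  ½≥0 : 0ℚ ℚ.≤ ½
  ½≥0 = ℚ.nonNegative⁻¹ ½

  x-kept : ∀ {i} → Kept i → x (E i) ≡ ½
  x-kept {i} p = trans (x-E i) (trans (cong (λ z → ½ ℚ.* z ℚ.- h i) (trans (cong nat p) (trans (nat-+ 1 (Q i)) (cong (ℚ._+ nat (Q i)) nat-1)))) (half (nat (Q i))))
    where
    half : ∀ q → ½ ℚ.* (1ℚ ℚ.+ q) ℚ.- ½ ℚ.* q ≡ ½
    half = RS.solve-∀ ℚ-ring

  x-flat : ∀ {i} → Q (suc i) ≡ Q i → x (E i) ≡ 0ℚ
  x-flat {i} p = trans (x-E i) (≡⇒diff≡0 (cong (λ q → ½ ℚ.* nat q) p))

  negWeight≥0 : ∀ {e} (d₀ : Dec (Span e 0)) (d₁ : Dec (Span e 1)) → 0ℚ ℚ.≤ negWeight d₀ d₁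
  negWeight≥0 (yes _) _       = ℚ.nonNegative⁻¹ 1ℚ
  negWeight≥0 (no _)  (yes _) = ½≥0
  negWeight≥0 (no _)  (no _)  = ℚ.≤-refl

  x≥0 : ∀ e → 0ℚ ℚ.≤ x e
  x≥0 e = go (pos G e) refl
    where
    go : ∀ b → pos G e ≡ b → 0ℚ ℚ.≤ x e
    go false p = subst (0ℚ ℚ.≤_) (sym (x-neg p)) (negWeight≥0 (span? e 0) (span? e 1))
    go true  p with Q-slow (posIdx e)
    ... | inj₁ q = subst (0ℚ ℚ.≤_) (trans (sym (x-flat q)) (cong x (E-posIdx e p))) ℚ.≤-refl
    ... | inj₂ q = subst (0ℚ ℚ.≤_) (trans (sym (x-kept q)) (cong x (E-posIdx e p))) ½≥0

  x-InP : InP G x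
  x-InP = arc-InP x≥0 λ {e} {u} {L} a u<N → let d = Q (u + L) ∸ Q u ; p = sym (ℕ.m+[n∸m]≡n (Q-mono (ℕ.m≤m+n u L))) in
    subst (1ℚ ℚ.≤_) (sym (cong₂ ℚ._+_ (x-neg (IsArc.neg a)) (trans (arcSum-h u L) (rise-h {u} {L} p)))) (enough a u<N d p (span? e 0) (span? e 1))
    where
    enough : ∀ {e u L} → IsArc e u L → u < N → ∀ d → Q (u + L) ≡ Q u + d → ∀ (d₀ : Dec (Span e 0)) (d₁ : Dec (Span e 1)) →
      1ℚ ℚ.≤ negWeight d₀ d₁ ℚ.+ ½ ℚ.* nat d
    enough a u<N d p (yes _) _ = ≤-by (*-nonneg ½≥0 (0≤nat d)) (b≡a+b-a 1ℚ (½ ℚ.* nat d))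
    enough a u<N zero p (no ¬0) _ = contradiction (span a u<N p) ¬0
    enough a u<N (suc zero) p (no _) (yes _) = ℚ.≤-reflexive (cong (λ z → ½ ℚ.+ ½ ℚ.* z) (sym nat-1))
    enough a u<N (suc zero) p (no _) (no ¬1) = contradiction (span a u<N p) ¬1
    enough {e} a u<N (suc (suc d)) p (no ¬0) d₁ = ≤-by (+-nonneg (negWeight≥0 (no ¬0) d₁) (*-nonneg ½≥0 (0≤nat d)))
        (trans (regroup (negWeight (no ¬0) d₁) (nat d)) (cong (λ z → (negWeight {e} (no ¬0) d₁ ℚ.+ ½ ℚ.* z) ℚ.- 1ℚ)
          (trans (cong (λ z → (z ℚ.+ z) ℚ.+ nat d) (sym nat-1)) (trans (cong (ℚ._+ nat d) (sym (nat-+ 1 1))) (sym (nat-+ 2 d))))))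
      where
      regroup : ∀ a b → a ℚ.+ ½ ℚ.* b ≡ (a ℚ.+ ½ ℚ.* ((1ℚ ℚ.+ 1ℚ) ℚ.+ b)) ℚ.- 1ℚ
      regroup = RS.solve-∀ ℚ-ring

  -- The other arc of such an edge has `Q` rising by k - 2 ≥ 3, so no arc of it rises by less than
  -- 2.
  chord-weight : ∀ {e u L} → IsArc e u L → Q (u + L) ≡ Q u + 2 → x e ≡ 0ℚ
  chord-weight {e} {u} {L} a p = trans (x-neg (IsArc.neg a)) (zero′ (span? e 0) (span? e 1))
    where
    wide : ∀ {d} → d < 2 → ¬ Span e d
    wide {d} d<2 (u′ , L′ , a′ , p′) with arc-rise a a′
    ... | inj₁ same = ℕ.<⇒≢ d<2 (nat-injective (trans (sym (rise-nat {toℕ u′} {toℕ L′} p′)) (trans (sym (same Q-qp)) (rise-nat {u} {L} p))))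
    ... | inj₂ opp = ℕ.<⇒≱ (subst (_< 5) total-k (s≤s (s≤s (ℕ.≤-trans d<2 (s≤s (s≤s z≤n)))))) 5≤k
      where
      total-k : 2 + d ≡ k
      total-k = nat-injective (trans (nat-+ 2 d) (trans (sym (cong₂ ℚ._+_ (rise-nat {u} {L} p) (rise-nat {toℕ u′} {toℕ L′} p′))) (opp Q-qp)))
    zero′ : (d₀ : Dec (Span e 0)) (d₁ : Dec (Span e 1)) → negWeight d₀ d₁ ≡ 0ℚ
    zero′ (yes s) _       = contradiction s (wide (s≤s z≤n))
    zero′ (no _)  (yes s) = contradiction s (wide (s≤s (s≤s z≤n)))
    zero′ (no _)  (no _)  = refl

  module Determined {y : Fin m → ℚ} (y-InP : InP G y)
    (flat : ∀ {i} → Q (suc i) ≡ Q i → y (E i) ≡ 0ℚ) where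
    Y : ℕ → ℚ
    Y = coord y

    level : ∀ {i j} → i ≤ j → Q i ≡ Q j → Y i ≡ Y j
    level {i} {j} i≤j p = trans (go (j ∸ i) (trans (cong Q (ℕ.m+[n∸m]≡n i≤j)) (sym p))) (cong Y (ℕ.m+[n∸m]≡n i≤j))
      where
      go : ∀ d → Q (i + d) ≡ Q i → Y i ≡ Y (i + d)
      go zero q = cong Y (sym (ℕ.+-identityʳ i))
      go (suc d) q = trans (go d Qd) (trans (trans (sym (ℚ.+-identityʳ _)) (cong (Y (i + d) ℚ.+_) (sym (flat (trans (sym (cong Q (ℕ.+-suc i d))) (trans q (sym Qd))))))) (cong Y (sym (ℕ.+-suc i d))))
        where
        Qd : Q (i + d) ≡ Q i
        Qd = ℕ.≤-antisym (ℕ.≤-trans (Q-mono (ℕ.≤-trans (ℕ.n≤1+n (i + d)) (ℕ.≤-reflexive (sym (ℕ.+-suc i d))))) (ℕ.≤-reflexive q)) (Q-mono (ℕ.m≤m+n i d))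

    level′ : ∀ {i j} → Q i ≡ Q j → Y i ≡ Y j
    level′ {i} {j} p with ℕ.≤-total i j
    ... | inj₁ i≤j = level i≤j p
    ... | inj₂ j≤i = sym (level j≤i (sym p))

    -- `Y` depends on the value of `Q` alone, so the stretch may be replaced by the arc of the chord
    -- of its class, whose flow inequality receives nothing from the chord itself.
    double-step : (∀ {e u L} → IsArc e u L → Q (u + L) ≡ Q u + 2 → y e ≡ 0ℚ) →
      ∀ {i L} → Q (i + L) ≡ Q i + 2 → 1ℚ ℚ.≤ rise Y i L
    double-step chords {i} {L} p with e , u , L′ , a , (s , t , q) , r ← chord (Q i) =
      subst (1ℚ ℚ.≤_) (trans (cong (ℚ._+ rise Y u L′) (chords a r)) (trans (ℚ.+-identityˡ _) (begin
        rise Y u L′               ≡⟨ rise-+N (coord-qp y) s u L′ ⟨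
        rise Y (u + s * N) L′     ≡⟨ cong₂ ℚ._-_ (level′ top) (level′ bottom) ⟩
        rise Y (i + t * N) L      ≡⟨ rise-+N (coord-qp y) t i L ⟩
        rise Y i L ∎))) (InP-rise y-InP a)
      where
      open ≡-Reasoning
      bottom : Q (u + s * N) ≡ Q (i + t * N)
      bottom = trans (Q-+N s u) (trans q (sym (Q-+N t i)))
      top : Q (u + s * N + L′) ≡ Q (i + t * N + L)
      top = begin
        Q (u + s * N + L′)    ≡⟨ cong Q (a+b+c≡a+c+b u (s * N) L′) ⟩
        Q (u + L′ + s * N)    ≡⟨ Q-+N s (u + L′) ⟩
        Q (u + L′) + s * k    ≡⟨ cong (_+ s * k) r ⟩
        Q u + 2 + s * k       ≡⟨ a+b+c≡a+c+b (Q u) 2 (s * k) ⟩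
        Q u + s * k + 2       ≡⟨ cong (_+ 2) q ⟩
        Q i + t * k + 2       ≡⟨ a+b+c≡a+c+b (Q i) (t * k) 2 ⟩
        Q i + 2 + t * k       ≡⟨ cong (_+ t * k) p ⟨
        Q (i + L) + t * k     ≡⟨ Q-+N t (i + L) ⟨
        Q (i + L + t * N)     ≡⟨ cong Q (a+b+c≡a+c+b i L (t * N)) ⟩
        Q (i + t * N + L) ∎

    -- b (q + 2) = b q + 1 and b (q + k) = b q + total with k odd force
    -- b (q + 1) − b q to be independent of q, hence ½.
    module Exact (exact : ∀ {i L} → Q (i + L) ≡ Q i + 2 → rise Y i L ≡ 1ℚ) where
      position : ∀ q → ∃[ s ] Q s ≡ Q 0 + q
      position q = let s , _ , Qs , _ = crossing Q (suc q * N) (λ s _ → Q-slow s) (Q 0 + q) (ℕ.m≤m+n (Q 0) q)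
                         (subst (Q 0 + q <_) (sym (Q-+N (suc q) 0)) (ℕ.+-monoʳ-< (Q 0) (ℕ.m≤m*n (suc q) k))) in s , Qs

      b : ℕ → ℚ
      b q = Y (proj₁ (position q))

      b-at : ∀ {i q} → Q i ≡ Q 0 + q → Y i ≡ b q
      b-at {i} {q} p = level′ (trans p (sym (proj₂ (position q))))

      b-2 : ∀ q → b (2 + q) ≡ b q ℚ.+ 1ℚ
      b-2 q = trans (a≡b+[a-b] (b (2 + q)) (b q)) (cong (b q ℚ.+_) (trans (cong (λ z → Y z ℚ.- b q) (sym (ℕ.m+[n∸m]≡n s≤t))) (exact gap)))
        where
        s = proj₁ (position q)
        t = proj₁ (position (2 + q))
        two-more : ∀ a q → a + (2 + q) ≡ a + q + 2
        two-more = solve-∀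
        Qt : Q t ≡ Q s + 2
        Qt = trans (proj₂ (position (2 + q))) (trans (two-more (Q 0) q) (cong (_+ 2) (sym (proj₂ (position q)))))
        s≤t : s ≤ t
        s≤t = ℕ.≮⇒≥ λ t<s → ℕ.<⇒≱ (ℕ.m<m+n (Q s) {2} (s≤s z≤n)) (subst (_≤ Q s) Qt (Q-mono (ℕ.<⇒≤ t<s)))
        gap : Q (s + (t ∸ s)) ≡ Q s + 2
        gap = trans (cong Q (ℕ.m+[n∸m]≡n s≤t)) Qt

      b-even : ∀ t q → b (t * 2 + q) ≡ b q ℚ.+ nat t
      b-even zero q = trans (sym (ℚ.+-identityʳ (b q))) (cong (b q ℚ.+_) (sym nat-0))
      b-even (suc t) q = trans (b-2 (t * 2 + q)) (trans (cong (ℚ._+ 1ℚ) (b-even t q)) (trans (ℚ.+-assoc (b q) (nat t) 1ℚ)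
        (cong (b q ℚ.+_) (trans (ℚ.+-comm (nat t) 1ℚ) (trans (cong (ℚ._+ nat t) (sym nat-1)) (sym (nat-+ 1 t)))))))

      b-k : ∀ q → b (k + q) ≡ b q ℚ.+ total y
      b-k q = trans (sym (b-at {proj₁ (position q) + N} (trans (Q-N _) (trans (cong (_+ k) (proj₂ (position q))) (swap (Q 0) q k)))))
                    (QuasiPeriodic.shift (coord-qp y) (proj₁ (position q)))
        where
        swap : ∀ a q k → a + q + k ≡ a + (k + q)
        swap = solve-∀

      b-1 : ∀ q → b (suc q) ℚ.- b q ≡ ½
      b-1 q with parity k
      ... | inj₁ (t , p) = contradiction (∣.divides t p) odd
      ... | inj₂ (t , p) = trans (halve (b (suc q)) (b q)) (trans (cong (½ ℚ.*_) twice) (ℚ.*-identityʳ ½))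
        where
        κ = nat (suc t) ℚ.- total y
        -- With k = 2 t + 1, the index k + (q + 1) = 2 (t + 1) + q is reached from q + 1 by a full
        -- turn and from `q` by t + 1 double steps.
        step : ∀ q → b (suc q) ℚ.- b q ≡ κ
        step q = trans (solve′ (b (suc q)) (total y) (b q)) (trans (cong (λ z → (z ℚ.- b q) ℚ.- total y)
          (trans (sym (b-k (suc q))) (trans (cong b (trans (cong (_+ suc q) p) (even t q))) (b-even (suc t) q)))) (solve″ (b q) (nat (suc t)) (total y)))
          where
          even : ∀ t q → suc (t * 2) + suc q ≡ suc t * 2 + q
          even = solve-∀
          solve′ : ∀ a t b → a ℚ.- b ≡ ((a ℚ.+ t) ℚ.- b) ℚ.- t
          solve′ = RS.solve-∀ ℚ-ring
          solve″ : ∀ b s t → ((b ℚ.+ s) ℚ.- b) ℚ.- t ≡ s ℚ.- t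
          solve″ = RS.solve-∀ ℚ-ring
        halve : ∀ a b → a ℚ.- b ≡ ½ ℚ.* ((a ℚ.- b) ℚ.+ (a ℚ.- b))
        halve = RS.solve-∀ ℚ-ring
        twice : (b (suc q) ℚ.- b q) ℚ.+ (b (suc q) ℚ.- b q) ≡ 1ℚ
        twice = trans (cong (ℚ._+ (b (suc q) ℚ.- b q)) (trans (step q) (sym (step (suc q)))))
          (trans (glue (b (2 + q)) (b (suc q)) (b q)) (trans (cong (ℚ._- b q) (b-2 q)) (a+b-a≡b (b q) 1ℚ)))
          where
          glue : ∀ a b c → (a ℚ.- b) ℚ.+ (b ℚ.- c) ≡ a ℚ.- c
          glue = RS.solve-∀ ℚ-ring

      y-E : ∀ i → y (E i) ≡ x (E i)
      y-E i with Q-slow i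
      ... | inj₁ p = trans (flat p) (sym (x-flat p))
      ... | inj₂ p = trans (b≡a+b-a (Y i) (y (E i))) (trans (cong₂ ℚ._-_ (b-at Qsi) (b-at Qi)) (trans (b-1 q) (sym (x-kept p))))
        where
        q = Q i ∸ Q 0
        Qi : Q i ≡ Q 0 + q
        Qi = sym (ℕ.m+[n∸m]≡n (Q-mono z≤n))
        Qsi : Q (suc i) ≡ Q 0 + suc q
        Qsi = trans p (trans (cong suc Qi) (sym (ℕ.+-suc (Q 0) q)))

      -- As `y` agrees with `x` on the positive edges, the arc that determined the weight of `e` in
      -- `x` demands at least this weight from `y` as well.
      y-neg : ∀ {e} → pos G e ≡ false → x e ℚ.≤ y e
      y-neg {e} neg = subst (ℚ._≤ y e) (sym (x-neg neg)) (bound (span? e 0) (span? e 1))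
        where
        least-weight : ∀ {d} w → w ℚ.+ ½ ℚ.* nat d ≡ 1ℚ → Span e d → w ℚ.≤ y e
        least-weight {d} w eq (u , L , a , p) = ≤-by (≤⇒0≤ (InP-arc y-InP a)) (trans (cong₂ (λ r o → (y e ℚ.+ r) ℚ.- o)
            (trans (pre-cong (toℕ L) (λ s _ → y-E (toℕ u + s))) (trans (arcSum-h (toℕ u) (toℕ L)) (rise-h {toℕ u} {toℕ L} p))) (sym eq)) (cancel (y e) (½ ℚ.* nat d) w))
          where
          cancel : ∀ y r w → (y ℚ.+ r) ℚ.- (w ℚ.+ r) ≡ y ℚ.- w
          cancel = RS.solve-∀ ℚ-ring
        bound : (d₀ : Dec (Span e 0)) (d₁ : Dec (Span e 1)) → negWeight d₀ d₁ ℚ.≤ y e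
        bound (yes s) _       = least-weight {0} 1ℚ (cong (λ z → 1ℚ ℚ.+ ½ ℚ.* z) nat-0) s
        bound (no _)  (yes s) = least-weight {1} ½ (cong (λ z → ½ ℚ.+ ½ ℚ.* z) nat-1) s
        bound (no _)  (no _)  = proj₁ y-InP e

  -- Where `x` vanishes, so do `y` and `z`. Along a double step both have length at least 1 and mean
  -- 1, so both are exact, which fixes them on the positive edges; on a negative edge both are at
  -- least `x`, their mean.
  x-vertex : IsVertex G x
  x-vertex = x-InP , unique
    where
    unique : ∀ (y z : Fin m → ℚ) → InP G y → InP G z → (∀ e → x e ≡ ½ ℚ.* (y e ℚ.+ z e)) → ∀ e → y e ≡ z e
    unique y z y-InP z-InP mid e = go (pos G e) refl
      where
      zero-left : ∀ {e} → x e ≡ 0ℚ → y e ≡ 0ℚ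
      zero-left {e} p = trans (midpoint-≡ (mid e) (subst (ℚ._≤ y e) (sym p) (proj₁ y-InP e)) (subst (ℚ._≤ z e) (sym p) (proj₁ z-InP e))) p
      mid′ : ∀ e → x e ≡ ½ ℚ.* (z e ℚ.+ y e)
      mid′ e = trans (mid e) (cong (½ ℚ.*_) (ℚ.+-comm (y e) (z e)))
      zero-right : ∀ {e} → x e ≡ 0ℚ → z e ≡ 0ℚ
      zero-right {e} p = trans (midpoint-≡ (mid′ e) (subst (ℚ._≤ z e) (sym p) (proj₁ z-InP e)) (subst (ℚ._≤ y e) (sym p) (proj₁ y-InP e))) p

      module DY = Determined y-InP (λ p → zero-left (x-flat p))
      module DZ = Determined z-InP (λ p → zero-right (x-flat p))

      coord-mid : ∀ i → coord x i ≡ ½ ℚ.* (coord y i ℚ.+ coord z i)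
      coord-mid zero = refl
      coord-mid (suc i) = trans (cong₂ ℚ._+_ (coord-mid i) (mid (E i))) (regroup (coord y i) (coord z i) (y (E i)) (z (E i)))
        where
        regroup : ∀ a b c d → ½ ℚ.* (a ℚ.+ b) ℚ.+ ½ ℚ.* (c ℚ.+ d) ≡ ½ ℚ.* ((a ℚ.+ c) ℚ.+ (b ℚ.+ d))
        regroup = RS.solve-∀ ℚ-ring

      rise-mid : ∀ {i L} → Q (i + L) ≡ Q i + 2 → 1ℚ ≡ ½ ℚ.* (rise DY.Y i L ℚ.+ rise DZ.Y i L)
      rise-mid {i} {L} p = trans (sym (trans (arcSum-h i L) (trans (rise-h {i} {L} p) (trans (cong (½ ℚ.*_) (trans (nat-+ 1 1) (cong (λ o → o ℚ.+ o) nat-1))) refl))))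
        (trans (arcSum-rise x (coord x) i L (λ _ → refl)) (trans (cong₂ ℚ._-_ (coord-mid (i + L)) (coord-mid i)) (regroup (coord y (i + L)) (coord z (i + L)) (coord y i) (coord z i))))
        where
        regroup : ∀ a b c d → ½ ℚ.* (a ℚ.+ b) ℚ.- ½ ℚ.* (c ℚ.+ d) ≡ ½ ℚ.* ((a ℚ.- c) ℚ.+ (b ℚ.- d))
        regroup = RS.solve-∀ ℚ-ring

      y≥1 : ∀ {i L} → Q (i + L) ≡ Q i + 2 → 1ℚ ℚ.≤ rise DY.Y i L
      y≥1 {i} {L} = DY.double-step (λ a p → zero-left (chord-weight a p)) {i} {L}
      z≥1 : ∀ {i L} → Q (i + L) ≡ Q i + 2 → 1ℚ ℚ.≤ rise DZ.Y i L
      z≥1 {i} {L} = DZ.double-step (λ a p → zero-right (chord-weight a p)) {i} {L}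

      module SY = DY.Exact (λ {i} {L} p → midpoint-≡ (rise-mid {i} {L} p) (y≥1 {i} {L} p) (z≥1 {i} {L} p))
      module SZ = DZ.Exact (λ {i} {L} p → midpoint-≡ (trans (rise-mid {i} {L} p) (cong (½ ℚ.*_) (ℚ.+-comm (rise DY.Y i L) (rise DZ.Y i L)))) (z≥1 {i} {L} p) (y≥1 {i} {L} p))

      go : ∀ b → pos G e ≡ b → y e ≡ z e
      go true p = subst (λ f → y f ≡ z f) (E-posIdx e p) (trans (SY.y-E (posIdx e)) (sym (SZ.y-E (posIdx e))))
      go false p = trans (midpoint-≡ (mid e) (SY.y-neg p) (SZ.y-neg p)) (sym (midpoint-≡ (mid′ e) (SZ.y-neg p) (SY.y-neg p)))

  not-ideal : ¬ FlowIdeal G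
  not-ideal ideal = ½-not-int (subst IsInt (x-kept (proj₁ (proj₂ kept))) (t , trans (proj₂ (ideal x x-vertex (E s))) (sym (int-/1 t))))
    where
    kept = Quotient.keep K O 0
    s = proj₁ kept
    t = proj₁ (ideal x x-vertex (E s))

obstruction⇒¬ideal : ∀ {n m} {G : SGraph n m} (K : Circle G) → Obstructions.Obstruction K → ¬ FlowIdeal G
obstruction⇒¬ideal K O = HalfIntegral.not-ideal K O

-- Vertices with integral positive part

module Integrality {n m} {G : SGraph n m} (K : Circle G) where
  open Obstructions K

  -- A non-integral negative edge lies on no tight arc, so it can be perturbed alone.
  vertex-integral : ∀ {x} → IsVertex G x → (∀ i → IsInt (x (E i))) → ∀ e → IsInt (x e)
  vertex-integral {x} vx ints e = go (pos G e) refl (IsInt? (x e))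
    where
    spike : ∀ {f} → Dec (f ≡ e) → ℚ
    spike (yes _) = 1ℚ
    spike (no _)  = 0ℚ

    D : Fin m → ℚ
    D f = spike (f ≟F e)

    coord-int : ∀ i → IsInt (coord x i)
    coord-int zero    = ℤ.+ 0 , sym nat-0
    coord-int (suc i) = IsInt-+ (coord-int i) (ints i)

    go : ∀ b → pos G e ≡ b → Dec (IsInt (x e)) → IsInt (x e)
    go true  p _ = subst (IsInt ∘ x) (E-posIdx e p) (ints (posIdx e))
    go false p (yes i) = i
    go false p (no ¬i) = contradiction (trans (sym (D-e (e ≟F e))) (perturb vx D (λ f → zeros f (f ≟F e)) tight e)) ℚ.1≢0
      where
      D-e : (d : Dec (e ≡ e)) → spike d ≡ 1ℚ
      D-e (yes _) = refl
      D-e (no e≢e) = contradiction refl e≢e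
      zeros : ∀ f (d : Dec (f ≡ e)) → x f ≡ 0ℚ → spike d ≡ 0ℚ
      zeros f (yes refl) z = contradiction (ℤ.+ 0 , trans z (sym nat-0)) ¬i
      zeros f (no _) z = refl
      D-E : ∀ i (d : Dec (E i ≡ e)) → spike d ≡ 0ℚ
      D-E i (yes q) = contradiction (trans (sym (E-pos i)) (trans (cong (pos G) q) p)) λ ()
      D-E i (no _) = refl
      arcD : ∀ u L → arcSum D u L ≡ 0ℚ
      arcD u zero = refl
      arcD u (suc L) = cong₂ ℚ._+_ (arcD u L) (D-E (u + L) (E (u + L) ≟F e))
      tight : ∀ {f u L} → IsArc f u L → u < N → x f ℚ.+ arcSum x u L ≡ 1ℚ → D f ℚ.+ arcSum D u L ≡ 0ℚ
      tight {f} {u} {L} a _ t = trans (cong (D f ℚ.+_) (arcD u L)) (trans (ℚ.+-identityʳ (D f)) (D-f (f ≟F e)))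
        where
        move : ∀ a b → a ≡ (a ℚ.+ b) ℚ.- b
        move = RS.solve-∀ ℚ-ring
        D-f : (d : Dec (f ≡ e)) → spike d ≡ 0ℚ
        D-f (no _) = refl
        -- On a tight arc x e would be 1 minus an integral arc sum.
        D-f (yes refl) = contradiction (subst IsInt (sym (trans (move (x f) (arcSum x u L)) (cong (ℚ._- arcSum x u L) t)))
          (IsInt-minus (ℤ.+ 1 , sym nat-1) (subst IsInt (sym (arcSum-rise x (coord x) u L (λ _ → refl))) (IsInt-minus (coord-int (u + L)) (coord-int u))))) ¬i

  ideal : ¬ Obstruction → FlowIdeal G
  ideal none x vx e with winding-or-integral vx
  ... | inj₁ W = ⊥-elim (winding⇒obstruction W none)
  ... | inj₂ ints with t , p ← vertex-integral vx ints e = t , trans p (int-/1 t)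

theorem3 : ∀ {n m : ℕ} (G : SGraph n m) → PosIsCircuit G →
    (FlowIdeal G ⇔ (¬ HasOddFlowCircuitMinor5 G))
theorem3 G circuit = mk⇔
  (λ flowIdeal minor → obstruction⇒¬ideal K (minor⇒obstruction K minor) flowIdeal)
  (λ noMinor → Integrality.ideal K (noMinor ∘ obstruction⇒minor K))
  where K = unroll circuit
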